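{- Fix an integer $n$ and $\varepsilon\in(1/n,1/30)$. Then every $n$-vertex graph $G=(V,E,w)$ with edge weights in the range $[1,W]$ admits a cut sketch of size $\tilde O(n\varepsilon^{ -1}\cdot\log\log W)$ bits with the ``for each'' guarantee. Specifically, for every query $S\subset V$ (equivalently, every $x\in\{0,1\}^n$), the sketch can produce, with high probability, a $(1+O(\varepsilon))$-approximation to $w(S,\bar S)$.
   Context: Graphs are undirected; $w(S,\bar S)$ is the total weight of edges of $G$ with exactly one endpoint in $S$. A cut sketch with the ``for each'' guarantee consists of a randomized map from graphs $G$ on $n$ vertices to bit strings $\mathrm{sk}(G)$, together with an estimation procedure which, given only $\mathrm{sk}(G)$ and a query $S\subset V$, outputs a number $\hat w$; the success probability is required for each fixed $G$ and $S$ separately. A $(1+O(\varepsilon))$-approximation means $(1-K\varepsilon)w(S,\bar S)\le\hat w\le(1+K\varepsilon)w(S,\bar S)$ for an absolute constant $K$. ``With high probability'' means with probability at least $1-1/n^{a}$ for some absolute constant $a\ge1$. $\tilde O(f)$ denotes $f\cdot(\log f)^{O(1)}$, with absolute constants. The factor $\log\log W$ is read as $\max\{1,\log\log W\}$. -}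

module Defs where

open import Data.Bool.Base using (Bool; true; false; not; _∧_; if_then_else_)
open import Data.Fin.Base using (Fin)
open import Data.Fin.Subset using (Subset; _∈_)
open import Data.Integer.Base using (+_)
open import Data.List.Base using (List; length)
open import Data.Nat.Base as ℕ using (ℕ; zero; suc)
import Data.Nat.Properties as ℕ
open import Data.Product.Base using (∃-syntax; _×_; _,_)
open import Data.Rational.Base as ℚ using (ℚ; 0ℚ; 1ℚ; ½)
import Data.Rational.Properties as ℚ
open import Data.Rational.Solver using (module +-*-Solver)
open import Data.Vec.Base using (lookup)
open import Data.Vec.Functional using (Vector; foldr)
open import Relation.Binary.PropositionalEquality
  using (_≡_; refl; sym; trans; cong; cong₂; subst)

-- Reals are Cauchy sequences of rationals, with equality _≃_.

IsCauchy : (ℕ → ℚ) → Set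
IsCauchy x = ∀ δ → 0ℚ ℚ.< δ →
  ∃[ N ] (∀ m n → N ℕ.≤ m → N ℕ.≤ n → ℚ.∣ x m ℚ.- x n ∣ ℚ.≤ δ)

record ℝ : Set where
  constructor mkℝ
  field
    seq    : ℕ → ℚ
    cauchy : IsCauchy seq

open ℝ public

infix 4 _≤_ _<_ _≃_

_≤_ : ℝ → ℝ → Set
x ≤ y = ∀ δ → 0ℚ ℚ.< δ → ∃[ N ] (∀ n → N ℕ.≤ n → seq x n ℚ.≤ seq y n ℚ.+ δ)

_<_ : ℝ → ℝ → Set
x < y = ∃[ δ ] (0ℚ ℚ.< δ × ∃[ N ] (∀ n → N ℕ.≤ n → seq x n ℚ.+ δ ℚ.≤ seq y n))

_≃_ : ℝ → ℝ → Set
x ≃ y = x ≤ y × y ≤ x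

fromℚ : ℚ → ℝ
fromℚ q = mkℝ (λ _ → q) λ δ 0<δ →
  0 , λ _ _ _ _ → subst (ℚ._≤ δ) (sym (cong ℚ.∣_∣ (ℚ.+-inverseʳ q))) (ℚ.<⇒≤ 0<δ)

fromℕ : ℕ → ℝ
fromℕ n = fromℚ (+ n ℚ./ 1)

0ℝ 1ℝ : ℝ
0ℝ = fromℚ 0ℚ
1ℝ = fromℚ 1ℚ

private
  half-pos : ∀ {δ} → 0ℚ ℚ.< δ → 0ℚ ℚ.< ½ ℚ.* δ
  half-pos {δ} 0<δ = subst (ℚ._< ½ ℚ.* δ) (ℚ.*-zeroʳ ½) (ℚ.*-monoʳ-<-pos ½ 0<δ)

  halves : ∀ δ → ½ ℚ.* δ ℚ.+ ½ ℚ.* δ ≡ δ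
  halves δ = trans (sym (ℚ.*-distribʳ-+ δ ½ ½)) (ℚ.*-identityˡ δ)

  module _ where
    open +-*-Solver

    sum-difference : ∀ a b c d → (a ℚ.+ b) ℚ.- (c ℚ.+ d) ≡ (a ℚ.- c) ℚ.+ (b ℚ.- d)
    sum-difference =
      solve 4 (λ a b c d → (a :+ b) :- (c :+ d) := (a :- c) :+ (b :- d)) refl

    product-difference : ∀ a b c d →
      a ℚ.* b ℚ.- c ℚ.* d ≡ a ℚ.* (b ℚ.- d) ℚ.+ d ℚ.* (a ℚ.- c)
    product-difference =
      solve 4 (λ a b c d → a :* b :- c :* d := a :* (b :- d) :+ d :* (a :- c)) refl

    split : ∀ a b → a ≡ (a ℚ.- b) ℚ.+ b
    split = solve 2 (λ a b → a := (a :- b) :+ b) refl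

  ∣+∣-mono : ∀ p q {r s} → ℚ.∣ p ∣ ℚ.≤ r → ℚ.∣ q ∣ ℚ.≤ s → ℚ.∣ p ℚ.+ q ∣ ℚ.≤ r ℚ.+ s
  ∣+∣-mono p q p≤r q≤s = ℚ.≤-trans (ℚ.∣p+q∣≤∣p∣+∣q∣ p q) (ℚ.+-mono-≤ p≤r q≤s)

  ∣*∣-mono : ∀ p q {r s} → ℚ.∣ p ∣ ℚ.≤ r → ℚ.∣ q ∣ ℚ.≤ s → ℚ.∣ p ℚ.* q ∣ ℚ.≤ r ℚ.* s
  ∣*∣-mono p q {r} {s} p≤r q≤s = subst (ℚ._≤ r ℚ.* s) (sym (ℚ.∣p*q∣≡∣p∣*∣q∣ p q))
    (ℚ.≤-trans
      (ℚ.*-monoʳ-≤-nonNeg ℚ.∣ q ∣ {{ℚ.nonNegative (ℚ.0≤∣p∣ q)}} p≤r)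
      (ℚ.*-monoˡ-≤-nonNeg r {{ℚ.nonNegative (ℚ.≤-trans (ℚ.0≤∣p∣ p) p≤r)}} q≤s))

  sum-close : ∀ a b c d {α β δ} → ℚ.∣ a ℚ.- c ∣ ℚ.≤ α → ℚ.∣ b ℚ.- d ∣ ℚ.≤ β →
    α ℚ.+ β ≡ δ → ℚ.∣ (a ℚ.+ b) ℚ.- (c ℚ.+ d) ∣ ℚ.≤ δ
  sum-close a b c d p q refl = subst (λ t → ℚ.∣ t ∣ ℚ.≤ _)
    (sym (sum-difference a b c d)) (∣+∣-mono (a ℚ.- c) (b ℚ.- d) p q)

  product-close : ∀ a b c d {A B α β δ} → ℚ.∣ a ∣ ℚ.≤ A → ℚ.∣ d ∣ ℚ.≤ B →
    ℚ.∣ a ℚ.- c ∣ ℚ.≤ β → ℚ.∣ b ℚ.- d ∣ ℚ.≤ α →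
    A ℚ.* α ℚ.+ B ℚ.* β ≡ δ → ℚ.∣ a ℚ.* b ℚ.- c ℚ.* d ∣ ℚ.≤ δ
  product-close a b c d a≤A d≤B p q refl = subst (λ t → ℚ.∣ t ∣ ℚ.≤ _)
    (sym (product-difference a b c d))
    (∣+∣-mono (a ℚ.* (b ℚ.- d)) (d ℚ.* (a ℚ.- c))
      (∣*∣-mono a (b ℚ.- d) a≤A q) (∣*∣-mono d (a ℚ.- c) d≤B p))

  neg-close : ∀ a c {δ} → ℚ.∣ a ℚ.- c ∣ ℚ.≤ δ → ℚ.∣ ℚ.- a ℚ.- ℚ.- c ∣ ℚ.≤ δ
  neg-close a c {δ} = subst (ℚ._≤ δ)
    (trans (sym (ℚ.∣-p∣≡∣p∣ (a ℚ.- c))) (cong ℚ.∣_∣ (ℚ.neg-distrib-+ a (ℚ.- c))))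

  size-bound : ∀ a b {δ} → ℚ.∣ a ℚ.- b ∣ ℚ.≤ δ → ℚ.∣ a ∣ ℚ.≤ δ ℚ.+ ℚ.∣ b ∣
  size-bound a b p = subst (λ t → ℚ.∣ t ∣ ℚ.≤ _) (sym (split a b))
    (∣+∣-mono (a ℚ.- b) b p ℚ.≤-refl)

  scaled : ∀ {B δ} → 0ℚ ℚ.< B → 0ℚ ℚ.< δ → ∃[ η ] (0ℚ ℚ.< η × B ℚ.* η ≡ δ)
  scaled {B} {δ} 0<B 0<δ = ℚ.1/ B ℚ.* δ , pos , eq
    where
    instance
      B-pos : ℚ.Positive B
      B-pos = ℚ.positive 0<B
      B-nz : ℚ.NonZero B
      B-nz = ℚ.pos⇒nonZero B
      1/B-pos : ℚ.Positive (ℚ.1/ B)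
      1/B-pos = ℚ.1/pos⇒pos B
    pos : 0ℚ ℚ.< ℚ.1/ B ℚ.* δ
    pos = subst (ℚ._< ℚ.1/ B ℚ.* δ) (ℚ.*-zeroʳ (ℚ.1/ B)) (ℚ.*-monoʳ-<-pos (ℚ.1/ B) 0<δ)
    eq : B ℚ.* (ℚ.1/ B ℚ.* δ) ≡ δ
    eq = trans (sym (ℚ.*-assoc B (ℚ.1/ B) δ))
               (trans (cong (ℚ._* δ) (ℚ.*-inverseʳ B)) (ℚ.*-identityˡ δ))

  bounded : ∀ x → IsCauchy x →
    ∃[ B ] (0ℚ ℚ.< B × ∃[ N ] (∀ n → N ℕ.≤ n → ℚ.∣ x n ∣ ℚ.≤ B))
  bounded x cx =
    let N , h = cx 1ℚ (ℚ.positive⁻¹ 1ℚ) in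
    1ℚ ℚ.+ ℚ.∣ x N ∣ ,
    ℚ.<-≤-trans (ℚ.positive⁻¹ 1ℚ)
      (subst (ℚ._≤ 1ℚ ℚ.+ ℚ.∣ x N ∣) (ℚ.+-identityʳ 1ℚ) (ℚ.+-monoʳ-≤ 1ℚ (ℚ.0≤∣p∣ (x N)))) ,
    N , λ n n≥ → size-bound (x n) (x N) (h n N n≥ ℕ.≤-refl)

  +-cauchy : ∀ x y → IsCauchy x → IsCauchy y → IsCauchy (λ n → x n ℚ.+ y n)
  +-cauchy x y cx cy δ 0<δ =
    let M , hx = cx (½ ℚ.* δ) (half-pos 0<δ)
        N , hy = cy (½ ℚ.* δ) (half-pos 0<δ)
    in M ℕ.⊔ N , λ m n m≥ n≥ → sum-close (x m) (y m) (x n) (y n)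
         (hx m n (ℕ.m⊔n≤o⇒m≤o M N m≥) (ℕ.m⊔n≤o⇒m≤o M N n≥))
         (hy m n (ℕ.m⊔n≤o⇒n≤o M N m≥) (ℕ.m⊔n≤o⇒n≤o M N n≥))
         (halves δ)

  neg-cauchy : ∀ x → IsCauchy x → IsCauchy (λ n → ℚ.- x n)
  neg-cauchy x cx δ 0<δ =
    let N , h = cx δ 0<δ
    in N , λ m n m≥ n≥ → neg-close (x m) (x n) (h m n m≥ n≥)

  *-cauchy : ∀ x y → IsCauchy x → IsCauchy y → IsCauchy (λ n → x n ℚ.* y n)
  *-cauchy x y cx cy δ 0<δ =
    let A , 0<A , K , bx = bounded x cx
        B , 0<B , L , by = bounded y cy
        α , 0<α , Aα = scaled 0<A (half-pos 0<δ)
        β , 0<β , Bβ = scaled 0<B (half-pos 0<δ)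
        M , hy = cy α 0<α
        N , hx = cx β 0<β
        left : ∀ {k} → (K ℕ.⊔ L) ℕ.⊔ (M ℕ.⊔ N) ℕ.≤ k → K ℕ.⊔ L ℕ.≤ k
        left  = ℕ.m⊔n≤o⇒m≤o (K ℕ.⊔ L) (M ℕ.⊔ N)
        right : ∀ {k} → (K ℕ.⊔ L) ℕ.⊔ (M ℕ.⊔ N) ℕ.≤ k → M ℕ.⊔ N ℕ.≤ k
        right = ℕ.m⊔n≤o⇒n≤o (K ℕ.⊔ L) (M ℕ.⊔ N)
    in (K ℕ.⊔ L) ℕ.⊔ (M ℕ.⊔ N) , λ m n m≥ n≥ → product-close (x m) (y m) (x n) (y n)
         (bx m (ℕ.m⊔n≤o⇒m≤o K L (left m≥)))
         (by n (ℕ.m⊔n≤o⇒n≤o K L (left n≥)))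
         (hx m n (ℕ.m⊔n≤o⇒n≤o M N (right m≥)) (ℕ.m⊔n≤o⇒n≤o M N (right n≥)))
         (hy m n (ℕ.m⊔n≤o⇒m≤o M N (right m≥)) (ℕ.m⊔n≤o⇒m≤o M N (right n≥)))
         (trans (cong₂ ℚ._+_ Aα Bβ) (halves δ))

infix  8 -_
infixl 6 _+_ _-_
infixl 7 _*_

_+_ : ℝ → ℝ → ℝ
x + y = mkℝ (λ n → seq x n ℚ.+ seq y n) (+-cauchy (seq x) (seq y) (cauchy x) (cauchy y))

-_ : ℝ → ℝ
- x = mkℝ (λ n → ℚ.- seq x n) (neg-cauchy (seq x) (cauchy x))

_-_ : ℝ → ℝ → ℝ
x - y = x + (- y)

_*_ : ℝ → ℝ → ℝ
x * y = mkℝ (λ n → seq x n ℚ.* seq y n) (*-cauchy (seq x) (seq y) (cauchy x) (cauchy y))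

∑ : ∀ {n} → Vector ℝ n → ℝ
∑ = foldr _+_ 0ℝ

-- The values of `weight` at non-adjacent pairs carry no meaning.
record Graph (n : ℕ) (W : ℝ) : Set where
  field
    adjacent  : Fin n → Fin n → Bool
    symmetric : ∀ i j → adjacent i j ≡ adjacent j i
    loopless  : ∀ i → adjacent i i ≡ false
    weight    : Fin n → Fin n → ℝ
    weight-symmetric : ∀ i j → adjacent i j ≡ true → weight i j ≃ weight j i
    weight-range     : ∀ i j → adjacent i j ≡ true → 1ℝ ≤ weight i j × weight i j ≤ W

open Graph public

-- Each edge leaving S is counted once, from its endpoint in S.
cutWeight : ∀ {n W} → Graph n W → Subset n → ℝ
cutWeight G S = ∑ λ i → ∑ λ j →
  if lookup S i ∧ not (lookup S j) ∧ adjacent G i j then weight G i j else 0ℝ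

-- Bit strings of bounded length form a finite set, so finitely supported
-- distributions with arbitrary real probabilities cover every randomized map
-- into them.
record Distribution (A : Set) : Set where
  field
    #outcomes   : ℕ
    outcome     : Fin #outcomes → A
    probability : Fin #outcomes → ℝ
    probability-nonNegative : ∀ i → 0ℝ ≤ probability i
    probability-total       : ∑ probability ≃ 1ℝ

open Distribution public

-- "The event P has probability at least p".  Events about reals need not be
-- decidable, so a set T of outcomes contained in P is exhibited.
Pr[_∶_]≥_ : ∀ {A : Set} → Distribution A → (A → Set) → ℝ → Set
Pr[ D ∶ P ]≥ p = ∃[ T ]
  ((∀ i → i ∈ T → P (outcome D i)) ×
   p ≤ ∑ (λ i → if lookup T i then probability D i else 0ℝ))

-- Randomness is used only in producing the bit string; `estimate` sees the bit
-- string and the query (and the parameters n, ε, W), but not G.  The map `sketch`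
-- may depend on the sequences representing the weights: a discrete-valued map
-- cannot constructively respect _≃_, and the guarantee is for each G separately.
record CutSketch (n : ℕ) (W : ℝ) : Set where
  field
    sketch   : Graph n W → Distribution (List Bool)
    estimate : List Bool → Subset n → ℝ

open CutSketch public

HasSize : ∀ {n W} → CutSketch n W → ℕ → Set
HasSize sk s = ∀ G i → length (outcome (sketch sk G) i) ℕ.≤ s

Approximates : (K : ℕ) (ε w ŵ : ℝ) → Set
Approximates K ε w ŵ =
  (1ℝ - fromℕ K * ε) * w ≤ ŵ × ŵ ≤ (1ℝ + fromℕ K * ε) * w

1/_^_ : ∀ n .{{_ : ℕ.NonZero n}} → ℕ → ℝ
1/ n ^ a = fromℚ ((+ 1 ℚ./ (n ℕ.^ a)) {{ℕ.m^n≢0 n a}})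

ForEach : ∀ {n W} .{{_ : ℕ.NonZero n}} → (K a : ℕ) (ε : ℝ) → CutSketch n W → Set
ForEach {n} K a ε sk = ∀ G S →
  Pr[ sketch sk G ∶ (λ b → Approximates K ε (cutWeight G S) (estimate sk b S)) ]≥
    (1ℝ - 1/ n ^ a)

-- s = Õ(f) for f = n ε⁻¹ max{1, log log W}, with constants C and c:
-- s ≤ C f (log f)^c, multiplied through by ε > 0.
-- Logarithms are base 2 and rounded up to integers: ℓ ranges over the integer
-- upper bounds of max{1, log log W}, and m over those of log (n ε⁻¹ ℓ).  The
-- right-hand side increases with ℓ and m, so the least choices decide the bound;
-- as f ≥ 2, rounding changes only C.
SizeÕ : (C c n : ℕ) (ε W : ℝ) → ℕ → Set
SizeÕ C c n ε W s = ∀ ℓ m →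
  1 ℕ.≤ ℓ → W ≤ fromℕ (2 ℕ.^ (2 ℕ.^ ℓ)) →
  fromℕ (n ℕ.* ℓ) ≤ fromℕ (2 ℕ.^ m) * ε →
  fromℕ s * ε ≤ fromℕ (C ℕ.* (n ℕ.* ℓ) ℕ.* m ℕ.^ c)

module Submission where

-- With D about 2 / ε, round the weights to integers.  For every edge of weight w, contract the
-- edges heavier than about w D n²: a cut separating two contracted vertices outweighs all such
-- lighter edges together D times over, so cuts change by a factor 1 ± 1 / D.  Of the merged
-- weights keep the leading O(log n) binary digits.  A vertex is isolated in the graph of the t-th
-- digits unless its component merges within O(log n) scales of 2 ^ t, so these simple graphs have
-- O(n log n) vertices in total, whatever W is.
--
-- Split each simple graph recursively along cuts with fewer than D min(|S|, |P ∖ S|) edges.  The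
-- removed edges, O(D n log n) by the potential n log n, are stored, and in every remaining piece
-- P each vertex stores its degree and D random neighbours.  If S is the smaller side of P, of k
-- vertices, the estimator (1 / D) ∑_{u ∈ S} deg u · #{sampled neighbours of u outside S} of the
-- cut has variance (1 / D) ∑_{u ∈ S} e_out(u) e_in(u) ≤ k cut / D ≤ (cut / D)², because
-- e_in(u) ≤ k and D k ≤ cut.  So Chebyshev bounds the failure of one trial, and the majority
-- value of O(log n) trials fails with probability at most 1 / n.

-- The budget shapes the argument. For the weights only a factor log log W is available, which is
-- the cost of writing down the index of one binary scale; nothing can be spent on each scale, as
-- there are about log W of them. Hence the threshold for contraction depends on the edge, and a
-- scale at which no vertex is touched stores nothing. One factor 1 / ε suffices since the guarantee
-- concerns a single fixed cut: there is no union bound over cuts, and Chebyshev's inequality is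
-- applied once, to the sum over all pieces of all planes.
--
-- Randomness is a finite list of equally likely outcomes, so probabilities are counts, and all of
-- the combinatorics stays in the natural numbers. Comparisons of reals are undecidable; therefore
-- ε, W and the weights are read at late enough indices and replaced by integers, which is the
-- origin of the tolerances 1 / 2 and of the additive slack in several constants. Every source of
-- error is brought to the unit 1 / D, and 1 ≤ D ε ≤ 4 translates between D and 1 / ε.

module Prelude where
  open import Data.Bool.Base public using (Bool; true; false; not; _∧_; _xor_)
  open import Data.Fin.Base public using (Fin; toℕ)
  open import Data.List.Base public
    using (List; []; _∷_; _++_; length; map; concatMap; replicate; filterᵇ; allFin; upTo)
  open import Data.List.Membership.Propositional public using (_∈_; find)
  open import Data.List.Membership.Propositional.Properties public using (∈-allFin; ∈-map⁻; ∈-concatMap⁻; ∈-++⁻)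
  open import Data.List.Properties public using (length-map; length-++; length-replicate; map-∘)
  open import Data.List.Relation.Unary.Any public using (here; there)
  open import Data.Nat.Base public
  open import Data.Nat.Properties public
  open import Data.Nat.Tactic.RingSolver public using (solve-∀)
  open import Data.Product.Base public using (∃-syntax; _×_; _,_; proj₁; proj₂)
  open import Data.Sum.Base public using (inj₁; inj₂; [_,_]′)
  open import Function.Base public using (_∘_; id)
  open import Relation.Binary.PropositionalEquality public
  open import Relation.Nullary.Decidable public using (does; yes; no)
  open import Relation.Nullary.Negation public using (¬_; contradiction)

-- Finite sums of natural numbers over lists.

module Sums where
  open Prelude
  open import Data.Fin.Base using (zero; suc)
  import Data.Fin.Properties as Fin
  open import Data.List.Base
  open import Data.List.Properties using (map-tabulate; length-tabulate; length-upTo; map-upTo)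

  *-swap : ∀ a b c → a * (b * c) ≡ b * (a * c)
  *-swap = solve-∀

  infix 5 ∑

  ∑ : ∀ {A : Set} → List A → (A → ℕ) → ℕ
  ∑ []       f = 0
  ∑ (x ∷ xs) f = f x + ∑ xs f

  syntax ∑ xs (λ x → e) = ∑[ x ∈ xs ] e

  ⟦_⟧ : Bool → ℕ
  ⟦ true ⟧  = 1
  ⟦ false ⟧ = 0

  ⟦⟧≤1 : ∀ b → ⟦ b ⟧ ≤ 1
  ⟦⟧≤1 true  = s≤s z≤n
  ⟦⟧≤1 false = z≤n

  ⟦∧⟧ : ∀ a b → ⟦ a ∧ b ⟧ ≡ ⟦ a ⟧ * ⟦ b ⟧
  ⟦∧⟧ true  b = sym (+-identityʳ ⟦ b ⟧)
  ⟦∧⟧ false b = refl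

  ⟦⟧+⟦not⟧ : ∀ b → ⟦ b ⟧ + ⟦ not b ⟧ ≡ 1
  ⟦⟧+⟦not⟧ true  = refl
  ⟦⟧+⟦not⟧ false = refl

  positive : ℕ → Bool
  positive zero    = false
  positive (suc _) = true

  ⟦positive⟧ : ∀ {k} → k ≤ 1 → ⟦ positive k ⟧ ≡ k
  ⟦positive⟧ {zero}  _         = refl
  ⟦positive⟧ {suc _} (s≤s z≤n) = refl

  positive-factor : ∀ {m} d k → m < d * k → 1 ≤ k
  positive-factor {m} d zero lt = contradiction (subst (m <_) (*-zeroʳ d) lt) λ ()
  positive-factor d (suc k) lt = s≤s z≤n

  module _ {A : Set} where

    ∑-cong-∈ : ∀ (xs : List A) {f g} → (∀ x → x ∈ xs → f x ≡ g x) → ∑ xs f ≡ ∑ xs g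
    ∑-cong-∈ []       e = refl
    ∑-cong-∈ (x ∷ xs) e = cong₂ _+_ (e x (here refl)) (∑-cong-∈ xs λ y y∈ → e y (there y∈))

    ∑-cong : ∀ (xs : List A) {f g} → (∀ x → f x ≡ g x) → ∑ xs f ≡ ∑ xs g
    ∑-cong xs e = ∑-cong-∈ xs λ x _ → e x

    ∑-mono-∈ : ∀ (xs : List A) {f g} → (∀ x → x ∈ xs → f x ≤ g x) → ∑ xs f ≤ ∑ xs g
    ∑-mono-∈ []       e = z≤n
    ∑-mono-∈ (x ∷ xs) e = +-mono-≤ (e x (here refl)) (∑-mono-∈ xs λ y y∈ → e y (there y∈))

    ∑-mono : ∀ (xs : List A) {f g} → (∀ x → f x ≤ g x) → ∑ xs f ≤ ∑ xs g
    ∑-mono xs e = ∑-mono-∈ xs λ x _ → e x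

    ∑-+ : ∀ (xs : List A) f g → (∑[ x ∈ xs ] f x + g x) ≡ ∑ xs f + ∑ xs g
    ∑-+ []       f g = refl
    ∑-+ (x ∷ xs) f g = trans (cong (f x + g x +_) (∑-+ xs f g)) (shuffle (f x) (g x) _ _)
      where
      shuffle : ∀ a b c d → (a + b) + (c + d) ≡ (a + c) + (b + d)
      shuffle = solve-∀

    ∑-*ˡ : ∀ c (xs : List A) f → (∑[ x ∈ xs ] c * f x) ≡ c * ∑ xs f
    ∑-*ˡ c []       f = sym (*-zeroʳ c)
    ∑-*ˡ c (x ∷ xs) f = trans (cong (c * f x +_) (∑-*ˡ c xs f)) (sym (*-distribˡ-+ c (f x) _))

    ∑-*ʳ : ∀ c (xs : List A) f → (∑[ x ∈ xs ] f x * c) ≡ ∑ xs f * c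
    ∑-*ʳ c xs f = trans (∑-cong xs λ x → *-comm (f x) c) (trans (∑-*ˡ c xs f) (*-comm c _))

    ∑-const : ∀ (xs : List A) c → (∑[ _ ∈ xs ] c) ≡ length xs * c
    ∑-const []       c = refl
    ∑-const (x ∷ xs) c = cong (c +_) (∑-const xs c)

    ∑-1 : ∀ (xs : List A) → (∑[ _ ∈ xs ] 1) ≡ length xs
    ∑-1 xs = trans (∑-const xs 1) (*-identityʳ (length xs))

    ∑-zero : ∀ (xs : List A) → (∑[ _ ∈ xs ] 0) ≡ 0
    ∑-zero xs = trans (∑-const xs 0) (*-zeroʳ (length xs))

    ∑-++ : ∀ (xs ys : List A) f → ∑ (xs ++ ys) f ≡ ∑ xs f + ∑ ys f
    ∑-++ []       ys f = refl
    ∑-++ (x ∷ xs) ys f = trans (cong (f x +_) (∑-++ xs ys f)) (sym (+-assoc (f x) _ _))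

    ∑-∈ : ∀ {xs : List A} f {x} → x ∈ xs → f x ≤ ∑ xs f
    ∑-∈ f (here refl) = m≤m+n _ _
    ∑-∈ f (there x∈) = ≤-trans (∑-∈ f x∈) (m≤n+m _ _)

    -- The cross terms are nonnegative. Applied to the cuts of the pieces, this bounds the sum of
    -- their variances by the square of the total cut.
    ∑-square-≤ : ∀ (xs : List A) f → (∑[ x ∈ xs ] f x * f x) ≤ ∑ xs f * ∑ xs f
    ∑-square-≤ []       f = z≤n
    ∑-square-≤ (x ∷ xs) f = ≤-trans (+-monoʳ-≤ _ (∑-square-≤ xs f)) (drop-cross (f x) (∑ xs f))
      where
      expand : ∀ a b → a * a + b * b + 2 * a * b ≡ (a + b) * (a + b)
      expand = solve-∀
      drop-cross : ∀ a b → a * a + b * b ≤ (a + b) * (a + b)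
      drop-cross a b = subst (a * a + b * b ≤_) (expand a b) (m≤m+n _ _)

    -- Averaging: the largest term is at least the mean. Its positivity is what leads from a
    -- positive entry of a derived graph to an actual pair behind it. A tail with sum zero is
    -- treated apart because the induction needs a positive sum.
    ∑-large-term : ∀ N (xs : List A) f → length xs ≤ N → 0 < ∑ xs f →
      ∃[ x ] (x ∈ xs × 0 < f x × ∑ xs f ≤ N * f x)
    ∑-large-term N (x ∷ []) f (s≤s {n = n} _) 0<
      = x , here refl , subst (0 <_) (+-identityʳ (f x)) 0<
          , subst (_≤ f x + n * f x) (sym (+-identityʳ (f x))) (m≤m+n _ _)
    ∑-large-term (suc N) (x ∷ xs@(_ ∷ _)) f (s≤s len≤) 0< with 0 <? ∑ xs f
    ... | no ≯0 = x , here refl , subst (0 <_) eq 0< , subst (_≤ f x + N * f x) (sym eq) (m≤m+n _ _)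
      where
      eq : f x + ∑ xs f ≡ f x
      eq = trans (cong (f x +_) (n≤0⇒n≡0 (≮⇒≥ ≯0))) (+-identityʳ (f x))
    ... | yes >0 with ∑-large-term N xs f len≤ >0
    ... | y , y∈ , 0<fy , b with f x ≤? f y
    ... | yes fx≤ = y , there y∈ , 0<fy , +-mono-≤ fx≤ b
    ... | no fx≰ = x , here refl , ≤-<-trans z≤n fy<fx ,
          +-monoʳ-≤ (f x) (≤-trans b (*-monoʳ-≤ N (<⇒≤ fy<fx)))
      where
      fy<fx : f y < f x
      fy<fx = ≰⇒> fx≰

  module _ {A B : Set} where

    ∑-swap : ∀ (xs : List A) (ys : List B) (f : A → B → ℕ) →
      (∑[ x ∈ xs ] ∑[ y ∈ ys ] f x y) ≡ (∑[ y ∈ ys ] ∑[ x ∈ xs ] f x y)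
    ∑-swap []       ys f = sym (∑-zero ys)
    ∑-swap (x ∷ xs) ys f = trans (cong (∑ ys (f x) +_) (∑-swap xs ys f)) (sym (∑-+ ys _ _))

    ∑-map : ∀ (g : A → B) xs f → ∑ (map g xs) f ≡ (∑[ x ∈ xs ] f (g x))
    ∑-map g []       f = refl
    ∑-map g (x ∷ xs) f = cong (f (g x) +_) (∑-map g xs f)

    ∑-concatMap : ∀ (g : A → List B) xs f → ∑ (concatMap g xs) f ≡ (∑[ x ∈ xs ] ∑ (g x) f)
    ∑-concatMap g []       f = refl
    ∑-concatMap g (x ∷ xs) f = trans (∑-++ (g x) _ f) (cong (∑ (g x) f +_) (∑-concatMap g xs f))

    length-concatMap : ∀ (g : A → List B) xs → length (concatMap g xs) ≡ (∑[ x ∈ xs ] length (g x))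
    length-concatMap g xs = trans (sym (∑-1 (concatMap g xs)))
      (trans (∑-concatMap g xs (λ _ → 1)) (∑-cong xs λ x → ∑-1 (g x)))

  ∑-filterᵇ : ∀ {A : Set} (p : A → Bool) xs f → ∑ (filterᵇ p xs) f ≡ (∑[ x ∈ xs ] ⟦ p x ⟧ * f x)
  ∑-filterᵇ p []       f = refl
  ∑-filterᵇ p (x ∷ xs) f with p x
  ... | true  = cong₂ _+_ (sym (+-identityʳ (f x))) (∑-filterᵇ p xs f)
  ... | false = ∑-filterᵇ p xs f

  length-filterᵇ : ∀ {A : Set} (p : A → Bool) xs → length (filterᵇ p xs) ≡ (∑[ x ∈ xs ] ⟦ p x ⟧)
  length-filterᵇ p []       = refl
  length-filterᵇ p (x ∷ xs) with p x
  ... | true  = cong suc (length-filterᵇ p xs)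
  ... | false = length-filterᵇ p xs

  ∑-upTo-suc : ∀ n f → ∑ (upTo (suc n)) f ≡ f 0 + (∑[ t ∈ upTo n ] f (suc t))
  ∑-upTo-suc n f = cong (f 0 +_) (trans (cong (λ xs → ∑ xs f) (sym (map-upTo suc n))) (∑-map suc (upTo n) f))

  ∑-upTo-+ : ∀ m n f → ∑ (upTo (m + n)) f ≡ ∑ (upTo m) f + (∑[ t ∈ upTo n ] f (m + t))
  ∑-upTo-+ zero    n f = refl
  ∑-upTo-+ (suc m) n f = trans (∑-upTo-suc (m + n) f)
    (trans (cong (f 0 +_) (∑-upTo-+ m n (f ∘ suc)))
    (trans (sym (+-assoc (f 0) _ _))
      (cong (_+ (∑[ t ∈ upTo n ] f (suc m + t))) (sym (∑-upTo-suc m f)))))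

  ∑-upTo-last : ∀ n f → ∑ (upTo (suc n)) f ≡ ∑ (upTo n) f + f n
  ∑-upTo-last n f = trans (cong (λ k → ∑ (upTo k) f) (sym (+-comm n 1)))
    (trans (∑-upTo-+ n 1 f) (cong (∑ (upTo n) f +_) (trans (+-identityʳ _) (cong f (+-identityʳ n)))))

  length-allFin : ∀ n → length (allFin n) ≡ n
  length-allFin n = length-tabulate {n = n} id

  ∑-allFin-const : ∀ n c → (∑[ _ ∈ allFin n ] c) ≡ n * c
  ∑-allFin-const n c = trans (∑-const (allFin n) c) (cong (_* c) (length-allFin n))

  count-≤ : ∀ {n} (p : Fin n → Bool) → (∑[ i ∈ allFin n ] ⟦ p i ⟧) ≤ n
  count-≤ {n} p = ≤-trans (∑-mono (allFin n) λ i → ⟦⟧≤1 (p i)) (≤-reflexive (trans (∑-1 (allFin n)) (length-allFin n)))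

  ∑-allFin-suc : ∀ n (f : Fin (suc n) → ℕ) → ∑ (allFin (suc n)) f ≡ f zero + (∑[ i ∈ allFin n ] f (suc i))
  ∑-allFin-suc n f = cong (f zero +_) (trans (cong (λ xs → ∑ xs f) (sym (map-tabulate id suc)))
                                             (∑-map suc (allFin n) f))

  ∑-δ : ∀ {n} (a : Fin n) (f : Fin n → ℕ) → (∑[ i ∈ allFin n ] ⟦ does (a Fin.≟ i) ⟧ * f i) ≡ f a
  ∑-δ {suc n} zero    f = trans (∑-allFin-suc n (λ i → ⟦ does (zero Fin.≟ i) ⟧ * f i)) (trans (cong (f zero + 0 +_) (∑-zero (allFin n)))
                            (trans (+-identityʳ _) (+-identityʳ _)))
  ∑-δ {suc n} (suc a) f = trans (∑-allFin-suc n (λ i → ⟦ does (suc a Fin.≟ i) ⟧ * f i)) (∑-δ a (f ∘ suc))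

  -- Telescoping: N t is charged to the difference of c between t + A and t ∸ B, and in the total
  -- only A + B boundary values, each at most n, survive. The bound does not depend on T, which is
  -- how W drops out of the number of vertices.
  windows : ∀ {n} (c N : ℕ → ℕ) A B → (∀ k → c k ≤ n) → (∀ t → N t + 2 * c (t ∸ B) ≤ 2 * c (t + A)) →
    ∀ T → ∑ (upTo T) N ≤ 2 * ((A + B) * n)
  windows {n} c N A B c≤n step T = +-cancelʳ-≤ (2 * low) (∑ (upTo T) N) (2 * ((A + B) * n)) (begin
    ∑ (upTo T) N + 2 * low ≡⟨ cong (∑ (upTo T) N +_) (sym (∑-*ˡ 2 (upTo T) _)) ⟩
    ∑ (upTo T) N + (∑[ t ∈ upTo T ] 2 * c (t ∸ B)) ≡⟨ sym (∑-+ (upTo T) N _) ⟩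
    (∑[ t ∈ upTo T ] N t + 2 * c (t ∸ B)) ≤⟨ ∑-mono (upTo T) step ⟩
    (∑[ t ∈ upTo T ] 2 * c (t + A)) ≡⟨ ∑-*ˡ 2 (upTo T) _ ⟩
    2 * (∑[ t ∈ upTo T ] c (t + A)) ≤⟨ *-monoʳ-≤ 2 shift ⟩
    2 * ((A + B) * n + low) ≡⟨ *-distribˡ-+ 2 ((A + B) * n) low ⟩
    2 * ((A + B) * n) + 2 * low ∎)
    where
    open ≤-Reasoning
    low = ∑[ t ∈ upTo T ] c (t ∸ B)
    -- Both sums run through the sequence c (t ∸ B), started A + B places apart, so they differ only
    -- in their end segments.
    shift : (∑[ t ∈ upTo T ] c (t + A)) ≤ (A + B) * n + low
    shift = begin
      (∑[ t ∈ upTo T ] c (t + A))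
        ≡⟨ ∑-cong (upTo T) (λ t → cong c (reindex t)) ⟩
      (∑[ t ∈ upTo T ] c ((A + B + t) ∸ B))
        ≤⟨ m≤n+m _ _ ⟩
      (∑[ t ∈ upTo (A + B) ] c (t ∸ B)) + (∑[ t ∈ upTo T ] c ((A + B + t) ∸ B))
        ≡⟨ trans (sym (∑-upTo-+ (A + B) T _)) (trans (cong (λ k → ∑[ t ∈ upTo k ] c (t ∸ B)) (+-comm (A + B) T)) (∑-upTo-+ T (A + B) _)) ⟩
      low + (∑[ t ∈ upTo (A + B) ] c ((T + t) ∸ B))
        ≤⟨ +-monoʳ-≤ low (≤-trans (∑-mono (upTo (A + B)) λ t → c≤n _) (≤-reflexive
             (trans (∑-const (upTo (A + B)) n) (cong (_* n) (length-upTo (A + B)))))) ⟩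
      low + (A + B) * n
        ≡⟨ +-comm low _ ⟩
      (A + B) * n + low ∎
      where
      reindex : ∀ t → t + A ≡ (A + B + t) ∸ B
      reindex t = sym (trans (cong (_∸ B) (regroup A B t)) (m+n∸n≡m (t + A) B))
        where
        regroup : ∀ a b t → a + b + t ≡ t + a + b
        regroup = solve-∀

-- Rounded-up binary logarithms and the potential of a split.

module Log where
  open Prelude

  -- The least k with n ≤ 2 ^ k.
  lg : ℕ → ℕ
  lg zero    = 0
  lg (suc n) with suc n ≤? 2 ^ lg n
  ... | yes _ = lg n
  ... | no _  = suc (lg n)

  double : ∀ m → 2 * m ≡ m + m
  double = solve-∀

  2^-pos : ∀ k → 1 ≤ 2 ^ k
  2^-pos = m^n>0 2

  ≤2^lg : ∀ n → n ≤ 2 ^ lg n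
  ≤2^lg zero = z≤n
  ≤2^lg (suc n) with suc n ≤? 2 ^ lg n
  ... | yes p = p
  ... | no _  = subst (suc n ≤_) (sym (double (2 ^ lg n))) (+-mono-≤ (2^-pos (lg n)) (≤2^lg n))

  lg-least : ∀ {n k} → n ≤ 2 ^ k → lg n ≤ k
  lg-least {zero}  _ = z≤n
  lg-least {suc n} {k} le with suc n ≤? 2 ^ lg n
  ... | yes _ = lg-least (≤-trans (n≤1+n n) le)
  ... | no ≰  = ≤∧≢⇒< (lg-least (≤-trans (n≤1+n n) le)) λ { refl → ≰ le }

  lg-mono : ∀ {m n} → m ≤ n → lg m ≤ lg n
  lg-mono {n = n} m≤n = lg-least (≤-trans m≤n (≤2^lg n))

  2^-suc-< : ∀ k → 2 ^ k < 2 ^ suc k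
  2^-suc-< k = ≤-trans (≤-reflexive (+-comm 1 (2 ^ k))) (+-monoʳ-≤ (2 ^ k) (≤-trans (2^-pos k) (m≤m+n _ 0)))

  n<2^n : ∀ n → n < 2 ^ n
  n<2^n zero    = s≤s z≤n
  n<2^n (suc n) = ≤-trans (+-mono-≤ (2^-pos n) (n<2^n n)) (≤-reflexive (sym (double (2 ^ n))))

  2^-mono : ∀ {j k} → j ≤ k → 2 ^ j ≤ 2 ^ k
  2^-mono = ^-monoʳ-≤ 2

  2^-cancel : ∀ {j k} → 2 ^ j ≤ 2 ^ k → j ≤ k
  2^-cancel {j} {k} le with j ≤? k
  ... | yes p = p
  ... | no ≰  = contradiction le (<⇒≱ (^-monoʳ-< 2 (s≤s (s≤s z≤n)) (≰⇒> ≰)))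

  -- Since 2 a ≤ a + b ≤ 2 ^ lg (a + b), one factor 2 cancels; the exponent is not zero because a +
  -- b is at least 2.
  lg-smaller-half : ∀ {a b} → 1 ≤ a → a ≤ b → suc (lg a) ≤ lg (a + b)
  lg-smaller-half {a} {b} 1≤a a≤b with lg (a + b) in eq
  ... | zero  = contradiction (≤-trans (+-mono-≤ 1≤a (≤-trans 1≤a a≤b))
                  (subst (λ k → a + b ≤ 2 ^ k) eq (≤2^lg (a + b)))) λ { (s≤s ()) }
  ... | suc k = s≤s (lg-least {a} {k} (*-cancelˡ-≤ 2 (≤-trans
                  (subst (_≤ a + b) (sym (double a)) (+-monoʳ-≤ a a≤b))
                  (subst (λ k → a + b ≤ 2 ^ k) eq (≤2^lg (a + b))))))

  private
    ordered : ∀ a b → 1 ≤ a → a ≤ b → a * lg a + b * lg b + a ≤ (a + b) * lg (a + b)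
    ordered a b 1≤a a≤b = begin
      a * lg a + b * lg b + a ≡⟨ regroup a b (lg a) (lg b) ⟩
      a * suc (lg a) + b * lg b ≤⟨ +-mono-≤ (*-monoʳ-≤ a (lg-smaller-half 1≤a a≤b))
                                                 (*-monoʳ-≤ b (lg-mono (m≤n+m b a))) ⟩
      a * lg (a + b) + b * lg (a + b) ≡⟨ sym (*-distribʳ-+ (lg (a + b)) a b) ⟩
      (a + b) * lg (a + b) ∎
      where
      open ≤-Reasoning
      regroup : ∀ a b x y → a * x + b * y + a ≡ a * suc x + b * y
      regroup = solve-∀

  -- The potential n lg n pays for the smaller half of every split.
  split-potential : ∀ a b → 1 ≤ a → 1 ≤ b → a * lg a + b * lg b + a ⊓ b ≤ (a + b) * lg (a + b)
  split-potential a b 1≤a 1≤b with ≤-total a b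
  ... | inj₁ a≤b = subst (λ m → a * lg a + b * lg b + m ≤ (a + b) * lg (a + b))
                     (sym (m≤n⇒m⊓n≡m a≤b)) (ordered a b 1≤a a≤b)
  ... | inj₂ b≤a = subst₂ _≤_
                     (cong₂ _+_ (+-comm (b * lg b) (a * lg a)) (sym (m≥n⇒m⊓n≡n b≤a)))
                     (cong (λ s → s * lg s) (+-comm b a)) (ordered b a 1≤b b≤a)

-- Components of the graphs of heavy edges.

module Contraction {n : Prelude.ℕ} where
  open Prelude
  open import Data.Bool.Base using (if_then_else_)
  open import Data.Fin.Base as Fin using (Fin; toℕ)
  import Data.Fin.Properties as Fin
  open import Data.List.Base using (filter; cartesianProduct)
  open import Data.List.Membership.Propositional.Properties using (∈-filter⁺; ∈-filter⁻; ∈-cartesianProduct⁺)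
  open import Relation.Unary using (Decidable)

  merge : Fin n → Fin n → Fin n → Fin n
  merge a b y = if does (y Fin.≟ a) then b else y

  -- The smaller label survives, so labels only decrease and a root is the least vertex of its
  -- component.
  union : Fin n → Fin n → Fin n → Fin n
  union a b y with toℕ a ≤? toℕ b
  ... | yes _ = merge b a y
  ... | no _  = merge a b y

  merge-self : ∀ a b → merge a b a ≡ b
  merge-self a b with a Fin.≟ a
  ... | yes _  = refl
  ... | no a≢a = contradiction refl a≢a

  merge-target : ∀ a b → merge a b b ≡ b
  merge-target a b with b Fin.≟ a
  ... | yes _ = refl
  ... | no _  = refl

  merge-invariant : ∀ {X : Set} (f : Fin n → X) a b y → f a ≡ f b → f (merge a b y) ≡ f y
  merge-invariant f a b y fa≡fb with y Fin.≟ a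
  ... | yes refl = sym fa≡fb
  ... | no _     = refl

  merge-≤ : ∀ a b y → toℕ b ≤ toℕ a → toℕ (merge a b y) ≤ toℕ y
  merge-≤ a b y b≤a with y Fin.≟ a
  ... | yes refl = b≤a
  ... | no _     = ≤-refl

  union-joins : ∀ a b → union a b a ≡ union a b b
  union-joins a b with toℕ a ≤? toℕ b
  ... | yes _ = trans (merge-target b a) (sym (merge-self b a))
  ... | no _  = trans (merge-self a b) (sym (merge-target a b))

  union-invariant : ∀ {X : Set} (f : Fin n → X) a b y → f a ≡ f b → f (union a b y) ≡ f y
  union-invariant f a b y fa≡fb with toℕ a ≤? toℕ b
  ... | yes _ = merge-invariant f b a y (sym fa≡fb)
  ... | no _  = merge-invariant f a b y fa≡fb

  union-≤ : ∀ a b y → toℕ (union a b y) ≤ toℕ y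
  union-≤ a b y with toℕ a ≤? toℕ b
  ... | yes a≤b = merge-≤ b a y a≤b
  ... | no a≰b  = merge-≤ a b y (<⇒≤ (≰⇒> a≰b))

  -- The least vertex of the connected component of x in the graph with edge list E.
  root : List (Fin n × Fin n) → Fin n → Fin n
  root []            x = x
  root ((u , v) ∷ E) x = union (root E u) (root E v) (root E x)

  root-edge : ∀ {E u v} → (u , v) ∈ E → root E u ≡ root E v
  root-edge {(u , v) ∷ E} (here refl) = union-joins (root E u) (root E v)
  root-edge {(u , v) ∷ E} (there e)   = cong (union (root E u) (root E v)) (root-edge e)

  -- Each union replaces a label by one at which f has the same value. This universal property of
  -- components is used for a cut crossed by no edge of E, and for the roots of a coarser graph.
  root-invariant : ∀ {X : Set} (f : Fin n → X) E → (∀ u v → (u , v) ∈ E → f u ≡ f v) →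
    ∀ x → f (root E x) ≡ f x
  root-invariant f []            inv x = refl
  root-invariant f ((u , v) ∷ E) inv x = trans
    (union-invariant f (root E u) (root E v) (root E x)
      (trans (ih u) (trans (inv u v (here refl)) (sym (ih v)))))
    (ih x)
    where
    ih : ∀ y → f (root E y) ≡ f y
    ih = root-invariant f E λ u v e → inv u v (there e)

  root-≤ : ∀ E x → toℕ (root E x) ≤ toℕ x
  root-≤ []            x = ≤-refl
  root-≤ ((u , v) ∷ E) x = ≤-trans (union-≤ (root E u) (root E v) (root E x)) (root-≤ E x)

  module Heavy (q : Fin n → Fin n → ℕ) where

    IsHeavy : ℕ → Fin n × Fin n → Set
    IsHeavy k (u , v) = 2 ^ k ≤ q u v

    heavy? : ∀ k → Decidable (IsHeavy k)
    heavy? k (u , v) = 2 ^ k ≤? q u v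

    heavyPairs : ℕ → List (Fin n × Fin n)
    heavyPairs k = filter (heavy? k) (cartesianProduct (allFin n) (allFin n))

    rep : ℕ → Fin n → Fin n
    rep k = root (heavyPairs k)

    rep-edge : ∀ k {u v} → 2 ^ k ≤ q u v → rep k u ≡ rep k v
    rep-edge k {u} {v} h = root-edge
      (∈-filter⁺ (heavy? k) (∈-cartesianProduct⁺ (∈-allFin u) (∈-allFin v)) h)

    rep-invariant : ∀ {X : Set} (f : Fin n → X) k → (∀ u v → 2 ^ k ≤ q u v → f u ≡ f v) →
      ∀ x → f (rep k x) ≡ f x
    rep-invariant f k inv = root-invariant f (heavyPairs k) λ u v e →
      inv u v (proj₂ (∈-filter⁻ (heavy? k) {xs = cartesianProduct (allFin n) (allFin n)} e))

    -- A pair heavy at level k is heavy at every lower level j, so `rep j` is constant on components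
    -- of level k: lowering the level coarsens the partition.
    rep-rep : ∀ {j k} → j ≤ k → ∀ x → rep j (rep k x) ≡ rep j x
    rep-rep {j} {k} j≤k = rep-invariant (rep j) k λ u v h →
      rep-edge j (≤-trans (^-monoʳ-≤ 2 j≤k) h)

    -- Roots are least vertices: `rep k x` is at most x, and at least its own root at level j, which
    -- is x. Thus the set of roots grows with the level.
    fixed-mono : ∀ {j k x} → j ≤ k → rep j x ≡ x → rep k x ≡ x
    fixed-mono {j} {k} {x} j≤k fix = Fin.toℕ-injective (≤-antisym (root-≤ (heavyPairs k) x)
      (subst (λ y → toℕ y ≤ toℕ (rep k x)) (trans (rep-rep j≤k x) fix)
             (root-≤ (heavyPairs j) (rep k x))))

    rep-fixed : ∀ {j k} x → j ≤ k → rep k (rep j x) ≡ rep j x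
    rep-fixed {j} x j≤k = fixed-mono j≤k (rep-rep {j} ≤-refl x)

-- Moving edges to roots, and the merging of components across scales.

module ContractedGraph {n : Prelude.ℕ} where
  open Prelude
  open import Data.Bool.Properties as Bool using ()
  import Data.Fin.Properties as Fin
  open Sums
  open Log
  open Contraction

  crosses : (Fin n → Bool) → Fin n → Fin n → ℕ
  crosses χ u v = ⟦ χ u ∧ not (χ v) ⟧

  cut : (Fin n → Fin n → ℕ) → (Fin n → Bool) → List (Fin n) → ℕ
  cut H χ xs = ∑[ u ∈ xs ] ∑[ v ∈ xs ] crosses χ u v * H u v

  ∑² : (Fin n → Fin n → ℕ) → ℕ
  ∑² f = ∑[ u ∈ allFin n ] ∑[ v ∈ allFin n ] f u v

  ∑²-cong : ∀ {f g} → (∀ u v → f u v ≡ g u v) → ∑² f ≡ ∑² g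
  ∑²-cong e = ∑-cong (allFin n) λ u → ∑-cong (allFin n) λ v → e u v

  ∑²-mono : ∀ {f g} → (∀ u v → f u v ≤ g u v) → ∑² f ≤ ∑² g
  ∑²-mono e = ∑-mono (allFin n) λ u → ∑-mono (allFin n) λ v → e u v

  ∑²-*ˡ : ∀ c f → ∑² (λ u v → c * f u v) ≡ c * ∑² f
  ∑²-*ˡ c f = trans (∑-cong (allFin n) λ u → ∑-*ˡ c (allFin n) (f u)) (∑-*ˡ c (allFin n) _)

  ∑²-swap : ∀ (f : Fin n → Fin n → Fin n → Fin n → ℕ) →
    ∑² (λ i j → ∑² (f i j)) ≡ ∑² (λ u v → ∑² λ i j → f i j u v)
  ∑²-swap f = trans (∑-cong V λ i → ∑-swap V V λ j u → ∑ V (f i j u))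
    (trans (∑-swap V V λ i u → ∑[ j ∈ V ] ∑ V (f i j u)) (∑-cong V λ u →
      trans (∑-cong V λ i → ∑-swap V V λ j v → f i j u v) (∑-swap V V λ i v → ∑[ j ∈ V ] f i j u v)))
    where
    V : List (Fin n)
    V = allFin n

  ∑²-term : ∀ f u v → f u v ≤ ∑² f
  ∑²-term f u v = ≤-trans (∑-∈ (f u) (∈-allFin v)) (∑-∈ (λ u → ∑ (allFin n) (f u)) (∈-allFin u))

  module _ (q : Fin n → Fin n → ℕ) (q-sym : ∀ u v → q u v ≡ q v u) (M : ℕ) where
    open Heavy q

    private
      V : List (Fin n)
      V = allFin n

    -- Rounding the logarithm up makes every pair contracted for uv at least 2 ^ M times as heavy as
    -- uv.
    level : Fin n → Fin n → ℕ
    level u v = lg (q u v) + M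

    -- An edge uv is moved to the roots of its endpoints in the graph of all edges heavier
    -- than about 2 ^ M times its own weight.
    source target : Fin n → Fin n → Fin n
    source u v = rep (level u v) u
    target u v = rep (level u v) v

    contracted : Fin n → Fin n → ℕ
    contracted i j = ∑² λ u v →
      ⟦ does (source u v Fin.≟ i) ⟧ * (⟦ does (target u v Fin.≟ j) ⟧ * q u v)

    contracted-sym : ∀ i j → contracted i j ≡ contracted j i
    contracted-sym i j = trans (∑-swap V V _) (∑²-cong λ v u → trans
      (cong₂ (λ k x → ⟦ does (rep (lg k + M) u Fin.≟ i) ⟧ * (⟦ does (rep (lg k + M) v Fin.≟ j) ⟧ * x))
             (q-sym u v) (q-sym u v))
      (*-swap ⟦ does (target v u Fin.≟ i) ⟧ ⟦ does (source v u Fin.≟ j) ⟧ (q v u)))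

    cut-contracted : ∀ χ → cut contracted χ V ≡ ∑² λ u v → crosses χ (source u v) (target u v) * q u v
    cut-contracted χ = begin
      ∑² (λ i j → crosses χ i j * contracted i j)
        ≡⟨ ∑²-cong (λ i j → sym (∑²-*ˡ (crosses χ i j) _)) ⟩
      ∑² (λ i j → ∑² λ u v → crosses χ i j * (s u v i * (t u v j * q u v)))
        ≡⟨ ∑²-swap (λ i j u v → crosses χ i j * (s u v i * (t u v j * q u v))) ⟩
      ∑² (λ u v → ∑² λ i j → crosses χ i j * (s u v i * (t u v j * q u v)))
        ≡⟨ ∑²-cong (λ u v → ∑-cong V λ i → begin
             (∑[ j ∈ V ] crosses χ i j * (s u v i * (t u v j * q u v)))
               ≡⟨ ∑-cong V (λ j → rearrange (crosses χ i j) (s u v i) (t u v j) (q u v)) ⟩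
             (∑[ j ∈ V ] s u v i * (t u v j * (crosses χ i j * q u v)))
               ≡⟨ ∑-*ˡ (s u v i) V _ ⟩
             s u v i * (∑[ j ∈ V ] t u v j * (crosses χ i j * q u v))
               ≡⟨ cong (s u v i *_) (∑-δ (target u v) (λ j → crosses χ i j * q u v)) ⟩
             s u v i * (crosses χ i (target u v) * q u v) ∎) ⟩
      ∑² (λ u v → ∑[ i ∈ V ] s u v i * (crosses χ i (target u v) * q u v))
        ≡⟨ ∑-cong V (λ u → ∑-cong V λ v → ∑-δ (source u v) (λ i → crosses χ i (target u v) * q u v)) ⟩
      ∑² (λ u v → crosses χ (source u v) (target u v) * q u v) ∎
      where
      open ≡-Reasoning
      s t : Fin n → Fin n → Fin n → ℕ
      s u v i = ⟦ does (source u v Fin.≟ i) ⟧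
      t u v j = ⟦ does (target u v Fin.≟ j) ⟧
      rearrange : ∀ a b c d → a * (b * (c * d)) ≡ b * (c * (a * d))
      rearrange = solve-∀

    module _ (χ : Fin n → Bool) where

      private
        C : ℕ
        C = cut q χ V

        -- Either the weight of uv is negligible, or no edge heavy enough to have been contracted for uv crosses χ.
        unsplit : ∀ u v → C < 2 ^ M * q u v → ∀ x → χ (rep (level u v) x) ≡ χ x
        unsplit u v C< = rep-invariant χ (level u v) λ a b heavy →
          agree a b (<-≤-trans C< (≤-trans (*-monoʳ-≤ (2 ^ M) (≤2^lg (q u v)))
            (≤-trans (≤-reflexive (trans (*-comm (2 ^ M) _) (sym (^-distribˡ-+-* 2 (lg (q u v)) M)))) heavy)))
          where
          crossing-≤ : ∀ a b → χ a ≡ true → χ b ≡ false → q a b ≤ C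
          crossing-≤ a b e e′ = subst (_≤ C) term (∑²-term (λ u v → crosses χ u v * q u v) a b)
            where
            term : crosses χ a b * q a b ≡ q a b
            term rewrite e | e′ = +-identityʳ (q a b)
          agree : ∀ a b → C < q a b → χ a ≡ χ b
          agree a b C<q with χ a in eqa | χ b in eqb
          ... | true  | true  = refl
          ... | false | false = refl
          ... | true  | false = contradiction C<q (≤⇒≯ (crossing-≤ a b eqa eqb))
          ... | false | true  = contradiction C<q (≤⇒≯ (≤-trans (≤-reflexive (q-sym a b)) (crossing-≤ b a eqb eqa)))

        -- The indicators can disagree only on pairs with 2 ^ M * q u v ≤ C. There are at most n * n
        -- of these, and each costs at most C after multiplication by 2 ^ M. The roles of f and g
        -- can be exchanged, which gives both directions.
        one-sided : ∀ (f g : Fin n → Fin n → Bool) → (∀ u v → C < 2 ^ M * q u v → f u v ≡ g u v) →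
          2 ^ M * ∑² (λ u v → ⟦ f u v ⟧ * q u v) ≤ 2 ^ M * ∑² (λ u v → ⟦ g u v ⟧ * q u v) + n * (n * C)
        one-sided f g same = begin
          2 ^ M * ∑² (λ u v → ⟦ f u v ⟧ * q u v) ≡⟨ sym (∑²-*ˡ (2 ^ M) _) ⟩
          ∑² (λ u v → 2 ^ M * (⟦ f u v ⟧ * q u v)) ≤⟨ ∑²-mono pointwise ⟩
          ∑² (λ u v → 2 ^ M * (⟦ g u v ⟧ * q u v) + C)
            ≡⟨ ∑-cong V (λ u → trans (∑-+ V _ _) (cong₂ _+_ (∑-*ˡ (2 ^ M) V (λ v → ⟦ g u v ⟧ * q u v)) (∑-allFin-const n C))) ⟩
          (∑[ u ∈ V ] 2 ^ M * (∑[ v ∈ V ] ⟦ g u v ⟧ * q u v) + n * C)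
            ≡⟨ trans (∑-+ V _ _) (cong₂ _+_ (∑-*ˡ (2 ^ M) V (λ u → ∑[ v ∈ V ] ⟦ g u v ⟧ * q u v)) (∑-allFin-const n (n * C))) ⟩
          2 ^ M * ∑² (λ u v → ⟦ g u v ⟧ * q u v) + n * (n * C) ∎
          where
          open ≤-Reasoning
          pointwise : ∀ u v → 2 ^ M * (⟦ f u v ⟧ * q u v) ≤ 2 ^ M * (⟦ g u v ⟧ * q u v) + C
          pointwise u v with C <? 2 ^ M * q u v
          ... | yes C< = ≤-trans (≤-reflexive (cong (λ b → 2 ^ M * (⟦ b ⟧ * q u v)) (same u v C<))) (m≤m+n _ C)
          ... | no C≮  = ≤-trans (*-monoʳ-≤ (2 ^ M) (≤-trans (*-monoˡ-≤ (q u v) (⟦⟧≤1 (f u v))) (≤-reflexive (+-identityʳ _))))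
                           (≤-trans (≮⇒≥ C≮) (m≤n+m C _))

        before after : Fin n → Fin n → Bool
        before u v = χ u ∧ not (χ v)
        after u v = χ (source u v) ∧ not (χ (target u v))

        same-crossing : ∀ u v → C < 2 ^ M * q u v → after u v ≡ before u v
        same-crossing u v C< = cong₂ (λ a b → a ∧ not b) (unsplit u v C< u) (unsplit u v C< v)

      cut-contracted-≤ : 2 ^ M * cut contracted χ V ≤ 2 ^ M * C + n * (n * C)
      cut-contracted-≤ = subst (λ h → 2 ^ M * h ≤ 2 ^ M * C + n * (n * C)) (sym (cut-contracted χ))
        (one-sided after before same-crossing)

      cut-contracted-≥ : 2 ^ M * C ≤ 2 ^ M * cut contracted χ V + n * (n * C)
      cut-contracted-≥ = subst (λ h → 2 ^ M * C ≤ 2 ^ M * h + n * (n * C)) (sym (cut-contracted χ))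
        (one-sided before after λ u v C< → sym (same-crossing u v C<))

    private
      indicator-pos : ∀ {i j : Fin n} c → 0 < ⟦ does (i Fin.≟ j) ⟧ * c → i ≡ j × 0 < c × ⟦ does (i Fin.≟ j) ⟧ * c ≡ c
      indicator-pos {i} {j} c 0< with i Fin.≟ j
      ... | yes i≡j = i≡j , subst (0 <_) (+-identityʳ c) 0< , +-identityʳ c
      ... | no _    = contradiction 0< λ ()

    -- A pair moved to ij weighs less than 2 ^ r, so i and j are roots of a level at most r + M and
    -- remain roots above it. Averaging over u and then over v yields such a pair with at least 1 /
    -- n² of the weight of ij, hence at least 2 ^ (t ∸ B); this pair joins i and j at level t ∸ B.
    contracted-edge : ∀ i j {B t r} → n * n ≤ 2 ^ B → 2 ^ t ≤ contracted i j → contracted i j < 2 ^ r →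
      rep (r + M) i ≡ i × rep (r + M) j ≡ j × rep (t ∸ B) i ≡ rep (t ∸ B) j
    contracted-edge i j {B} {t} {r} nn≤ 2^t≤ <2^r
      with ∑-large-term n V _ (≤-reflexive (length-allFin n)) (≤-trans (2^-pos t) 2^t≤)
    ... | u , _ , 0<u , ≤u with ∑-large-term n V _ (≤-reflexive (length-allFin n)) 0<u
    ... | v , _ , 0<v , ≤v with indicator-pos {source u v} {i} _ 0<v
    ... | refl , 0<v′ , eq with indicator-pos {target u v} {j} (q u v) 0<v′
    ... | refl , 0<q , eq′ =
        rep-fixed {level u v} u level≤ , rep-fixed {level u v} v level≤ ,
        trans (rep-rep {k = level u v} t∸B≤ u) (trans (rep-edge (t ∸ B) heavy) (sym (rep-rep {k = level u v} t∸B≤ v)))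
      where
      open ≤-Reasoning
      q-term : ⟦ does (source u v Fin.≟ i) ⟧ * (⟦ does (target u v Fin.≟ j) ⟧ * q u v) ≡ q u v
      q-term = trans eq eq′
      level≤ : level u v ≤ r + M
      level≤ = +-monoˡ-≤ M (lg-least (<⇒≤ (≤-<-trans
        (subst (_≤ contracted i j) q-term (∑²-term (λ u v → ⟦ does (source u v Fin.≟ i) ⟧ * (⟦ does (target u v Fin.≟ j) ⟧ * q u v)) u v)) <2^r)))
      bound : 2 ^ t ≤ 2 ^ B * q u v
      bound = begin
        2 ^ t ≤⟨ 2^t≤ ⟩
        contracted i j ≤⟨ ≤u ⟩
        n * _ ≤⟨ *-monoʳ-≤ n ≤v ⟩
        n * (n * _) ≡⟨ cong (λ x → n * (n * x)) q-term ⟩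
        n * (n * q u v) ≡⟨ sym (*-assoc n n (q u v)) ⟩
        n * n * q u v ≤⟨ *-monoˡ-≤ (q u v) nn≤ ⟩
        2 ^ B * q u v ∎
      -- If t ≤ B, the level is 0 and a heavy pair is merely one of positive weight.
      heavy : 2 ^ (t ∸ B) ≤ q u v
      heavy with t ≤? B
      ... | yes t≤B = subst (λ k → 2 ^ k ≤ q u v) (sym (m≤n⇒m∸n≡0 t≤B)) 0<q
      ... | no t≰B  = *-cancelˡ-≤ (2 ^ B) {{m^n≢0 2 B}} (subst (_≤ 2 ^ B * q u v)
            (trans (cong (2 ^_) (sym (m+[n∸m]≡n (<⇒≤ (≰⇒> t≰B))))) (^-distribˡ-+-* 2 B (t ∸ B))) bound)
      t∸B≤ : t ∸ B ≤ level u v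
      t∸B≤ = ≤-trans (2^-cancel (≤-trans heavy (≤2^lg (q u v)))) (m≤m+n _ M)

  module _ (q : Fin n → Fin n → ℕ) where
    open Heavy q

    isRoot : ℕ → Fin n → ℕ
    isRoot k i = ⟦ does (rep k i Fin.≟ i) ⟧

    components : ℕ → ℕ
    components k = ∑ (allFin n) (isRoot k)

    components-≤ : ∀ k → components k ≤ n
    components-≤ k = count-≤ λ i → does (rep k i Fin.≟ i)

    private
      isRoot-true : ∀ {k i} → rep k i ≡ i → isRoot k i ≡ 1
      isRoot-true {k} {i} e with rep k i Fin.≟ i
      ... | yes _ = refl
      ... | no ¬e = contradiction e ¬e

      isRoot-false : ∀ {k i} → rep k i ≢ i → isRoot k i ≡ 0
      isRoot-false {k} {i} ¬e with rep k i Fin.≟ i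
      ... | yes e = contradiction e ¬e
      ... | no _  = refl

      isRoot-mono : ∀ {j k} i → j ≤ k → isRoot j i ≤ isRoot k i
      isRoot-mono {j} {k} i j≤k with rep j i Fin.≟ i
      ... | yes e = ≤-reflexive (sym (isRoot-true {k} (fixed-mono j≤k e)))
      ... | no _  = z≤n

    -- A root at level k that shares its component at level j with another such root either
    -- ceases to be a root, or absorbs one that does.
    merging-roots : ∀ {j k} → j ≤ k → (b : Fin n → Bool) →
      (∀ i → b i ≡ true → rep k i ≡ i × ∃[ m ] (m ≢ i × rep k m ≡ m × rep j m ≡ rep j i)) →
      (∑[ i ∈ allFin n ] ⟦ b i ⟧) + 2 * components j ≤ 2 * components k
    merging-roots {j} {k} j≤k b partner = begin
      N + 2 * components j ≡⟨ regroup N (components j) ⟩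
      (N + components j) + components j ≤⟨ +-monoˡ-≤ (components j) absorbed ⟩
      (components k + lost) + components j ≡⟨ trans (+-assoc (components k) lost _) (cong (components k +_) lost+kept) ⟩
      components k + components k ≡⟨ sym (double (components k)) ⟩
      2 * components k ∎
      where
      open ≤-Reasoning
      V = allFin n
      N = ∑[ i ∈ V ] ⟦ b i ⟧
      dies : Fin n → ℕ
      dies m = isRoot k m ∸ isRoot j m
      lost = ∑ V dies
      regroup : ∀ a c → a + 2 * c ≡ (a + c) + c
      regroup = solve-∀
      lost+kept : lost + components j ≡ components k
      lost+kept = trans (sym (∑-+ V dies (isRoot j))) (∑-cong V λ m → m∸n+n≡m (isRoot-mono m j≤k))
      into : Fin n → ℕ
      into i = ∑[ m ∈ V ] ⟦ does (rep j m Fin.≟ i) ⟧ * dies m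
      into-total : ∑ V into ≡ lost
      into-total = trans (∑-swap V V (λ i m → ⟦ does (rep j m Fin.≟ i) ⟧ * dies m)) (∑-cong V λ m → ∑-δ (rep j m) (λ _ → dies m))
      pointwise : ∀ i → ⟦ b i ⟧ + isRoot j i ≤ isRoot k i + into i
      pointwise i with b i in eqb
      ... | false = ≤-trans (isRoot-mono i j≤k) (m≤m+n _ _)
      ... | true with partner i eqb
      ... | ki , m , m≢i , km , jm with rep j i Fin.≟ i
      ... | no _  = subst (λ x → 1 ≤ x + into i) (sym (isRoot-true {k} ki)) (s≤s z≤n)
      ... | yes ji = subst (λ x → 2 ≤ x + into i) (sym (isRoot-true {k} ki)) (s≤s (≤-trans (≤-reflexive (sym term))
            (∑-∈ (λ m → ⟦ does (rep j m Fin.≟ i) ⟧ * dies m) (∈-allFin m))))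
        where
        term : ⟦ does (rep j m Fin.≟ i) ⟧ * dies m ≡ 1
        term with rep j m Fin.≟ i
        ... | no ≢i = contradiction (trans jm ji) ≢i
        ... | yes jm≡i = trans (+-identityʳ _) (cong₂ _∸_ (isRoot-true {k} km)
                (isRoot-false {j} λ jm≡m → m≢i (trans (sym jm≡m) jm≡i)))
      absorbed : N + components j ≤ components k + lost
      absorbed = begin
        N + components j ≡⟨ sym (∑-+ V _ _) ⟩
        (∑[ i ∈ V ] ⟦ b i ⟧ + isRoot j i) ≤⟨ ∑-mono V pointwise ⟩
        (∑[ i ∈ V ] isRoot k i + into i) ≡⟨ trans (∑-+ V _ _) (cong (components k +_) into-total) ⟩
        components k + lost ∎

-- Leading binary digits of the merged weights, and their supports.

module BitPlanes where
  open Prelude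
  open import Data.Bool.Base using (if_then_else_)
  import Data.Fin.Properties as Fin
  open import Data.Nat.DivMod using (_/_; _%_; m≡m%n+[m/n]*n; m%n<n; m<n*o⇒m/o<n; m/n*n≤m)
  open Sums
  open Log
  open Contraction
  open ContractedGraph

  bit : ℕ → ℕ → ℕ
  bit zero    x = x % 2
  bit (suc t) x = bit t (x / 2)

  bit≤1 : ∀ t x → bit t x ≤ 1
  bit≤1 zero    x = s≤s⁻¹ (m%n<n x 2)
  bit≤1 (suc t) x = bit≤1 t (x / 2)

  bit-pos : ∀ t x → 0 < bit t x → 2 ^ t ≤ x
  bit-pos zero    (suc x) _  = s≤s z≤n
  bit-pos (suc t) x       0< = ≤-trans (*-monoʳ-≤ 2 (bit-pos t (x / 2) 0<))
    (≤-trans (≤-reflexive (*-comm 2 (x / 2))) (m/n*n≤m x 2))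

  bit-sum : ∀ T x → x < 2 ^ T → (∑[ t ∈ upTo T ] 2 ^ t * bit t x) ≡ x
  bit-sum zero    zero    _ = refl
  bit-sum zero    (suc x) (s≤s ())
  bit-sum (suc T) x x< = begin
    (∑[ t ∈ upTo (suc T) ] 2 ^ t * bit t x)
      ≡⟨ ∑-upTo-suc T (λ t → 2 ^ t * bit t x) ⟩
    x % 2 + 0 + (∑[ t ∈ upTo T ] 2 * 2 ^ t * bit t (x / 2))
      ≡⟨ cong₂ _+_ (+-identityʳ (x % 2)) (trans (∑-cong (upTo T) λ t → *-assoc 2 (2 ^ t) _) (∑-*ˡ 2 (upTo T) _)) ⟩
    x % 2 + 2 * (∑[ t ∈ upTo T ] 2 ^ t * bit t (x / 2))
      ≡⟨ cong (λ y → x % 2 + 2 * y) (bit-sum T (x / 2) (m<n*o⇒m/o<n {n = 2 ^ T} {o = 2} (subst (x <_) (*-comm 2 (2 ^ T)) x<))) ⟩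
    x % 2 + 2 * (x / 2)
      ≡⟨ cong (x % 2 +_) (*-comm 2 (x / 2)) ⟩
    x % 2 + x / 2 * 2
      ≡⟨ sym (m≡m%n+[m/n]*n x 2) ⟩
    x ∎
    where open ≡-Reasoning

  -- The test places the t-th digit among the p leading ones, or above them, where it is 0. A kept
  -- digit 1 thus confines x to the range from 2 ^ t to 2 ^ (t + p).
  keep : ℕ → ℕ → ℕ → ℕ
  keep p t x with x <? 2 ^ (t + p)
  ... | yes _ = bit t x
  ... | no _  = 0

  keep≤bit : ∀ p t x → keep p t x ≤ bit t x
  keep≤bit p t x with x <? 2 ^ (t + p)
  ... | yes _ = ≤-refl
  ... | no _  = z≤n

  keep-pos : ∀ p t x → 0 < keep p t x → 2 ^ t ≤ x × x < 2 ^ (t + p)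
  keep-pos p t x 0< with x <? 2 ^ (t + p)
  ... | yes x< = bit-pos t x 0< , x<
  ... | no _   = contradiction 0< λ ()

  private
    dropped : ℕ → ℕ → ℕ → ℕ
    dropped p x t with 2 ^ (t + p) ≤? x
    ... | yes _ = 2 ^ t
    ... | no _  = 0

    dropped≤ : ∀ p x t → dropped p x t ≤ 2 ^ t
    dropped≤ p x t with 2 ^ (t + p) ≤? x
    ... | yes _ = ≤-refl
    ... | no _  = z≤n

    ∑-2^ : ∀ T → (∑[ t ∈ upTo T ] 2 ^ t) ≤ 2 ^ T
    ∑-2^ zero    = z≤n
    ∑-2^ (suc T) = ≤-trans (≤-reflexive (∑-upTo-last T (2 ^_)))
      (≤-trans (+-monoˡ-≤ (2 ^ T) (∑-2^ T)) (≤-reflexive (sym (double (2 ^ T)))))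

    -- Dropped scales satisfy 2 ^ (t + p) ≤ x and lie under a geometric series dominated by the
    -- largest of them, so at most the fraction 2 / 2 ^ p of x is lost.
    ∑-dropped : ∀ p x T → 2 ^ p * ∑ (upTo T) (dropped p x) ≤ 2 * x
    ∑-dropped p x zero    = ≤-trans (≤-reflexive (*-zeroʳ (2 ^ p))) z≤n
    ∑-dropped p x (suc T) rewrite ∑-upTo-last T (dropped p x) with 2 ^ (T + p) ≤? x
    ... | no _  rewrite +-identityʳ (∑ (upTo T) (dropped p x)) = ∑-dropped p x T
    ... | yes h = begin
      2 ^ p * (∑ (upTo T) (dropped p x) + 2 ^ T) ≤⟨ *-monoʳ-≤ (2 ^ p) (+-monoˡ-≤ (2 ^ T)
                                                     (≤-trans (∑-mono (upTo T) (dropped≤ p x)) (∑-2^ T))) ⟩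
      2 ^ p * (2 ^ T + 2 ^ T) ≡⟨ regroup (2 ^ p) (2 ^ T) ⟩
      2 * (2 ^ T * 2 ^ p) ≡⟨ cong (2 *_) (sym (^-distribˡ-+-* 2 T p)) ⟩
      2 * 2 ^ (T + p) ≤⟨ *-monoʳ-≤ 2 h ⟩
      2 * x ∎
      where
      open ≤-Reasoning
      regroup : ∀ a b → a * (b + b) ≡ 2 * (b * a)
      regroup = solve-∀

    bit≤keep+dropped : ∀ p t x → 2 ^ t * bit t x ≤ 2 ^ t * keep p t x + dropped p x t
    bit≤keep+dropped p t x with x <? 2 ^ (t + p) | 2 ^ (t + p) ≤? x
    ... | yes _ | _     = m≤m+n _ _
    ... | no ≮  | no ≰  = contradiction (≮⇒≥ ≮) ≰
    ... | no _  | yes _ = ≤-trans (*-monoʳ-≤ (2 ^ t) (bit≤1 t x))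
                            (≤-trans (≤-reflexive (*-identityʳ (2 ^ t))) (m≤n+m _ _))

  kept : ℕ → ℕ → ℕ → ℕ
  kept T p x = ∑[ t ∈ upTo T ] 2 ^ t * keep p t x

  kept-≤ : ∀ T p x → x < 2 ^ T → kept T p x ≤ x
  kept-≤ T p x x< = ≤-trans (∑-mono (upTo T) λ t → *-monoʳ-≤ (2 ^ t) (keep≤bit p t x))
    (≤-reflexive (bit-sum T x x<))

  kept-≥ : ∀ T p x → x < 2 ^ T → 2 ^ p * x ≤ 2 ^ p * kept T p x + 2 * x
  kept-≥ T p x x< = begin
    2 ^ p * x ≡⟨ cong (2 ^ p *_) (sym (bit-sum T x x<)) ⟩
    2 ^ p * (∑[ t ∈ upTo T ] 2 ^ t * bit t x) ≤⟨ *-monoʳ-≤ (2 ^ p) (∑-mono (upTo T) λ t → bit≤keep+dropped p t x) ⟩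
    2 ^ p * (∑[ t ∈ upTo T ] 2 ^ t * keep p t x + dropped p x t) ≡⟨ cong (2 ^ p *_) (∑-+ (upTo T) _ _) ⟩
    2 ^ p * (kept T p x + ∑ (upTo T) (dropped p x)) ≡⟨ *-distribˡ-+ (2 ^ p) (kept T p x) _ ⟩
    2 ^ p * kept T p x + 2 ^ p * ∑ (upTo T) (dropped p x) ≤⟨ +-monoʳ-≤ (2 ^ p * kept T p x) (∑-dropped p x T) ⟩
    2 ^ p * kept T p x + 2 * x ∎
    where open ≤-Reasoning

  module _ {n : ℕ} where

    private
      V : List (Fin n)
      V = allFin n

    crosses-diagonal : ∀ (χ : Fin n → Bool) u → crosses χ u u ≡ 0
    crosses-diagonal χ u with χ u
    ... | true  = refl
    ... | false = refl

    -- The diagonal holds the pairs whose endpoints were merged. They cross no cut, but would make a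
    -- vertex `touched` without providing a second root for it to merge with.
    plane : (Fin n → Fin n → ℕ) → ℕ → ℕ → Fin n → Fin n → ℕ
    plane w p t i j = if does (i Fin.≟ j) then 0 else keep p t (w i j)

    module _ (w : Fin n → Fin n → ℕ) (p : ℕ) where

      plane≤1 : ∀ t i j → plane w p t i j ≤ 1
      plane≤1 t i j with i Fin.≟ j
      ... | yes _ = z≤n
      ... | no _  = ≤-trans (keep≤bit p t (w i j)) (bit≤1 t (w i j))

      plane-sym : (∀ i j → w i j ≡ w j i) → ∀ t i j → plane w p t i j ≡ plane w p t j i
      plane-sym w-sym t i j with i Fin.≟ j | j Fin.≟ i
      ... | yes _    | yes _    = refl
      ... | no _     | no _     = cong (keep p t) (w-sym i j)
      ... | yes refl | no i≢i   = contradiction refl i≢i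
      ... | no i≢i   | yes refl = contradiction refl i≢i

      plane-pos : ∀ t i j → 0 < plane w p t i j → i ≢ j × 2 ^ t ≤ w i j × w i j < 2 ^ (t + p)
      plane-pos t i j 0< with i Fin.≟ j
      ... | yes _  = contradiction 0< λ ()
      ... | no i≢j = i≢j , keep-pos p t (w i j) 0<

      planes-cut : ℕ → (Fin n → Bool) → ℕ
      planes-cut T χ = ∑[ t ∈ upTo T ] 2 ^ t * cut (plane w p t) χ V

      private
        entry : ∀ T χ i j → (∑[ t ∈ upTo T ] 2 ^ t * (crosses χ i j * plane w p t i j)) ≡ crosses χ i j * kept T p (w i j)
        entry T χ i j with i Fin.≟ j
        ... | no _     = trans (∑-cong (upTo T) λ t → *-swap (2 ^ t) (crosses χ i j) _) (∑-*ˡ (crosses χ i j) (upTo T) _)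
        ... | yes refl rewrite crosses-diagonal χ i = trans (∑-cong (upTo T) λ t → *-zeroʳ (2 ^ t)) (∑-zero (upTo T))

      planes-cut-kept : ∀ T χ → planes-cut T χ ≡ ∑² λ i j → crosses χ i j * kept T p (w i j)
      planes-cut-kept T χ = begin
        (∑[ t ∈ upTo T ] 2 ^ t * cut (plane w p t) χ V)
          ≡⟨ ∑-cong (upTo T) (λ t → sym (∑²-*ˡ (2 ^ t) λ i j → crosses χ i j * plane w p t i j)) ⟩
        (∑[ t ∈ upTo T ] ∑[ i ∈ V ] ∑[ j ∈ V ] f t i j)
          ≡⟨ ∑-swap (upTo T) V (λ t i → ∑[ j ∈ V ] f t i j) ⟩
        (∑[ i ∈ V ] ∑[ t ∈ upTo T ] ∑[ j ∈ V ] f t i j)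
          ≡⟨ ∑-cong V (λ i → ∑-swap (upTo T) V λ t j → f t i j) ⟩
        (∑[ i ∈ V ] ∑[ j ∈ V ] ∑[ t ∈ upTo T ] f t i j)
          ≡⟨ ∑²-cong (entry T χ) ⟩
        ∑² (λ i j → crosses χ i j * kept T p (w i j)) ∎
        where
        open ≡-Reasoning
        f : ℕ → Fin n → Fin n → ℕ
        f t i j = 2 ^ t * (crosses χ i j * plane w p t i j)

      module _ (T : ℕ) (w< : ∀ i j → w i j < 2 ^ T) (χ : Fin n → Bool) where

        planes-cut-≤ : planes-cut T χ ≤ cut w χ V
        planes-cut-≤ = ≤-trans (≤-reflexive (planes-cut-kept T χ))
          (∑²-mono λ i j → *-monoʳ-≤ (crosses χ i j) (kept-≤ T p (w i j) (w< i j)))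

        planes-cut-≥ : 2 ^ p * cut w χ V ≤ 2 ^ p * planes-cut T χ + 2 * cut w χ V
        planes-cut-≥ = begin
          2 ^ p * cut w χ V
            ≡⟨ sym (∑²-*ˡ (2 ^ p) λ i j → c i j * w i j) ⟩
          ∑² (λ i j → 2 ^ p * (c i j * w i j))
            ≤⟨ ∑²-mono pointwise ⟩
          ∑² (λ i j → 2 ^ p * (c i j * kept T p (w i j)) + 2 * (c i j * w i j))
            ≡⟨ trans (∑-cong V λ i → ∑-+ V _ _) (∑-+ V _ _) ⟩
          ∑² (λ i j → 2 ^ p * (c i j * kept T p (w i j))) + ∑² (λ i j → 2 * (c i j * w i j))
            ≡⟨ cong₂ _+_ (∑²-*ˡ (2 ^ p) λ i j → c i j * kept T p (w i j)) (∑²-*ˡ 2 λ i j → c i j * w i j) ⟩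
          2 ^ p * ∑² (λ i j → c i j * kept T p (w i j)) + 2 * cut w χ V
            ≡⟨ cong (λ x → 2 ^ p * x + 2 * cut w χ V) (sym (planes-cut-kept T χ)) ⟩
          2 ^ p * planes-cut T χ + 2 * cut w χ V ∎
          where
          open ≤-Reasoning
          c : Fin n → Fin n → ℕ
          c = crosses χ
          after : ∀ a c k x → c * (a * k + 2 * x) ≡ a * (c * k) + 2 * (c * x)
          after = solve-∀
          pointwise : ∀ i j → 2 ^ p * (c i j * w i j) ≤ 2 ^ p * (c i j * kept T p (w i j)) + 2 * (c i j * w i j)
          pointwise i j = subst₂ _≤_ (sym (*-swap (2 ^ p) (c i j) (w i j))) (after (2 ^ p) (c i j) _ (w i j))
            (*-monoʳ-≤ (c i j) (kept-≥ T p (w i j) (w< i j)))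

    touched : (Fin n → Fin n → ℕ) → Fin n → Bool
    touched H i with 0 <? ∑ V (H i)
    ... | yes _ = true
    ... | no _  = false

    support : (Fin n → Fin n → ℕ) → List (Fin n)
    support H = filterᵇ (touched H) V

    support-≤ : ∀ H → length (support H) ≤ n
    support-≤ H = ≤-trans (≤-reflexive (length-filterᵇ (touched H) V)) (count-≤ (touched H))

    cut-support : ∀ H → (∀ i j → H i j ≡ H j i) → ∀ χ → cut H χ (support H) ≡ cut H χ V
    cut-support H H-sym χ = begin
      cut H χ (support H)
        ≡⟨ ∑-filterᵇ (touched H) V _ ⟩
      (∑[ u ∈ V ] ⟦ touched H u ⟧ * (∑[ v ∈ support H ] crosses χ u v * H u v))
        ≡⟨ ∑-cong V (λ u → cong (⟦ touched H u ⟧ *_) (∑-filterᵇ (touched H) V _)) ⟩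
      (∑[ u ∈ V ] ⟦ touched H u ⟧ * (∑[ v ∈ V ] ⟦ touched H v ⟧ * (crosses χ u v * H u v)))
        ≡⟨ ∑-cong V (λ u → sym (∑-*ˡ ⟦ touched H u ⟧ V _)) ⟩
      ∑² (λ u v → ⟦ touched H u ⟧ * (⟦ touched H v ⟧ * (crosses χ u v * H u v)))
        ≡⟨ ∑²-cong (λ u v → trans (rearrange ⟦ touched H u ⟧ ⟦ touched H v ⟧ (crosses χ u v) (H u v))
             (cong (crosses χ u v *_) (trans (cong (⟦ touched H u ⟧ *_)
                (trans (cong (⟦ touched H v ⟧ *_) (H-sym u v)) (trans (absorb v u) (H-sym v u)))) (absorb u v)))) ⟩
      cut H χ V ∎
      where
      open ≡-Reasoning
      rearrange : ∀ a b c h → a * (b * (c * h)) ≡ c * (a * (b * h))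
      rearrange = solve-∀
      absorb : ∀ u v → ⟦ touched H u ⟧ * H u v ≡ H u v
      absorb u v with 0 <? ∑ V (H u)
      ... | yes _ = +-identityʳ (H u v)
      ... | no ≯0 = sym (n≤0⇒n≡0 (≤-trans (∑-∈ (H u) (∈-allFin v)) (≮⇒≥ ≯0)))

    -- An entry of the t-th plane stems from a merged weight between 2 ^ t and 2 ^ (t + p), so its
    -- ends are distinct roots at level t + p + M that share a component at level t ∸ B. By
    -- `merging-roots` such vertices are paid for by the components lost between these levels, and
    -- `windows` sums the losses.
    total-support : ∀ (q : Fin n → Fin n → ℕ) (q-sym : ∀ u v → q u v ≡ q v u) M p B T → n * n ≤ 2 ^ B →
      (∑[ t ∈ upTo T ] length (support (plane (contracted q q-sym M) p t))) ≤ 2 * ((p + M + B) * n)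
    total-support q q-sym M p B T nn≤ = windows {n} (components q) _ (p + M) B (components-≤ q) step T
      where
      open Heavy q
      w : Fin n → Fin n → ℕ
      w = contracted q q-sym M
      step : ∀ t → length (support (plane w p t)) + 2 * components q (t ∸ B) ≤ 2 * components q (t + (p + M))
      step t = subst (λ l → l + 2 * components q (t ∸ B) ≤ 2 * components q (t + (p + M)))
        (sym (length-filterᵇ (touched (plane w p t)) V))
        (merging-roots q (≤-trans (m∸n≤m t B) (m≤m+n t (p + M))) (touched (plane w p t)) partner)
        where
        partner : ∀ i → touched (plane w p t) i ≡ true →
          rep (t + (p + M)) i ≡ i × ∃[ m ] (m ≢ i × rep (t + (p + M)) m ≡ m × rep (t ∸ B) m ≡ rep (t ∸ B) i)
        partner i e with 0 <? ∑ V (plane w p t i)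
        ... | yes 0< with ∑-large-term n V _ (≤-reflexive (length-allFin n)) 0<
        ... | j , _ , 0<p , _ with plane-pos w p t i j 0<p
        ... | i≢j , lo , hi with contracted-edge q q-sym M i j {B} {t} {t + p} nn≤ lo hi
        ... | fi , fj , eq = subst (λ k → rep k i ≡ i) (+-assoc t p M) fi , j , (λ j≡i → i≢j (sym j≡i)) ,
              subst (λ k → rep k j ≡ j) (+-assoc t p M) fj , sym eq

-- Decomposition along sparse cuts.

module SparseCuts {n : Prelude.ℕ} where
  open Prelude
  open import Data.Fin.Subset.Properties using (anySubset?)
  open import Data.Vec.Base using (lookup; tabulate)
  open import Data.Vec.Properties using (lookup∘tabulate)
  open Sums
  open Log
  open ContractedGraph using (crosses; cut)

  inside outside : (Fin n → Bool) → List (Fin n) → List (Fin n)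
  inside  χ = filterᵇ χ
  outside χ = filterᵇ (not ∘ χ)

  ∑-sides : ∀ (χ : Fin n → Bool) xs f → ∑ xs f ≡ ∑ (inside χ xs) f + ∑ (outside χ xs) f
  ∑-sides χ xs f = begin
    ∑ xs f
      ≡⟨ ∑-cong xs (λ x → trans (sym (*-identityˡ (f x)))
           (trans (cong (_* f x) (sym (⟦⟧+⟦not⟧ (χ x)))) (*-distribʳ-+ (f x) ⟦ χ x ⟧ ⟦ not (χ x) ⟧))) ⟩
    (∑[ x ∈ xs ] ⟦ χ x ⟧ * f x + ⟦ not (χ x) ⟧ * f x)
      ≡⟨ ∑-+ xs _ _ ⟩
    (∑[ x ∈ xs ] ⟦ χ x ⟧ * f x) + (∑[ x ∈ xs ] ⟦ not (χ x) ⟧ * f x)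
      ≡⟨ cong₂ _+_ (sym (∑-filterᵇ χ xs f)) (sym (∑-filterᵇ (not ∘ χ) xs f)) ⟩
    ∑ (inside χ xs) f + ∑ (outside χ xs) f ∎
    where open ≡-Reasoning

  length-sides : ∀ (χ : Fin n → Bool) xs → length (inside χ xs) + length (outside χ xs) ≡ length xs
  length-sides χ xs = trans (cong₂ _+_ (sym (∑-1 (inside χ xs))) (sym (∑-1 (outside χ xs))))
    (trans (sym (∑-sides χ xs (λ _ → 1))) (∑-1 xs))

  cut-sides : ∀ H (χ : Fin n → Bool) xs → cut H χ xs ≡ (∑[ u ∈ inside χ xs ] ∑[ v ∈ outside χ xs ] H u v)
  cut-sides H χ xs = begin
    (∑[ u ∈ xs ] ∑[ v ∈ xs ] crosses χ u v * H u v)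
      ≡⟨ ∑-cong xs (λ u → trans (∑-cong xs λ v → trans (cong (_* H u v) (⟦∧⟧ (χ u) (not (χ v)))) (*-assoc ⟦ χ u ⟧ _ (H u v)))
           (trans (∑-*ˡ ⟦ χ u ⟧ xs _) (cong (⟦ χ u ⟧ *_) (sym (∑-filterᵇ (not ∘ χ) xs (H u)))))) ⟩
    (∑[ u ∈ xs ] ⟦ χ u ⟧ * (∑[ v ∈ outside χ xs ] H u v))
      ≡⟨ sym (∑-filterᵇ χ xs _) ⟩
    (∑[ u ∈ inside χ xs ] ∑[ v ∈ outside χ xs ] H u v) ∎
    where open ≡-Reasoning

  smaller : (Fin n → Bool) → List (Fin n) → ℕ
  smaller χ xs = length (inside χ xs) ⊓ length (outside χ xs)

  cut-cong : ∀ H {χ χ′ : Fin n → Bool} → (∀ v → χ v ≡ χ′ v) → ∀ xs → cut H χ xs ≡ cut H χ′ xs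
  cut-cong H e xs = ∑-cong xs λ u → ∑-cong xs λ v → cong₂ (λ a b → ⟦ a ∧ not b ⟧ * H u v) (e u) (e v)

  smaller-cong : ∀ {χ χ′ : Fin n → Bool} → (∀ v → χ v ≡ χ′ v) → ∀ xs → smaller χ xs ≡ smaller χ′ xs
  smaller-cong {χ} {χ′} e xs = cong₂ _⊓_ (side χ χ′ e) (side (not ∘ χ) (not ∘ χ′) (cong not ∘ e))
    where
    side : ∀ (p p′ : Fin n → Bool) → (∀ v → p v ≡ p′ v) → length (filterᵇ p xs) ≡ length (filterᵇ p′ xs)
    side p p′ e = trans (length-filterᵇ p xs) (trans (∑-cong xs λ x → cong ⟦_⟧ (e x)) (sym (length-filterᵇ p′ xs)))

  module _ (D : ℕ) (H : Fin n → Fin n → ℕ) where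

    Expands : List (Fin n) → Set
    Expands xs = ∀ χ → D * smaller χ xs ≤ cut H χ xs

    -- A removed edge is stored in one orientation but may be cut in either direction, hence the
    -- exclusive or; `cut` counts pairs directed out of χ.
    split-edges : (Fin n → Bool) → List (Fin n × Fin n) → ℕ
    split-edges χ E = ∑[ e ∈ E ] ⟦ χ (proj₁ e) xor χ (proj₂ e) ⟧

    record Decomposition (xs : List (Fin n)) : Set where
      field
        pieces      : List (List (Fin n))
        edges       : List (Fin n × Fin n)
        cut-pieces  : ∀ χ → cut H χ xs ≡ ∑ pieces (cut H χ) + split-edges χ edges
        expands     : ∀ {P} → P ∈ pieces → Expands P
        pieces-size : ∑ pieces length ≤ length xs
        #pieces     : length pieces ≤ length xs
        edges-size  : length edges ≤ D * (length xs * lg (length xs))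

    open Decomposition

    between : List (Fin n) → List (Fin n) → List (Fin n × Fin n)
    between ys zs = concatMap (λ y → map (y ,_) (filterᵇ (positive ∘ H y) zs)) ys

    module _ (H≤1 : ∀ u v → H u v ≤ 1) (H-sym : ∀ u v → H u v ≡ H v u) where

      ∑-between : ∀ ys zs (f : Fin n × Fin n → ℕ) →
        ∑ (between ys zs) f ≡ (∑[ y ∈ ys ] ∑[ z ∈ zs ] H y z * f (y , z))
      ∑-between ys zs f = trans (∑-concatMap _ ys f) (∑-cong ys λ y →
        trans (∑-map (y ,_) (filterᵇ (positive ∘ H y) zs) f)
        (trans (∑-filterᵇ (positive ∘ H y) zs _) (∑-cong zs λ z → cong (_* f (y , z)) (⟦positive⟧ (H≤1 y z)))))

      length-between : ∀ χ xs → length (between (inside χ xs) (outside χ xs)) ≡ cut H χ xs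
      length-between χ xs = begin
        length E ≡⟨ sym (∑-1 E) ⟩
        (∑[ _ ∈ E ] 1) ≡⟨ ∑-between (inside χ xs) (outside χ xs) (λ _ → 1) ⟩
        (∑[ u ∈ inside χ xs ] ∑[ v ∈ outside χ xs ] H u v * 1) ≡⟨ ∑-cong (inside χ xs) (λ u → ∑-cong (outside χ xs) λ v → *-identityʳ (H u v)) ⟩
        (∑[ u ∈ inside χ xs ] ∑[ v ∈ outside χ xs ] H u v) ≡⟨ sym (cut-sides H χ xs) ⟩
        cut H χ xs ∎
        where
        open ≡-Reasoning
        E : List (Fin n × Fin n)
        E = between (inside χ xs) (outside χ xs)

      -- The double sum falls into four blocks. By the symmetry of H the two mixed ones add up to
      -- one term for every removed edge that χ separates.
      cut-between : ∀ ψ xs χ → cut H χ xs ≡ cut H χ (inside ψ xs) + cut H χ (outside ψ xs)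
                                             + split-edges χ (between (inside ψ xs) (outside ψ xs))
      cut-between ψ xs χ = begin
        ∑ xs (λ u → ∑ xs (F u))
          ≡⟨ ∑-cong xs (λ u → ∑-sides ψ xs (F u)) ⟩
        (∑[ u ∈ xs ] ∑ ys (F u) + ∑ zs (F u))
          ≡⟨ ∑-sides ψ xs (λ u → ∑ ys (F u) + ∑ zs (F u)) ⟩
        (∑[ u ∈ ys ] ∑ ys (F u) + ∑ zs (F u)) + (∑[ u ∈ zs ] ∑ ys (F u) + ∑ zs (F u))
          ≡⟨ cong₂ _+_ (∑-+ ys _ _) (∑-+ zs _ _) ⟩
        (cut H χ ys + (∑[ u ∈ ys ] ∑ zs (F u))) + ((∑[ u ∈ zs ] ∑ ys (F u)) + cut H χ zs)
          ≡⟨ cong (λ t → (cut H χ ys + (∑[ u ∈ ys ] ∑ zs (F u))) + (t + cut H χ zs)) (∑-swap zs ys F) ⟩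
        (cut H χ ys + (∑[ u ∈ ys ] ∑ zs (F u))) + ((∑[ u ∈ ys ] ∑[ v ∈ zs ] F v u) + cut H χ zs)
          ≡⟨ regroup (cut H χ ys) (∑[ u ∈ ys ] ∑ zs (F u)) (∑[ u ∈ ys ] ∑[ v ∈ zs ] F v u) (cut H χ zs) ⟩
        cut H χ ys + cut H χ zs + ((∑[ u ∈ ys ] ∑ zs (F u)) + (∑[ u ∈ ys ] ∑[ v ∈ zs ] F v u))
          ≡⟨ cong (cut H χ ys + cut H χ zs +_) (trans (sym (∑-+ ys _ _)) (trans
               (∑-cong ys λ u → trans (sym (∑-+ zs _ _)) (∑-cong zs λ v → either u v))
               (sym (∑-between ys zs _)))) ⟩
        cut H χ ys + cut H χ zs + split-edges χ (between ys zs) ∎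
        where
        open ≡-Reasoning
        ys zs : List (Fin n)
        ys = inside ψ xs
        zs = outside ψ xs
        F : Fin n → Fin n → ℕ
        F u v = crosses χ u v * H u v
        regroup : ∀ a b c d → (a + b) + (c + d) ≡ a + d + (b + c)
        regroup = solve-∀
        either : ∀ u v → F u v + F v u ≡ H u v * ⟦ χ u xor χ v ⟧
        either u v rewrite H-sym v u with χ u | χ v
        ... | true  | true  = sym (*-zeroʳ (H u v))
        ... | true  | false = trans (+-identityʳ (H u v + 0)) (*-comm 1 (H u v))
        ... | false | true  = *-comm 1 (H u v)
        ... | false | false = sym (*-zeroʳ (H u v))

      -- As long as some cut violates the expansion condition, split along it; fewer than D times
      -- the smaller side edges are removed, which the potential n log n pays for. Exhaustive search
      -- over subsets decides whether such a cut exists.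
      decompose : ∀ fuel xs → length xs ≤ fuel → Decomposition xs
      decompose fuel [] _ = record
        { pieces = [] ; edges = [] ; cut-pieces = λ χ → refl ; expands = λ ()
        ; pieces-size = z≤n ; #pieces = z≤n ; edges-size = z≤n }
      decompose (suc fuel) xs@(_ ∷ _) len≤
        with anySubset? (λ S → cut H (lookup S) xs <? D * smaller (lookup S) xs)
      ... | no ∄ = record
        { pieces = xs ∷ [] ; edges = []
        ; cut-pieces = λ χ → sym (trans (+-identityʳ _) (+-identityʳ _))
        ; expands = λ { (here refl) χ → subst₂ (λ s c → D * s ≤ c)
                          (smaller-cong (lookup∘tabulate χ) xs) (cut-cong H (lookup∘tabulate χ) xs)
                          (≮⇒≥ λ lt → ∄ (tabulate χ , lt)) }
        ; pieces-size = ≤-reflexive (+-identityʳ _) ; #pieces = s≤s z≤n ; edges-size = z≤n }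
      ... | yes (S , lt) = record
        { pieces      = pieces dy ++ pieces dz
        ; edges       = between ys zs ++ edges dy ++ edges dz
        ; cut-pieces  = cut-pieces′
        ; expands     = λ P∈ → [ expands dy , expands dz ]′ (∈-++⁻ (pieces dy) P∈)
        ; pieces-size = ≤-trans (≤-reflexive (∑-++ (pieces dy) (pieces dz) length))
                          (≤-trans (+-mono-≤ (pieces-size dy) (pieces-size dz)) (≤-reflexive (length-sides ψ xs)))
        ; #pieces     = ≤-trans (≤-reflexive (length-++ (pieces dy)))
                          (≤-trans (+-mono-≤ (#pieces dy) (#pieces dz)) (≤-reflexive (length-sides ψ xs)))
        ; edges-size  = edges-size′ }
        where
        ψ = lookup S
        ys = inside ψ xs
        zs = outside ψ xs
        a = length ys
        b = length zs
        -- A cut strictly below D times the smaller side leaves neither side empty, so both are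
        -- shorter than `xs` and the fuel suffices.
        1≤smaller : 1 ≤ a ⊓ b
        1≤smaller = positive-factor D (a ⊓ b) lt
        1≤a = ≤-trans 1≤smaller (m⊓n≤m a b)
        1≤b = ≤-trans 1≤smaller (m⊓n≤n a b)
        dy = decompose fuel ys (s≤s⁻¹ (≤-trans (≤-trans (≤-reflexive (+-comm 1 a)) (+-monoʳ-≤ a 1≤b))
               (≤-trans (≤-reflexive (length-sides ψ xs)) len≤)))
        dz = decompose fuel zs (s≤s⁻¹ (≤-trans (+-monoˡ-≤ b 1≤a)
               (≤-trans (≤-reflexive (length-sides ψ xs)) len≤)))
        cut-pieces′ : ∀ χ → cut H χ xs ≡ ∑ (pieces dy ++ pieces dz) (cut H χ)
                                          + split-edges χ (between ys zs ++ edges dy ++ edges dz)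
        cut-pieces′ χ = begin
          cut H χ xs
            ≡⟨ cut-between ψ xs χ ⟩
          cut H χ ys + cut H χ zs + s (between ys zs)
            ≡⟨ cong₂ (λ x y → x + y + s (between ys zs)) (cut-pieces dy χ) (cut-pieces dz χ) ⟩
          (p dy + s (edges dy)) + (p dz + s (edges dz)) + s (between ys zs)
            ≡⟨ regroup (p dy) (s (edges dy)) (p dz) (s (edges dz)) (s (between ys zs)) ⟩
          (p dy + p dz) + (s (between ys zs) + (s (edges dy) + s (edges dz)))
            ≡⟨ cong₂ _+_ (sym (∑-++ (pieces dy) (pieces dz) (cut H χ)))
                 (sym (trans (∑-++ (between ys zs) _ _) (cong (s (between ys zs) +_) (∑-++ (edges dy) (edges dz) _)))) ⟩
          ∑ (pieces dy ++ pieces dz) (cut H χ) + s (between ys zs ++ edges dy ++ edges dz) ∎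
          where
          open ≡-Reasoning
          s : List (Fin n × Fin n) → ℕ
          s = split-edges χ
          p : ∀ {xs} → Decomposition xs → ℕ
          p d = ∑ (pieces d) (cut H χ)
          regroup : ∀ a b c d e → (a + b) + (c + d) + e ≡ (a + c) + (e + (b + d))
          regroup = solve-∀
        edges-size′ : length (between ys zs ++ edges dy ++ edges dz) ≤ D * (length xs * lg (length xs))
        edges-size′ = begin
          length (between ys zs ++ edges dy ++ edges dz)
            ≡⟨ trans (length-++ (between ys zs)) (cong₂ _+_ (length-between ψ xs) (length-++ (edges dy))) ⟩
          cut H ψ xs + (length (edges dy) + length (edges dz))
            ≤⟨ +-mono-≤ (<⇒≤ lt) (+-mono-≤ (edges-size dy) (edges-size dz)) ⟩
          D * (a ⊓ b) + (D * (a * lg a) + D * (b * lg b))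
            ≡⟨ regroup D (a ⊓ b) (a * lg a) (b * lg b) ⟩
          D * (a * lg a + b * lg b + a ⊓ b)
            ≤⟨ *-monoʳ-≤ D (split-potential a b 1≤a 1≤b) ⟩
          D * ((a + b) * lg (a + b))
            ≡⟨ cong (λ k → D * (k * lg k)) (length-sides ψ xs) ⟩
          D * (length xs * lg (length xs)) ∎
          where
          open ≤-Reasoning
          regroup : ∀ d m x y → d * m + (d * x + d * y) ≡ d * (x + y + m)
          regroup = solve-∀

-- Independent choices, amplification and medians.

module Sampling where
  open Prelude
  open import Data.Bool.Base using (T)
  open import Data.Unit.Base using (tt)
  open Sums

  module _ {A : Set} where

    -- The sample space of independent uniform draws, one from each list, given by all its outcomes
    -- with multiplicity.
    choices : List (List A) → List (List A)
    choices []       = [] ∷ []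
    choices (L ∷ Ls) = concatMap (λ a → map (a ∷_) (choices Ls)) L

    ∑-choices : ∀ L Ls f → ∑ (choices (L ∷ Ls)) f ≡ (∑[ a ∈ L ] ∑[ as ∈ choices Ls ] f (a ∷ as))
    ∑-choices L Ls f = trans (∑-concatMap _ L f) (∑-cong L λ a → ∑-map (a ∷_) (choices Ls) f)

    length-choices : ∀ L Ls → length (choices (L ∷ Ls)) ≡ length L * length (choices Ls)
    length-choices L Ls = trans (length-concatMap _ L)
      (trans (∑-cong L λ a → length-map (a ∷_) (choices Ls)) (∑-const L _))

    choices-nonempty : ∀ Ls → (∀ {L} → L ∈ Ls → 1 ≤ length L) → 1 ≤ length (choices Ls)
    choices-nonempty []       _  = ≤-refl
    choices-nonempty (L ∷ Ls) ne = subst (1 ≤_) (sym (length-choices L Ls))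
      (*-mono-≤ (ne (here refl)) (choices-nonempty Ls (ne ∘ there)))

    length-∈-choices : ∀ Ls {as} → as ∈ choices Ls → length as ≡ length Ls
    length-∈-choices []       (here refl) = refl
    length-∈-choices (L ∷ Ls) as∈ with find (∈-concatMap⁻ (λ a → map (a ∷_) (choices Ls)) {xs = L} as∈)
    ... | a , _ , as∈a with ∈-map⁻ (a ∷_) as∈a
    ... | _ , bs∈ , refl = cong suc (length-∈-choices Ls bs∈)

    ∈-replicate : ∀ k {a b : A} → a ∈ replicate k b → a ≡ b
    ∈-replicate (suc k) (here refl) = refl
    ∈-replicate (suc k) (there a∈)  = ∈-replicate k a∈

    -- Weighting a tuple by 16 ^ #bad makes the coordinates independent factors.
    module Amplification (Ω : List A) (bad : A → Bool) (rare : 16 * (∑[ ω ∈ Ω ] ⟦ bad ω ⟧) ≤ length Ω) where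

      badness : List A → ℕ
      badness τ = ∑[ ω ∈ τ ] ⟦ bad ω ⟧

      tuples : ℕ → List (List A)
      tuples k = choices (replicate k Ω)

      mostlyBad : ℕ → List A → Bool
      mostlyBad k τ = k ≤ᵇ 2 * badness τ

      private
        -- The mean of the weight is 1 + 15 Pr(bad), and Pr(bad) is at most 1 / 16.
        one-trial : (∑[ ω ∈ Ω ] 16 ^ ⟦ bad ω ⟧) ≤ 2 * length Ω
        one-trial = begin
          (∑[ ω ∈ Ω ] 16 ^ ⟦ bad ω ⟧) ≡⟨ ∑-cong Ω (λ ω → weight (bad ω)) ⟩
          (∑[ ω ∈ Ω ] 1 + 15 * ⟦ bad ω ⟧) ≡⟨ ∑-+ Ω _ _ ⟩
          (∑[ ω ∈ Ω ] 1) + (∑[ ω ∈ Ω ] 15 * ⟦ bad ω ⟧)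
            ≡⟨ cong₂ _+_ (∑-1 Ω) (∑-*ˡ 15 Ω λ ω → ⟦ bad ω ⟧) ⟩
          length Ω + 15 * badness Ω ≤⟨ +-monoʳ-≤ (length Ω) (*-monoˡ-≤ (badness Ω) (n≤1+n 15)) ⟩
          length Ω + 16 * badness Ω ≤⟨ +-monoʳ-≤ (length Ω) rare ⟩
          length Ω + length Ω ≡⟨ cong (length Ω +_) (sym (+-identityʳ (length Ω))) ⟩
          2 * length Ω ∎
          where
          open ≤-Reasoning
          weight : ∀ b → 16 ^ ⟦ b ⟧ ≡ 1 + 15 * ⟦ b ⟧
          weight true  = refl
          weight false = refl

        all-trials : ∀ k → (∑[ τ ∈ tuples k ] 16 ^ badness τ) ≤ 2 ^ k * length (tuples k)
        all-trials zero    = ≤-refl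
        all-trials (suc k) = begin
          ∑ (tuples (suc k)) (λ τ → 16 ^ badness τ)
            ≡⟨ ∑-choices Ω (replicate k Ω) _ ⟩
          (∑[ ω ∈ Ω ] ∑[ τ ∈ tuples k ] 16 ^ (⟦ bad ω ⟧ + badness τ))
            ≡⟨ ∑-cong Ω (λ ω → trans (∑-cong (tuples k) λ τ → ^-distribˡ-+-* 16 ⟦ bad ω ⟧ (badness τ)) (∑-*ˡ (16 ^ ⟦ bad ω ⟧) (tuples k) λ τ → 16 ^ badness τ)) ⟩
          (∑[ ω ∈ Ω ] 16 ^ ⟦ bad ω ⟧ * (∑[ τ ∈ tuples k ] 16 ^ badness τ))
            ≡⟨ ∑-*ʳ _ Ω _ ⟩
          (∑[ ω ∈ Ω ] 16 ^ ⟦ bad ω ⟧) * (∑[ τ ∈ tuples k ] 16 ^ badness τ)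
            ≤⟨ *-mono-≤ one-trial (all-trials k) ⟩
          2 * length Ω * (2 ^ k * length (tuples k))
            ≡⟨ regroup 2 (length Ω) (2 ^ k) (length (tuples k)) ⟩
          2 * 2 ^ k * (length Ω * length (tuples k))
            ≡⟨ cong (2 * 2 ^ k *_) (sym (length-choices Ω (replicate k Ω))) ⟩
          2 ^ suc k * length (tuples (suc k)) ∎
          where
          open ≤-Reasoning
          regroup : ∀ a b c d → a * b * (c * d) ≡ a * c * (b * d)
          regroup = solve-∀

      -- Markov's inequality for 16 ^ `badness`: a mostly bad tuple has weight at least 4 ^ k, while
      -- the mean weight is at most 2 ^ k.
      mostly-bad-rare : ∀ k → (∑[ τ ∈ tuples k ] ⟦ mostlyBad k τ ⟧) * 2 ^ k ≤ length (tuples k)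
      mostly-bad-rare k = *-cancelˡ-≤ (2 ^ k) {{m^n≢0 2 k}} (begin
        2 ^ k * (count * 2 ^ k) ≡⟨ regroup (2 ^ k) count ⟩
        count * (2 ^ k * 2 ^ k) ≡⟨ sym (∑-*ʳ _ (tuples k) _) ⟩
        (∑[ τ ∈ tuples k ] ⟦ mostlyBad k τ ⟧ * (2 ^ k * 2 ^ k)) ≤⟨ ∑-mono (tuples k) pointwise ⟩
        (∑[ τ ∈ tuples k ] 16 ^ badness τ) ≤⟨ all-trials k ⟩
        2 ^ k * length (tuples k) ∎)
        where
        open ≤-Reasoning
        count : ℕ
        count = ∑[ τ ∈ tuples k ] ⟦ mostlyBad k τ ⟧
        regroup : ∀ a c → a * (c * a) ≡ c * (a * a)
        regroup = solve-∀
        pointwise : ∀ τ → ⟦ mostlyBad k τ ⟧ * (2 ^ k * 2 ^ k) ≤ 16 ^ badness τ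
        pointwise τ with mostlyBad k τ in eq
        ... | false = z≤n
        ... | true  = begin
          2 ^ k * 2 ^ k + 0 ≡⟨ +-identityʳ _ ⟩
          2 ^ k * 2 ^ k ≡⟨ sym (^-distribˡ-+-* 2 k k) ⟩
          2 ^ (k + k) ≤⟨ ^-monoʳ-≤ 2 (+-mono-≤ k≤ k≤) ⟩
          2 ^ (2 * b + 2 * b) ≡⟨ cong (2 ^_) (four b) ⟩
          2 ^ (4 * b) ≡⟨ sym (^-*-assoc 2 4 b) ⟩
          16 ^ b ∎
          where
          b : ℕ
          b = badness τ
          k≤ : k ≤ 2 * b
          k≤ = ≤ᵇ⇒≤ k (2 * b) (subst T (sym eq) tt)
          four : ∀ b → 2 * b + 2 * b ≡ 4 * b
          four = solve-∀

      mostly-good : ∀ k τ → mostlyBad k τ ≡ false → 2 * badness τ < k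
      mostly-good k τ eq = ≰⇒> λ k≤ → subst T eq (≤⇒≤ᵇ k≤)

  least : (ℕ → Bool) → ℕ → ℕ
  least p zero       = 0
  least p (suc fuel) with p 0
  ... | true  = 0
  ... | false = suc (least (p ∘ suc) fuel)

  least-≤ : ∀ p fuel {v} → p v ≡ true → least p fuel ≤ v
  least-≤ p zero       pv = z≤n
  least-≤ p (suc fuel) {v} pv with p 0 in eq
  ... | true = z≤n
  least-≤ p (suc fuel) {zero}  pv | false = contradiction (trans (sym pv) eq) λ ()
  least-≤ p (suc fuel) {suc v} pv | false = s≤s (least-≤ (p ∘ suc) fuel pv)

  least-true : ∀ (p : ℕ → Bool) fuel → p fuel ≡ true → p (least p fuel) ≡ true
  least-true p zero       pf = pf
  least-true p (suc fuel) pf with p 0 in eq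
  ... | true  = eq
  ... | false = least-true (p ∘ suc) fuel pf

  private
    atMost : List ℕ → ℕ → ℕ
    atMost vs v = ∑[ x ∈ vs ] ⟦ x ≤ᵇ v ⟧

    majority : List ℕ → ℕ → Bool
    majority vs v = length vs <ᵇ 2 * atMost vs v

  -- A search for the least value that a strict majority does not exceed needs no sorting. The sum
  -- is at least every entry, so for a nonempty list the search ends at such a value.
  median : List ℕ → ℕ
  median vs = least (majority vs) (∑ vs λ v → v)

  module _ {lo hi : ℕ} (bad : ℕ → Bool) (good : ∀ x → bad x ≡ false → lo ≤ x × x ≤ hi)
           (vs : List ℕ) (few : 2 * (∑[ x ∈ vs ] ⟦ bad x ⟧) < length vs) where

    private
      badness : ℕ
      badness = ∑[ x ∈ vs ] ⟦ bad x ⟧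

      majority-true : ∀ v → length vs < 2 * atMost vs v → majority vs v ≡ true
      majority-true v lt with majority vs v | <⇒<ᵇ lt
      ... | true | _ = refl

      true-≤ᵇ : ∀ {m n} → m ≤ n → ⟦ m ≤ᵇ n ⟧ ≡ 1
      true-≤ᵇ {m} {n} m≤n with m ≤ᵇ n | ≤⇒≤ᵇ m≤n
      ... | true | _ = refl

      1≤length : 1 ≤ length vs
      1≤length = ≤-trans (s≤s z≤n) few

      -- Every entry is at most `hi` or bad, and fewer than half are bad.
      majority-hi : majority vs hi ≡ true
      majority-hi = majority-true hi (+-cancelʳ-< (length vs) _ _ (begin-strict
        length vs + length vs ≡⟨ cong (length vs +_) (sym (+-identityʳ _)) ⟩
        2 * length vs ≤⟨ *-monoʳ-≤ 2 cover ⟩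
        2 * (atMost vs hi + badness) ≡⟨ *-distribˡ-+ 2 (atMost vs hi) badness ⟩
        2 * atMost vs hi + 2 * badness <⟨ +-monoʳ-< (2 * atMost vs hi) few ⟩
        2 * atMost vs hi + length vs ∎))
        where
        open ≤-Reasoning
        pointwise : ∀ x → 1 ≤ ⟦ x ≤ᵇ hi ⟧ + ⟦ bad x ⟧
        pointwise x with bad x in eq
        ... | true  = m≤n+m 1 _
        ... | false = subst (λ b → 1 ≤ b + 0) (sym (true-≤ᵇ (proj₂ (good x eq)))) ≤-refl
        cover : length vs ≤ atMost vs hi + badness
        cover = ≤-trans (≤-reflexive (sym (∑-1 vs))) (≤-trans (∑-mono vs pointwise) (≤-reflexive (∑-+ vs _ _)))

      majority-sum : majority vs (∑ vs λ v → v) ≡ true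
      majority-sum = majority-true _ (subst (length vs <_) (sym (cong (2 *_) all))
        (≤-trans (≤-reflexive (+-comm 1 _)) (+-monoʳ-≤ (length vs) (≤-trans 1≤length (m≤m+n _ 0)))))
        where
        all : atMost vs (∑ vs λ v → v) ≡ length vs
        all = trans (∑-cong-∈ vs λ x x∈ → true-≤ᵇ (∑-∈ (λ v → v) x∈)) (∑-1 vs)

    median-≤ : median vs ≤ hi
    median-≤ = least-≤ (majority vs) (∑ vs λ v → v) majority-hi

    -- Were the median below `lo`, the strict majority of entries up to it would consist of bad
    -- ones.
    median-≥ : lo ≤ median vs
    median-≥ with lo ≤? median vs
    ... | yes p = p
    ... | no ≰  = contradiction few (<⇒≯ (<-≤-trans
          (<ᵇ⇒< _ _ (subst T (sym (least-true (majority vs) (∑ vs λ v → v) majority-sum)) tt))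
          (*-monoʳ-≤ 2 (∑-mono vs pointwise))))
      where
      pointwise : ∀ x → ⟦ x ≤ᵇ median vs ⟧ ≤ ⟦ bad x ⟧
      pointwise x with bad x in eq
      ... | true  = ⟦⟧≤1 (x ≤ᵇ median vs)
      ... | false with x ≤ᵇ median vs in le
      ... | false = z≤n
      ... | true  = contradiction (≤-trans (proj₁ (good x eq)) (≤ᵇ⇒≤ x (median vs) (subst T (sym le) tt))) ≰

-- Neighbour sampling in an expanding piece, and Chebyshev's inequality.

module PieceEstimator {n : Prelude.ℕ} where
  open Prelude
  open import Data.Bool.Base using (T)
  open import Data.List.Base using (concat)
  open import Data.List.Properties using (map-id)
  open import Data.Unit.Base using (tt)
  open Sums
  open ContractedGraph using (crosses; cut)
  open SparseCuts
  open Sampling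

  private
    V : Set
    V = Fin n

  -- An item (w , u) turns a sampled neighbour a of u into the value w if ua is cut, else 0.
  score : (V → Bool) → List (ℕ × V) → List V → ℕ
  score χ ((w , u) ∷ is) (a ∷ as) = w * ⟦ χ u xor χ a ⟧ + score χ is as
  score χ _              _        = 0

  module _ (χ : V → Bool) where

    -- Mean m and variance v of the value of an item for a uniform a in L. The moments are
    -- multiplied by the length of L to avoid division.
    record Draw (w : ℕ) (u : V) (L : List V) (m v : ℕ) : Set where
      constructor draw
      field
        mean   : (∑[ a ∈ L ] w * ⟦ χ u xor χ a ⟧) ≡ length L * m
        second : (∑[ a ∈ L ] (w * ⟦ χ u xor χ a ⟧) * (w * ⟦ χ u xor χ a ⟧)) ≡ length L * (m * m + v)

    data Draws : List (ℕ × V) → List (List V) → ℕ → ℕ → Set where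
      []  : Draws [] [] 0 0
      _∷_ : ∀ {w u L is Ls m v μ σ} → Draw w u L m v → Draws is Ls μ σ →
            Draws ((w , u) ∷ is) (L ∷ Ls) (m + μ) (v + σ)

    infixr 5 _++ᴰ_

    _++ᴰ_ : ∀ {is Ls μ σ is′ Ls′ μ′ σ′} → Draws is Ls μ σ → Draws is′ Ls′ μ′ σ′ →
            Draws (is ++ is′) (Ls ++ Ls′) (μ + μ′) (σ + σ′)
    [] ++ᴰ es = es
    _++ᴰ_ {μ′ = μ′} {σ′ = σ′} (_∷_ {m = m} {v = v} {μ = μ} {σ = σ} d ds) es =
      subst₂ (Draws _ _) (sym (+-assoc m μ μ′)) (sym (+-assoc v σ σ′)) (d ∷ (ds ++ᴰ es))

    replicateᴰ : ∀ k {w u L m v} → Draw w u L m v →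
      Draws (replicate k (w , u)) (replicate k L) (k * m) (k * v)
    replicateᴰ zero    d = []
    replicateᴰ (suc k) d = d ∷ replicateᴰ k d

    concatMapᴰ : ∀ {A : Set} (is : A → List (ℕ × V)) (Ls : A → List (List V)) (μ σ : A → ℕ) xs →
      (∀ {x} → x ∈ xs → Draws (is x) (Ls x) (μ x) (σ x)) →
      Draws (concatMap is xs) (concatMap Ls xs) (∑ xs μ) (∑ xs σ)
    concatMapᴰ is Ls μ σ []       ds = []
    concatMapᴰ is Ls μ σ (x ∷ xs) ds = ds (here refl) ++ᴰ concatMapᴰ is Ls μ σ xs (ds ∘ there)

    first-moment : ∀ {is Ls μ σ} → Draws is Ls μ σ →
      (∑[ ω ∈ choices Ls ] score χ is ω) ≡ length (choices Ls) * μ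
    first-moment [] = refl
    first-moment (_∷_ {w} {u} {L} {is} {Ls} {m} {v} {μ} {σ} d ds) = begin
      ∑ (choices (L ∷ Ls)) (score χ ((w , u) ∷ is))
        ≡⟨ ∑-choices L Ls _ ⟩
      (∑[ a ∈ L ] ∑[ ω ∈ Ω ] x a + X ω)
        ≡⟨ ∑-cong L (λ a → trans (∑-+ Ω _ X) (cong₂ _+_ (∑-const Ω (x a)) (first-moment ds))) ⟩
      (∑[ a ∈ L ] length Ω * x a + length Ω * μ)
        ≡⟨ trans (∑-+ L _ _) (cong₂ _+_ (∑-*ˡ (length Ω) L x) (∑-const L _)) ⟩
      length Ω * ∑ L x + length L * (length Ω * μ)
        ≡⟨ cong (λ e → length Ω * e + length L * (length Ω * μ)) (Draw.mean d) ⟩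
      length Ω * (length L * m) + length L * (length Ω * μ)
        ≡⟨ collect (length L) (length Ω) m μ ⟩
      length L * length Ω * (m + μ)
        ≡⟨ cong (_* (m + μ)) (sym (length-choices L Ls)) ⟩
      length (choices (L ∷ Ls)) * (m + μ) ∎
      where
      open ≡-Reasoning
      Ω : List (List V)
      Ω = choices Ls
      x : V → ℕ
      x a = w * ⟦ χ u xor χ a ⟧
      X : List V → ℕ
      X = score χ is
      collect : ∀ l k m μ → k * (l * m) + l * (k * μ) ≡ l * k * (m + μ)
      collect = solve-∀

    -- By independence the mean of the product of the first value and the remaining score is the
    -- product of the means. The cross term thus completes the square of m + μ, and the variances
    -- add.
    second-moment : ∀ {is Ls μ σ} → Draws is Ls μ σ →
      (∑[ ω ∈ choices Ls ] score χ is ω * score χ is ω) ≡ length (choices Ls) * (μ * μ + σ)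
    second-moment [] = refl
    second-moment (_∷_ {w} {u} {L} {is} {Ls} {m} {v} {μ} {σ} d ds) = begin
      ∑ (choices (L ∷ Ls)) (λ ω → score χ ((w , u) ∷ is) ω * score χ ((w , u) ∷ is) ω)
        ≡⟨ ∑-choices L Ls _ ⟩
      (∑[ a ∈ L ] ∑[ ω ∈ Ω ] (x a + X ω) * (x a + X ω))
        ≡⟨ ∑-cong L (λ a → trans (∑-cong Ω λ ω → square (x a) (X ω)) (trans (∑-+ Ω _ _)
             (cong₂ _+_ (∑-const Ω (x a * x a)) (trans (∑-+ Ω _ _) (cong₂ _+_ (∑-*ˡ (2 * x a) Ω X) refl))))) ⟩
      (∑[ a ∈ L ] length Ω * (x a * x a) + (2 * x a * ∑ Ω X + S))
        ≡⟨ ∑-cong L (λ a → cong₂ (λ p q → length Ω * (x a * x a) + (2 * x a * p + q)) (first-moment ds) (second-moment ds)) ⟩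
      (∑[ a ∈ L ] length Ω * (x a * x a) + (2 * x a * (length Ω * μ) + length Ω * (μ * μ + σ)))
        ≡⟨ trans (∑-+ L _ _) (cong₂ _+_ (∑-*ˡ (length Ω) L _) (trans (∑-+ L _ _)
             (cong₂ _+_ (trans (∑-*ʳ (length Ω * μ) L _) (cong (_* (length Ω * μ)) (∑-*ˡ 2 L x))) (∑-const L _)))) ⟩
      length Ω * (∑[ a ∈ L ] x a * x a) + (2 * ∑ L x * (length Ω * μ) + length L * (length Ω * (μ * μ + σ)))
        ≡⟨ cong₂ (λ p q → length Ω * p + (2 * q * (length Ω * μ) + length L * (length Ω * (μ * μ + σ)))) (Draw.second d) (Draw.mean d) ⟩
      length Ω * (length L * (m * m + v)) + (2 * (length L * m) * (length Ω * μ) + length L * (length Ω * (μ * μ + σ)))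
        ≡⟨ collect (length L) (length Ω) m v μ σ ⟩
      length L * length Ω * ((m + μ) * (m + μ) + (v + σ))
        ≡⟨ cong (_* ((m + μ) * (m + μ) + (v + σ))) (sym (length-choices L Ls)) ⟩
      length (choices (L ∷ Ls)) * ((m + μ) * (m + μ) + (v + σ)) ∎
      where
      open ≡-Reasoning
      Ω : List (List V)
      Ω = choices Ls
      x : V → ℕ
      x a = w * ⟦ χ u xor χ a ⟧
      X : List V → ℕ
      X = score χ is
      S : ℕ
      S = ∑[ ω ∈ Ω ] X ω * X ω
      square : ∀ a b → (a + b) * (a + b) ≡ a * a + (2 * a * b + b * b)
      square = solve-∀
      collect : ∀ l k m v μ σ →
        k * (l * (m * m + v)) + (2 * (l * m) * (k * μ) + l * (k * (μ * μ + σ))) ≡ l * k * ((m + μ) * (m + μ) + (v + σ))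
      collect = solve-∀

    ∣-∣-square : ∀ a b → ∣ a - b ∣ * ∣ a - b ∣ + 2 * a * b ≡ a * a + b * b
    ∣-∣-square a b with ≤-total a b
    ... | inj₁ a≤b = subst (λ b → ∣ a - b ∣ * ∣ a - b ∣ + 2 * a * b ≡ a * a + b * b) (m+[n∸m]≡n a≤b)
          (trans (cong (λ d → d * d + 2 * a * (a + (b ∸ a))) (∣m-m+n∣≡n a (b ∸ a))) (identity a (b ∸ a)))
      where
      identity : ∀ a k → k * k + 2 * a * (a + k) ≡ a * a + (a + k) * (a + k)
      identity = solve-∀
    ... | inj₂ b≤a = subst (λ a → ∣ a - b ∣ * ∣ a - b ∣ + 2 * a * b ≡ a * a + b * b) (m+[n∸m]≡n b≤a)
          (trans (cong (λ d → d * d + 2 * (b + (a ∸ b)) * b) (∣m+n-m∣≡n b (a ∸ b))) (identity b (a ∸ b)))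
      where
      ∣m+n-m∣≡n : ∀ m n → ∣ m + n - m ∣ ≡ n
      ∣m+n-m∣≡n m n = trans (∣-∣-comm (m + n) m) (∣m-m+n∣≡n m n)
      identity : ∀ b k → k * k + 2 * (b + k) * b ≡ (b + k) * (b + k) + b * b
      identity = solve-∀

    -- The usual second moment minus the square of the mean, with the cross term kept on the other
    -- side because subtraction is truncated.
    variance : ∀ {is Ls μ σ} → Draws is Ls μ σ →
      (∑[ ω ∈ choices Ls ] ∣ score χ is ω - μ ∣ * ∣ score χ is ω - μ ∣) ≡ length (choices Ls) * σ
    variance {is} {Ls} {μ} {σ} ds = +-cancelʳ-≡ (2 * (N * μ) * μ) _ _ (begin
      ∑ Ω (λ ω → ∣ X ω - μ ∣ * ∣ X ω - μ ∣) + 2 * (N * μ) * μ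
        ≡⟨ cong (λ s → ∑ Ω (λ ω → ∣ X ω - μ ∣ * ∣ X ω - μ ∣) + s)
             (sym (trans (∑-*ʳ μ Ω _) (cong (_* μ) (trans (∑-*ˡ 2 Ω X) (cong (2 *_) (first-moment ds)))))) ⟩
      ∑ Ω (λ ω → ∣ X ω - μ ∣ * ∣ X ω - μ ∣) + (∑[ ω ∈ Ω ] 2 * X ω * μ)
        ≡⟨ sym (∑-+ Ω _ _) ⟩
      (∑[ ω ∈ Ω ] ∣ X ω - μ ∣ * ∣ X ω - μ ∣ + 2 * X ω * μ)
        ≡⟨ ∑-cong Ω (λ ω → ∣-∣-square (X ω) μ) ⟩
      (∑[ ω ∈ Ω ] X ω * X ω + μ * μ)
        ≡⟨ trans (∑-+ Ω _ _) (cong₂ _+_ (second-moment ds) (∑-const Ω (μ * μ))) ⟩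
      N * (μ * μ + σ) + N * (μ * μ)
        ≡⟨ collect N μ σ ⟩
      N * σ + 2 * (N * μ) * μ ∎)
      where
      open ≡-Reasoning
      Ω : List (List V)
      Ω = choices Ls
      N : ℕ
      N = length Ω
      X : List V → ℕ
      X = score χ is
      collect : ∀ N μ σ → N * (μ * μ + σ) + N * (μ * μ) ≡ N * σ + 2 * (N * μ) * μ
      collect = solve-∀

    far : ℕ → ℕ → ℕ → Bool
    far c μ x = 4 * c <ᵇ ∣ x - μ ∣

    -- Beyond 4 c the squared deviation is at least 16 c² + 1. Using the strict bound keeps the
    -- factor to be cancelled positive, also for c = 0.
    chebyshev : ∀ {is Ls μ σ} c → Draws is Ls μ σ → σ ≤ c * c →
      16 * (∑[ ω ∈ choices Ls ] ⟦ far c μ (score χ is ω) ⟧) ≤ length (choices Ls)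
    chebyshev {is} {Ls} {μ} {σ} c ds σ≤ = *-cancelʳ-≤ (16 * #far) N (suc (16 * (c * c))) (begin
      16 * #far * suc (16 * (c * c)) ≡⟨ *-assoc 16 #far _ ⟩
      16 * (#far * suc (16 * (c * c))) ≡⟨ cong (16 *_) (sym (∑-*ʳ _ Ω _)) ⟩
      16 * (∑[ ω ∈ Ω ] ⟦ far c μ (X ω) ⟧ * suc (16 * (c * c)))
                                           ≤⟨ *-monoʳ-≤ 16 (∑-mono Ω λ ω → pointwise (X ω)) ⟩
      16 * (∑[ ω ∈ Ω ] ∣ X ω - μ ∣ * ∣ X ω - μ ∣)
                                           ≡⟨ cong (16 *_) (variance ds) ⟩
      16 * (N * σ) ≤⟨ *-monoʳ-≤ 16 (*-monoʳ-≤ N σ≤) ⟩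
      16 * (N * (c * c)) ≡⟨ *-swap 16 N (c * c) ⟩
      N * (16 * (c * c)) ≤⟨ *-monoʳ-≤ N (n≤1+n _) ⟩
      N * suc (16 * (c * c)) ∎)
      where
      open ≤-Reasoning
      Ω : List (List V)
      Ω = choices Ls
      N #far : ℕ
      N = length Ω
      X : List V → ℕ
      X = score χ is
      #far = ∑[ ω ∈ Ω ] ⟦ far c μ (X ω) ⟧
      sixteen : ∀ c → 16 * (c * c) ≡ 4 * c * (4 * c)
      sixteen = solve-∀
      pointwise : ∀ x → ⟦ far c μ x ⟧ * suc (16 * (c * c)) ≤ ∣ x - μ ∣ * ∣ x - μ ∣
      pointwise x with far c μ x in eq
      ... | false = z≤n
      ... | true  = ≤-trans (≤-reflexive (+-identityʳ _))
            (subst (λ s → s < ∣ x - μ ∣ * ∣ x - μ ∣) (sym (sixteen c)) (*-mono-< lt lt))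
        where
        lt : 4 * c < ∣ x - μ ∣
        lt = <ᵇ⇒< (4 * c) _ (subst T (sym eq) tt)

  -- A vertex isolated in its piece must still have something to draw, or the sample space would be
  -- empty. Drawing itself is harmless: it lies on its own side of every cut.
  orSelf : V → List V → List V
  orSelf u []         = u ∷ []
  orSelf u xs@(_ ∷ _) = xs

  neighbours : (V → V → ℕ) → List V → V → List V
  neighbours H P u = orSelf u (filterᵇ (positive ∘ H u) P)

  agree : Bool → Bool → Bool
  agree a b = not (a xor b)

  smallSide : (V → Bool) → List V → Bool
  smallSide χ vs = length (inside χ vs) ≤ᵇ length (outside χ vs)

  -- Here c is the degree of u: weighting a crossing sample by it makes the mean 2 ^ t times the
  -- number of cut edges at u. Vertices of the larger side get weight zero, so every cut edge is
  -- counted once.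
  weightOf : (V → Bool) → Bool → ℕ → V → ℕ → ℕ
  weightOf χ side t u c = ⟦ agree (χ u) side ⟧ * 2 ^ t * c

  -- A piece of the plane t is stored as its vertices with their degrees.
  pieceItems : ℕ → (V → Bool) → ℕ × List (V × ℕ) → List (ℕ × V)
  pieceItems D χ (t , us) = concatMap (λ uc → replicate D (weightOf χ side t (proj₁ uc) (proj₂ uc) , proj₁ uc)) us
    where
    side : Bool
    side = smallSide χ (map proj₁ us)

  module _ (H : V → V → ℕ) (H≤1 : ∀ u v → H u v ≤ 1) (H-sym : ∀ u v → H u v ≡ H v u) where

    skeleton : List V → List (V × ℕ)
    skeleton P = map (λ u → u , length (neighbours H P u)) P

    pieceDraws : ℕ → List V → List (List V)
    pieceDraws D P = concatMap (λ u → replicate D (neighbours H P u)) P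

    orSelf-∑ : ∀ u xs f → f u ≡ 0 → ∑ (orSelf u xs) f ≡ ∑ xs f
    orSelf-∑ u []       f fu≡0 = trans (+-identityʳ (f u)) fu≡0
    orSelf-∑ u (x ∷ xs) f fu≡0 = refl

    orSelf-∑-≤ : ∀ u xs ys f → u ∈ ys → ∑ xs f ≤ ∑ ys f → ∑ (orSelf u xs) f ≤ ∑ ys f
    orSelf-∑-≤ u []       ys f u∈ le = ≤-trans (≤-reflexive (+-identityʳ (f u))) (∑-∈ f u∈)
    orSelf-∑-≤ u (x ∷ xs) ys f u∈ le = le

    xor-self : ∀ b → ⟦ b xor b ⟧ ≡ 0
    xor-self true  = refl
    xor-self false = refl

    module _ (χ : V → Bool) (P : List V) where

      out same : V → ℕ
      out  u = ∑[ a ∈ neighbours H P u ] ⟦ χ u xor χ a ⟧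
      same u = ∑[ a ∈ neighbours H P u ] ⟦ agree (χ u) (χ a) ⟧

      out+same : ∀ u → out u + same u ≡ length (neighbours H P u)
      out+same u = trans (sym (∑-+ L _ _)) (trans (∑-cong L λ a → ⟦⟧+⟦not⟧ (χ u xor χ a))
        (∑-1 L))
        where
        L : List V
        L = neighbours H P u

      out-degree : ∀ u → out u ≡ (∑[ v ∈ P ] H u v * ⟦ χ u xor χ v ⟧)
      out-degree u = trans (orSelf-∑ u (filterᵇ (positive ∘ H u) P) _ (xor-self (χ u)))
        (trans (∑-filterᵇ (positive ∘ H u) P _)
          (∑-cong P λ v → cong (_* ⟦ χ u xor χ v ⟧) (⟦positive⟧ (H≤1 u v))))

      -- The neighbours are selected from the entries of P, each at most once. If u stands in for a
      -- neighbour of itself, its membership in P makes up for it.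
      same-≤ : ∀ u → u ∈ P → same u ≤ (∑[ v ∈ P ] ⟦ agree (χ u) (χ v) ⟧)
      same-≤ u u∈ = orSelf-∑-≤ u (filterᵇ (positive ∘ H u) P) P (λ v → ⟦ agree (χ u) (χ v) ⟧) u∈
        (≤-trans (≤-reflexive (∑-filterᵇ (positive ∘ H u) P _))
          (∑-mono P λ v → ≤-trans (*-monoˡ-≤ ⟦ agree (χ u) (χ v) ⟧ (⟦⟧≤1 (positive (H u v)))) (≤-reflexive (+-identityʳ _))))

      -- With l = out + same, the value g l has probability out / l, so the second moment is g² l
      -- out = (g out)² + g² out same.
      draw-neighbour : ∀ side t u → let g = ⟦ agree (χ u) side ⟧ * 2 ^ t ; L = neighbours H P u in
        Draw χ (weightOf χ side t u (length L)) u L (g * out u) (g * g * (out u * same u))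
      draw-neighbour side t u = draw
        (trans (∑-*ˡ (g * l) L _) (mean g l (out u)))
        (begin
          (∑[ a ∈ L ] (g * l * x a) * (g * l * x a)) ≡⟨ ∑-cong L (λ a → idempotent (g * l) (χ u xor χ a)) ⟩
          (∑[ a ∈ L ] g * l * (g * l) * x a) ≡⟨ ∑-*ˡ (g * l * (g * l)) L _ ⟩
          g * l * (g * l) * out u ≡⟨ regroup g l (out u) ⟩
          l * (g * g * out u * l) ≡⟨ cong (λ d → l * (g * g * out u * d)) (sym (out+same u)) ⟩
          l * (g * g * out u * (out u + same u)) ≡⟨ cong (l *_) (expand g (out u) (same u)) ⟩
          l * (g * out u * (g * out u) + g * g * (out u * same u)) ∎)
        where
        open ≡-Reasoning
        g l : ℕ
        L : List V
        L = neighbours H P u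
        g = ⟦ agree (χ u) side ⟧ * 2 ^ t
        l = length L
        x : V → ℕ
        x a = ⟦ χ u xor χ a ⟧
        mean : ∀ g l o → g * l * o ≡ l * (g * o)
        mean = solve-∀
        idempotent : ∀ c b → (c * ⟦ b ⟧) * (c * ⟦ b ⟧) ≡ c * c * ⟦ b ⟧
        idempotent c true  = trans (cong₂ _*_ (*-identityʳ c) (*-identityʳ c)) (sym (*-identityʳ (c * c)))
        idempotent c false = trans (cong (_* (c * 0)) (*-zeroʳ c)) (sym (*-zeroʳ (c * c)))
        regroup : ∀ g l o → g * l * (g * l) * o ≡ l * (g * g * o * l)
        regroup = solve-∀
        expand : ∀ g o s → g * g * o * (o + s) ≡ g * o * (g * o) + g * g * (o * s)
        expand = solve-∀

      -- Every cut edge has exactly one endpoint on the chosen side. For the side `false` it is met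
      -- from the end opposite to the one in `cut`, which is where the symmetry of H enters.
      cut-side : ∀ side → (∑[ u ∈ P ] ⟦ agree (χ u) side ⟧ * out u) ≡ cut H χ P
      cut-side true = ∑-cong P λ u → trans (cong (⟦ agree (χ u) true ⟧ *_) (out-degree u))
        (trans (sym (∑-*ˡ ⟦ agree (χ u) true ⟧ P _)) (∑-cong P λ v → pointwise (χ u) (χ v) (H u v)))
        where
        pointwise : ∀ a b h → ⟦ agree a true ⟧ * (h * ⟦ a xor b ⟧) ≡ ⟦ a ∧ not b ⟧ * h
        pointwise true  b h = trans (+-identityʳ _) (*-comm h _)
        pointwise false b h = refl
      cut-side false = trans (∑-cong P λ u → trans (cong (⟦ agree (χ u) false ⟧ *_) (out-degree u))
        (trans (sym (∑-*ˡ ⟦ agree (χ u) false ⟧ P _)) (∑-cong P λ v →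
           trans (pointwise (χ u) (χ v) (H u v)) (cong (crosses χ v u *_) (H-sym u v)))))
        (∑-swap P P λ u v → crosses χ v u * H v u)
        where
        pointwise : ∀ a b h → ⟦ agree a false ⟧ * (h * ⟦ a xor b ⟧) ≡ ⟦ b ∧ not a ⟧ * h
        pointwise true  true  h = refl
        pointwise true  false h = refl
        pointwise false true  h = trans (+-identityʳ _) (*-comm h 1)
        pointwise false false h = trans (+-identityʳ _) (*-zeroʳ h)

      small-≤ : ∀ u → χ u ≡ smallSide χ P → (∑[ v ∈ P ] ⟦ agree (χ u) (χ v) ⟧) ≤ smaller χ P
      small-≤ u eq rewrite eq with length (inside χ P) ≤ᵇ length (outside χ P) in le
      ... | true  = ≤-reflexive (trans (trans (∑-cong P λ v → refl′ (χ v)) (sym (length-filterᵇ χ P)))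
            (sym (m≤n⇒m⊓n≡m (≤ᵇ⇒≤ (length (inside χ P)) _ (subst T (sym le) tt)))))
        where
        refl′ : ∀ b → ⟦ agree true b ⟧ ≡ ⟦ b ⟧
        refl′ true  = refl
        refl′ false = refl
      ... | false = ≤-reflexive (trans (sym (length-filterᵇ (not ∘ χ) P))
            (sym (m≥n⇒m⊓n≡n (<⇒≤ (≰⇒> λ h → subst T le (≤⇒≤ᵇ h))))))

      -- e_out e_in ≤ e_out k on a side of k vertices, and expansion makes D k at most the cut.
      piece-draws : ∀ D t → Expands D H P → ∃[ σ ]
        (Draws χ (pieceItems D χ (t , skeleton P)) (pieceDraws D P) (D * (2 ^ t * cut H χ P)) σ
         × σ ≤ (2 ^ t * cut H χ P) * (2 ^ t * cut H χ P))
      piece-draws D t expands = _ , ds , bound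
        where
        side : Bool
        side = smallSide χ P
        g : V → ℕ
        g u = ⟦ agree (χ u) side ⟧ * 2 ^ t
        vertices : map proj₁ (skeleton P) ≡ P
        vertices = trans (sym (map-∘ P)) (map-id P)
        items : pieceItems D χ (t , skeleton P) ≡
                concatMap (λ u → replicate D (weightOf χ side t u (length (neighbours H P u)) , u)) P
        items = trans (cong (λ vs → concatMap (λ uc → replicate D (weightOf χ (smallSide χ vs) t (proj₁ uc) (proj₂ uc) , proj₁ uc)) (skeleton P)) vertices)
          (cong concat (sym (map-∘ P)))
        μ : V → ℕ
        μ u = D * (g u * out u)
        σ : V → ℕ
        σ u = D * (g u * g u * (out u * same u))
        total : ∑ P μ ≡ D * (2 ^ t * cut H χ P)
        total = trans (∑-*ˡ D P _) (cong (D *_) (trans (∑-cong P λ u → regroup ⟦ agree (χ u) side ⟧ (2 ^ t) (out u))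
          (trans (∑-*ˡ (2 ^ t) P _) (cong (2 ^ t *_) (cut-side side)))))
          where
          regroup : ∀ a b c → a * b * c ≡ b * (a * c)
          regroup = solve-∀
        ds : Draws χ (pieceItems D χ (t , skeleton P)) (pieceDraws D P) (D * (2 ^ t * cut H χ P)) (∑ P σ)
        ds = subst₂ (λ is m → Draws χ is (pieceDraws D P) m (∑ P σ)) (sym items) total
          (concatMapᴰ χ _ _ μ σ P λ {u} _ → replicateᴰ χ D (draw-neighbour side t u))
        bound : ∑ P σ ≤ (2 ^ t * cut H χ P) * (2 ^ t * cut H χ P)
        bound = begin
          ∑ P σ
            ≤⟨ ∑-mono-∈ P pointwise ⟩
          (∑[ u ∈ P ] 2 ^ t * 2 ^ t * (D * smaller χ P) * (⟦ agree (χ u) side ⟧ * out u))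
            ≡⟨ trans (∑-*ˡ (2 ^ t * 2 ^ t * (D * smaller χ P)) P λ u → ⟦ agree (χ u) side ⟧ * out u) (cong (2 ^ t * 2 ^ t * (D * smaller χ P) *_) (cut-side side)) ⟩
          2 ^ t * 2 ^ t * (D * smaller χ P) * cut H χ P
            ≤⟨ *-monoˡ-≤ (cut H χ P) (*-monoʳ-≤ (2 ^ t * 2 ^ t) (expands χ)) ⟩
          2 ^ t * 2 ^ t * cut H χ P * cut H χ P
            ≡⟨ regroup (2 ^ t) (cut H χ P) ⟩
          (2 ^ t * cut H χ P) * (2 ^ t * cut H χ P) ∎
          where
          open ≤-Reasoning
          regroup : ∀ a c → a * a * c * c ≡ (a * c) * (a * c)
          regroup = solve-∀
          agree-true : ∀ a b → agree a b ≡ true → a ≡ b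
          agree-true true  true  _ = refl
          agree-true false false _ = refl
          active : ∀ a d o k → d * ((1 * a) * (1 * a) * (o * k)) ≡ a * a * (d * k) * (1 * o)
          active = solve-∀
          pointwise : ∀ u → u ∈ P → σ u ≤ 2 ^ t * 2 ^ t * (D * smaller χ P) * (⟦ agree (χ u) side ⟧ * out u)
          pointwise u u∈ with agree (χ u) side in eq
          ... | false = ≤-trans (≤-reflexive (*-zeroʳ D)) z≤n
          ... | true  = ≤-trans
                (*-monoʳ-≤ D (*-monoʳ-≤ (1 * 2 ^ t * (1 * 2 ^ t)) (*-monoʳ-≤ (out u)
                  (≤-trans (same-≤ u u∈) (small-≤ u (agree-true (χ u) side eq))))))
                (≤-reflexive (active (2 ^ t) D (out u) (smaller χ P)))

-- Self-delimiting bit encodings.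

module Encoding where
  open Prelude
  import Data.Fin.Properties as Fin
  open import Data.List.Properties using (++-assoc)
  open import Data.List.Relation.Unary.All as All using (All; []; _∷_)
  import Data.List.Relation.Unary.All.Properties as All
  open import Data.Nat.DivMod
  open Sums
  open Log

  -- Every digit takes two bits, the first of which tells it from the end of the number.
  digits : ℕ → ℕ → List Bool
  digits zero    x = false ∷ false ∷ []
  digits (suc k) x = true ∷ positive (x % 2) ∷ digits k (x / 2)

  encodeℕ : ℕ → List Bool
  encodeℕ x = digits (lg (suc x)) x

  encodeBits : List ℕ → List Bool
  encodeBits = concatMap encodeℕ

  -- The first component is the number whose remaining digits are being read, lowest first; the
  -- second holds the numbers after it.
  decodeBits′ : List Bool → ℕ × List ℕ
  decodeBits′ (true  ∷ b ∷ bs) = ⟦ b ⟧ + 2 * proj₁ (decodeBits′ bs) , proj₂ (decodeBits′ bs)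
  decodeBits′ (false ∷ _ ∷ bs) = 0 , proj₁ (decodeBits′ bs) ∷ proj₂ (decodeBits′ bs)
  decodeBits′ _                = 0 , []

  decodeBits : List Bool → List ℕ
  decodeBits bs = proj₁ (decodeBits′ bs) ∷ proj₂ (decodeBits′ bs)

  decode-digits : ∀ k x bs → x < 2 ^ k → decodeBits′ (digits k x ++ bs) ≡ (x , decodeBits bs)
  decode-digits zero    zero    bs _ = refl
  decode-digits zero    (suc x) bs (s≤s ())
  decode-digits (suc k) x bs x<
    rewrite decode-digits k (x / 2) bs (m<n*o⇒m/o<n {n = 2 ^ k} {o = 2} (subst (x <_) (*-comm 2 (2 ^ k)) x<))
    = cong (_, decodeBits bs) (trans (cong₂ _+_ (⟦positive⟧ (s≤s⁻¹ (m%n<n x 2))) (*-comm 2 (x / 2))) (sym (m≡m%n+[m/n]*n x 2)))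

  -- The exhausted input reads as one more number 0. Codecs take what they need from the front, so
  -- the surplus is harmless.
  decode-encode : ∀ ns → decodeBits (encodeBits ns) ≡ ns ++ 0 ∷ []
  decode-encode []       = refl
  decode-encode (x ∷ ns) rewrite decode-digits (lg (suc x)) x (encodeBits ns) (≤2^lg (suc x)) =
    cong (x ∷_) (decode-encode ns)

  length-digits : ∀ k x → length (digits k x) ≡ 2 * k + 2
  length-digits zero    x = refl
  length-digits (suc k) x = trans (cong (2 +_) (length-digits k (x / 2))) (cong (_+ 2) (sym (*-suc 2 k)))

  length-encodeBits : ∀ b ns → All (_< 2 ^ b) ns → length (encodeBits ns) ≤ length ns * (2 * b + 2)
  length-encodeBits b []       _          = z≤n
  length-encodeBits b (x ∷ ns) (x< ∷ ns<) = ≤-trans (≤-reflexive (length-++ (encodeℕ x)))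
    (+-mono-≤ (≤-trans (≤-reflexive (length-digits (lg (suc x)) x)) (+-monoˡ-≤ 2 (*-monoʳ-≤ 2 (lg-least {suc x} {b} x<))))
              (length-encodeBits b ns ns<))

  -- The decoder returns what it has not consumed, so that encodings can be concatenated without
  -- separators.
  record Codec (A : Set) : Set where
    field
      encode    : A → List ℕ
      decode    : List ℕ → A × List ℕ
      roundtrip : ∀ a ns → decode (encode a ++ ns) ≡ (a , ns)

  open Codec public

  ℕ-codec : Codec ℕ
  ℕ-codec = record
    { encode    = λ x → x ∷ []
    ; decode    = λ { [] → 0 , [] ; (x ∷ ns) → x , ns }
    ; roundtrip = λ _ _ → refl }

  -- Reduction modulo n makes the decoder total; on encodings it changes nothing.
  Fin-codec : ∀ n .{{_ : NonZero n}} → Codec (Fin n)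
  Fin-codec n = record
    { encode    = λ i → toℕ i ∷ []
    ; decode    = λ { [] → 0 mod n , [] ; (x ∷ ns) → x mod n , ns }
    ; roundtrip = λ i ns → cong (_, ns) (Fin.toℕ-injective
        (trans (Fin.toℕ-fromℕ< (m%n<n (toℕ i) n)) (m<n⇒m%n≡m (Fin.toℕ<n i)))) }

  infixr 4 _×-codec_

  _×-codec_ : ∀ {A B} → Codec A → Codec B → Codec (A × B)
  _×-codec_ {A} {B} C₁ C₂ = record { encode = enc ; decode = dec ; roundtrip = rt }
    where
    enc : A × B → List ℕ
    enc (a , b) = encode C₁ a ++ encode C₂ b
    dec : List ℕ → (A × B) × List ℕ
    dec ns = let a , ns₁ = decode C₁ ns ; b , ns₂ = decode C₂ ns₁ in (a , b) , ns₂
    rt : ∀ ab ns → dec (enc ab ++ ns) ≡ (ab , ns)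
    rt (a , b) ns rewrite ++-assoc (encode C₁ a) (encode C₂ b) ns
                        | roundtrip C₁ a (encode C₂ b ++ ns) | roundtrip C₂ b ns = refl

  List-codec : ∀ {A} → Codec A → Codec (List A)
  List-codec {A} C = record { encode = enc ; decode = dec ; roundtrip = rt }
    where
    enc : List A → List ℕ
    enc xs = length xs ∷ concatMap (encode C) xs
    times : ℕ → List ℕ → List A × List ℕ
    times zero    ns = [] , ns
    times (suc k) ns = let x , ns₁ = decode C ns ; xs , ns₂ = times k ns₁ in x ∷ xs , ns₂
    dec : List ℕ → List A × List ℕ
    dec []       = [] , []
    dec (k ∷ ns) = times k ns
    times-rt : ∀ xs ns → times (length xs) (concatMap (encode C) xs ++ ns) ≡ (xs , ns)
    times-rt []       ns = refl
    times-rt (x ∷ xs) ns rewrite ++-assoc (encode C x) (concatMap (encode C) xs) ns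
                               | roundtrip C x (concatMap (encode C) xs ++ ns) | times-rt xs ns = refl
    rt : ∀ xs ns → dec (enc xs ++ ns) ≡ (xs , ns)
    rt xs ns = times-rt xs ns

  toBits : ∀ {A} → Codec A → A → List Bool
  toBits C a = encodeBits (encode C a)

  fromBits : ∀ {A} → Codec A → List Bool → A
  fromBits C bs = proj₁ (decode C (decodeBits bs))

  fromBits-toBits : ∀ {A} (C : Codec A) a → fromBits C (toBits C a) ≡ a
  fromBits-toBits C a rewrite decode-encode (encode C a) | roundtrip C a (0 ∷ []) = refl

  module _ (P : ℕ → Set) {A : Set} (C : Codec A) where

    All-List-codec : ∀ {xs} → P (length xs) → All (λ x → All P (encode C x)) xs →
      All P (encode (List-codec C) xs)
    All-List-codec {xs} p ps = p ∷ All.concat⁺ (All.map⁺ ps)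

  length-List-codec : ∀ {A} (C : Codec A) xs →
    length (encode (List-codec C) xs) ≡ suc (∑[ x ∈ xs ] length (encode C x))
  length-List-codec C xs = cong suc (length-concatMap (encode C) xs)

-- The randomized sketch of a graph with integer weights.

module IntegerSketch {n : Prelude.ℕ} (D : Prelude.ℕ) where
  open Prelude
  open import Data.Bool.Base using () renaming (T to IsTrue)
  open Sums
  open ContractedGraph
  open BitPlanes
  open SparseCuts
  open Sampling
  open PieceEstimator

  private
    V : Set
    V = Fin n

  -- The last component of `Stored` has one flat list of sampled neighbours for each trial. The
  -- vertex to which a sample belongs is recovered from its position, by running through the pieces
  -- in the same order.
  StoredEdge StoredPiece Stored : Set
  StoredEdge  = ℕ × V × V
  StoredPiece = ℕ × List (V × ℕ)
  Stored      = List StoredEdge × List StoredPiece × List (List V)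

  edgeTotal : (V → Bool) → List StoredEdge → ℕ
  edgeTotal χ E = ∑[ e ∈ E ] 2 ^ proj₁ e * ⟦ χ (proj₁ (proj₂ e)) xor χ (proj₂ (proj₂ e)) ⟧

  -- D times the estimate of the cut.
  value : (V → Bool) → List StoredEdge → List StoredPiece → List V → ℕ
  value χ E sk ω = D * edgeTotal χ E + score χ (concatMap (pieceItems D χ) sk) ω

  estimateℕ : Stored → (V → Bool) → ℕ
  estimateℕ (E , sk , τ) χ = median (map (value χ E sk) τ)

  module Build (q : V → V → ℕ) (q-sym : ∀ u v → q u v ≡ q v u) (M p T k : ℕ) where

    w : V → V → ℕ
    w = contracted q q-sym M

    H : ℕ → V → V → ℕ
    H = plane w p

    H≤1 : ∀ t u v → H t u v ≤ 1
    H≤1 = plane≤1 w p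

    H-sym : ∀ t u v → H t u v ≡ H t v u
    H-sym = plane-sym w p (contracted-sym q q-sym M)

    abstract
      decomposition : ∀ t → Decomposition D (H t) (support (H t))
      decomposition t = decompose D (H t) (H≤1 t) (H-sym t) (length (support (H t))) (support (H t)) ≤-refl

    module Dec (t : ℕ) = Decomposition (decomposition t)

    storedEdges : List StoredEdge
    storedEdges = concatMap (λ t → map (t ,_) (Dec.edges t)) (upTo T)

    allPieces : List (ℕ × List V)
    allPieces = concatMap (λ t → map (t ,_) (Dec.pieces t)) (upTo T)

    stored : ℕ × List V → StoredPiece
    stored (t , P) = t , skeleton (H t) (H≤1 t) (H-sym t) P

    storedPieces : List StoredPiece
    storedPieces = map stored allPieces

    draws : ℕ × List V → List (List V)
    draws (t , P) = pieceDraws (H t) (H≤1 t) (H-sym t) D P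

    allDraws : List (List V)
    allDraws = concatMap draws allPieces

    Ω : List (List V)
    Ω = choices allDraws

    outcomes : List (List (List V))
    outcomes = choices (replicate k Ω)

    sketchOf : List (List V) → Stored
    sketchOf τ = storedEdges , storedPieces , τ

    allPieces-expand : ∀ {x} → x ∈ allPieces → Expands D (H (proj₁ x)) (proj₂ x)
    allPieces-expand x∈ with find (∈-concatMap⁻ (λ t → map (t ,_) (Dec.pieces t)) {xs = upTo T} x∈)
    ... | t , _ , x∈t with ∈-map⁻ (t ,_) x∈t
    ... | P , P∈ , refl = Dec.expands t P∈

    total : (V → Bool) → ℕ
    total χ = planes-cut w p T χ

    pieceTotal : (V → Bool) → ℕ
    pieceTotal χ = ∑[ x ∈ allPieces ] 2 ^ proj₁ x * cut (H (proj₁ x)) χ (proj₂ x)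

    total-split : ∀ χ → total χ ≡ edgeTotal χ storedEdges + pieceTotal χ
    total-split χ = begin
      (∑[ t ∈ upTo T ] 2 ^ t * cut (H t) χ (allFin n))
        ≡⟨ ∑-cong (upTo T) (λ t → trans (cong (2 ^ t *_) (trans (sym (cut-support (H t) (H-sym t) χ)) (Dec.cut-pieces t χ)))
             (trans (*-distribˡ-+ (2 ^ t) _ _) (cong₂ _+_ (sym (∑-*ˡ (2 ^ t) (Dec.pieces t) _)) (sym (∑-*ˡ (2 ^ t) (Dec.edges t) _))))) ⟩
      (∑[ t ∈ upTo T ] (∑[ P ∈ Dec.pieces t ] 2 ^ t * cut (H t) χ P)
                       + (∑[ e ∈ Dec.edges t ] 2 ^ t * ⟦ χ (proj₁ e) xor χ (proj₂ e) ⟧))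
        ≡⟨ trans (∑-+ (upTo T) _ _) (+-comm (∑[ t ∈ upTo T ] ∑[ P ∈ Dec.pieces t ] 2 ^ t * cut (H t) χ P) _) ⟩
      (∑[ t ∈ upTo T ] ∑[ e ∈ Dec.edges t ] 2 ^ t * ⟦ χ (proj₁ e) xor χ (proj₂ e) ⟧)
      + (∑[ t ∈ upTo T ] ∑[ P ∈ Dec.pieces t ] 2 ^ t * cut (H t) χ P)
        ≡⟨ sym (cong₂ _+_ (trans (∑-concatMap _ (upTo T) _) (∑-cong (upTo T) λ t → ∑-map (t ,_) (Dec.edges t) _))
                          (trans (∑-concatMap _ (upTo T) _) (∑-cong (upTo T) λ t → ∑-map (t ,_) (Dec.pieces t) _))) ⟩
      edgeTotal χ storedEdges + pieceTotal χ ∎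
      where open ≡-Reasoning

    module _ (χ : V → Bool) where

      -- All pieces of all planes are sampled independently in one trial, so means and variances
      -- add. The bound on the variance remains a sum of squares, one for each piece.
      all-draws : ∀ xs → (∀ {x} → x ∈ xs → Expands D (H (proj₁ x)) (proj₂ x)) → ∃[ σ ]
        (Draws χ (concatMap (pieceItems D χ) (map stored xs)) (concatMap draws xs)
               (D * (∑[ x ∈ xs ] 2 ^ proj₁ x * cut (H (proj₁ x)) χ (proj₂ x))) σ
         × σ ≤ (∑[ x ∈ xs ] (2 ^ proj₁ x * cut (H (proj₁ x)) χ (proj₂ x)) * (2 ^ proj₁ x * cut (H (proj₁ x)) χ (proj₂ x))))
      all-draws [] _ = 0 , subst (λ μ → Draws χ [] [] μ 0) (sym (*-zeroʳ D)) [] , z≤n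
      all-draws ((t , P) ∷ xs) ex =
        let σ₁ , ds₁ , b₁ = piece-draws (H t) (H≤1 t) (H-sym t) χ P D t (ex (here refl))
            σ₂ , ds₂ , b₂ = all-draws xs (ex ∘ there)
        in σ₁ + σ₂ ,
           subst (λ μ → Draws χ (pieceItems D χ (stored (t , P)) ++ concatMap (pieceItems D χ) (map stored xs))
                                (draws (t , P) ++ concatMap draws xs) μ (σ₁ + σ₂))
                 (sym (*-distribˡ-+ D (2 ^ t * cut (H t) χ P) (∑[ x ∈ xs ] 2 ^ proj₁ x * cut (H (proj₁ x)) χ (proj₂ x))))
                 (_++ᴰ_ χ ds₁ ds₂) ,
           +-mono-≤ b₁ b₂

      private
        bad : ℕ → Bool
        bad = far χ (total χ) (D * total χ)

        val : List V → ℕ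
        val = value χ storedEdges storedPieces

        -- The stored edges are exact: they shift the value and its mean equally, so only the
        -- sampled part deviates.
        bad-score : ∀ ω → bad (val ω) ≡ far χ (total χ) (D * pieceTotal χ) (score χ (concatMap (pieceItems D χ) storedPieces) ω)
        bad-score ω = cong (4 * total χ <ᵇ_) (trans
          (cong (λ m → ∣ val ω - m ∣) (trans (cong (D *_) (total-split χ)) (*-distribˡ-+ D (edgeTotal χ storedEdges) (pieceTotal χ))))
          (∣m+n-m+o∣≡∣n-o∣ (D * edgeTotal χ storedEdges) _ _))

      -- Chebyshev's inequality for the whole score: the sum of the squared cuts of the pieces is at
      -- most the square of their sum, hence of `total χ`. Pieces treated one by one would each fail
      -- with constant probability.
      trial-rare : 16 * (∑[ ω ∈ Ω ] ⟦ bad (val ω) ⟧) ≤ length Ω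
      trial-rare = let σ , ds , σ≤ = all-draws allPieces allPieces-expand in ≤-trans
        (≤-reflexive (cong (16 *_) (∑-cong Ω λ ω → cong ⟦_⟧ (bad-score ω))))
        (chebyshev χ (total χ) ds (≤-trans σ≤ (≤-trans (∑-square-≤ allPieces _) (*-mono-≤ piece≤ piece≤))))
        where
        piece≤ : pieceTotal χ ≤ total χ
        piece≤ = ≤-trans (m≤n+m _ _) (≤-reflexive (sym (total-split χ)))

      open Amplification Ω (bad ∘ val) trial-rare

      failed : List (List V) → Bool
      failed = mostlyBad k

      failed-rare : (∑[ τ ∈ outcomes ] ⟦ failed τ ⟧) * 2 ^ k ≤ length outcomes
      failed-rare = mostly-bad-rare k

      succeeded : ∀ {τ} → τ ∈ outcomes → failed τ ≡ false →
        D * total χ ≤ estimateℕ (sketchOf τ) χ + 4 * total χ ×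
        estimateℕ (sketchOf τ) χ ≤ D * total χ + 4 * total χ
      succeeded {τ} τ∈ ok =
        ≤-trans (m≤n+m∸n (D * total χ) (4 * total χ)) (≤-trans (+-monoʳ-≤ (4 * total χ)
          (median-≥ bad near (map val τ) few)) (≤-reflexive (+-comm (4 * total χ) _))) ,
        median-≤ bad near (map val τ) few
        where
        near : ∀ x → bad x ≡ false → D * total χ ∸ 4 * total χ ≤ x × x ≤ D * total χ + 4 * total χ
        near x e =
          m≤n+o⇒m∸n≤o (D * total χ) (4 * total χ) (≤-trans (m≤n+∣n-m∣ (D * total χ) x)
            (≤-trans (+-monoʳ-≤ x d≤) (≤-reflexive (+-comm x _)))) ,
          ≤-trans (m≤n+∣m-n∣ x (D * total χ)) (+-monoʳ-≤ (D * total χ) d≤)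
          where
          d≤ : ∣ x - D * total χ ∣ ≤ 4 * total χ
          d≤ = ≮⇒≥ λ lt → subst IsTrue e (<⇒<ᵇ lt)
        few : 2 * (∑[ x ∈ map val τ ] ⟦ bad x ⟧) < length (map val τ)
        few = subst₂ (λ b l → 2 * b < l) (sym (∑-map val τ _))
          (sym (trans (length-map val τ) (trans (length-∈-choices (replicate k Ω) τ∈) (length-replicate k))))
          (mostly-good k τ ok)

    -- Needed for a uniform distribution on `outcomes`; it rests on `orSelf` leaving no list of
    -- neighbours empty.
    outcomes-nonempty : 1 ≤ length outcomes
    outcomes-nonempty = choices-nonempty (replicate k Ω) λ L∈ → subst (λ L → 1 ≤ length L) (sym (∈-replicate k L∈))
      (choices-nonempty allDraws λ L∈ → nonempty L∈)
      where
      1≤orSelf : ∀ u xs → 1 ≤ length (orSelf {n} u xs)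
      1≤orSelf u []      = ≤-refl
      1≤orSelf u (_ ∷ _) = s≤s z≤n
      nonempty : ∀ {L} → L ∈ allDraws → 1 ≤ length L
      nonempty L∈ with find (∈-concatMap⁻ draws {xs = allPieces} L∈)
      ... | (t , P) , _ , L∈P with find (∈-concatMap⁻ (λ u → replicate D (neighbours (H t) P u)) {xs = P} L∈P)
      ... | u , _ , L∈u = subst (λ L → 1 ≤ length L) (sym (∈-replicate D L∈u)) (1≤orSelf u (filterᵇ (positive ∘ H t u) P))

-- Accuracy and size of the integer sketch.

module SketchBounds where
  open Prelude
  import Data.Fin.Properties as Fin
  open import Data.List.Membership.Propositional.Properties using (∈-upTo⁻)
  open import Data.List.Relation.Unary.All as All using (All; []; _∷_)
  import Data.List.Relation.Unary.All.Properties as All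
  open Sums
  open Log
  open ContractedGraph
  open BitPlanes
  open Sampling
  open PieceEstimator
  open Encoding
  open IntegerSketch

  ∈-choices : ∀ {A : Set} k {L : List A} {as a} → as ∈ choices (replicate k L) → a ∈ as → a ∈ L
  ∈-choices zero    (here refl) ()
  ∈-choices (suc k) {L} as∈ a∈ with find (∈-concatMap⁻ (λ a → map (a ∷_) (choices (replicate k L))) {xs = L} as∈)
  ... | b , b∈ , as∈b with ∈-map⁻ (b ∷_) as∈b
  ∈-choices (suc k) as∈ (here refl) | b , b∈ , as∈b | _ , _ , refl = b∈
  ∈-choices (suc k) as∈ (there a∈)  | b , b∈ , as∈b | _ , bs∈ , refl = ∈-choices k bs∈ a∈

  -- Multiplying by D / P turns the error e x into e D x / P ≤ x. Contraction and the dropping of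
  -- digits, with their own scales P, are both brought to the unit 1 / D in this way.
  relative-error : ∀ P D e a b x → 1 ≤ P → e * D ≤ P → P * a ≤ P * b + e * x → D * a ≤ D * b + x
  relative-error P D e a b x 1≤P eD≤P h = *-cancelˡ-≤ P {{>-nonZero 1≤P}} (begin
    P * (D * a) ≡⟨ *-swap P D a ⟩
    D * (P * a) ≤⟨ *-monoʳ-≤ D h ⟩
    D * (P * b + e * x) ≡⟨ regroup D P b e x ⟩
    P * (D * b) + e * D * x ≤⟨ +-monoʳ-≤ (P * (D * b)) (*-monoˡ-≤ x eD≤P) ⟩
    P * (D * b) + P * x ≡⟨ sym (*-distribˡ-+ P (D * b) x) ⟩
    P * (D * b + x) ∎)
    where
    open ≤-Reasoning
    regroup : ∀ d p b e x → d * (p * b + e * x) ≡ p * (d * b) + e * d * x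
    regroup = solve-∀

  -- Q is the given cut, h the contracted one, c the one in the bit planes and z the estimate.
  combine-errors : ∀ D {Q h c z} → 1 ≤ D → D * h ≤ D * Q + Q → D * Q ≤ D * h + Q → c ≤ h → D * h ≤ D * c + h →
    D * c ≤ z + 4 * c → z ≤ D * c + 4 * c → D * Q ≤ z + 11 * Q × z ≤ D * Q + 9 * Q
  combine-errors D {Q} {h} {c} {z} 1≤D h≤ Q≤ c≤h h≤c c≤z z≤c = lower , upper
    where
    open ≤-Reasoning
    h≤2Q : h ≤ 2 * Q
    h≤2Q = *-cancelˡ-≤ D {{>-nonZero 1≤D}} (begin
      D * h ≤⟨ h≤ ⟩
      D * Q + Q ≤⟨ +-monoʳ-≤ (D * Q) (≤-trans (≤-reflexive (sym (*-identityˡ Q))) (*-monoˡ-≤ Q 1≤D)) ⟩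
      D * Q + D * Q ≡⟨ regroup D Q ⟩
      D * (2 * Q) ∎)
      where
      regroup : ∀ d q → d * q + d * q ≡ d * (2 * q)
      regroup = solve-∀
    -- 11 = 8 + 2 + 1: sampling costs 4 c ≤ 8 Q, dropping digits costs h ≤ 2 Q and contraction costs
    -- Q. Dropping digits never increases a cut, which leaves 9 = 8 + 1 for `upper`.
    lower : D * Q ≤ z + 11 * Q
    lower = begin
      D * Q ≤⟨ Q≤ ⟩
      D * h + Q ≤⟨ +-monoˡ-≤ Q h≤c ⟩
      D * c + h + Q ≤⟨ +-monoˡ-≤ Q (+-mono-≤ (≤-trans c≤z (+-monoʳ-≤ z (*-monoʳ-≤ 4 (≤-trans c≤h h≤2Q)))) h≤2Q) ⟩
      z + 4 * (2 * Q) + 2 * Q + Q ≡⟨ regroup z Q ⟩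
      z + 11 * Q ∎
      where
      regroup : ∀ z q → z + 4 * (2 * q) + 2 * q + q ≡ z + 11 * q
      regroup = solve-∀
    upper : z ≤ D * Q + 9 * Q
    upper = begin
      z ≤⟨ z≤c ⟩
      D * c + 4 * c ≤⟨ +-mono-≤ (*-monoʳ-≤ D c≤h) (*-monoʳ-≤ 4 (≤-trans c≤h h≤2Q)) ⟩
      D * h + 4 * (2 * Q) ≤⟨ +-monoˡ-≤ (4 * (2 * Q)) h≤ ⟩
      D * Q + Q + 4 * (2 * Q) ≡⟨ regroup (D * Q) Q ⟩
      D * Q + 9 * Q ∎
      where
      regroup : ∀ z q → z + q + 4 * (2 * q) ≡ z + 9 * q
      regroup = solve-∀

  module _ {n : ℕ} .{{_ : NonZero n}} where

    stored-codec : ∀ D → Codec (Stored {n} D)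
    stored-codec D =
      List-codec (ℕ-codec ×-codec Fin-codec n ×-codec Fin-codec n) ×-codec
      List-codec (ℕ-codec ×-codec List-codec (Fin-codec n ×-codec ℕ-codec)) ×-codec
      List-codec (List-codec (Fin-codec n))

    module Bounds (D L R : ℕ) (1≤D : 1 ≤ D) (D≤ : D ≤ 2 ^ (L + 2)) (1≤L : 1 ≤ L) (n≤ : n ≤ 2 ^ L)
                  (q : Fin n → Fin n → ℕ) (q-sym : ∀ u v → q u v ≡ q v u) (q< : ∀ u v → q u v ≤ 2 ^ R) where

      -- M brings the contraction error n² / 2 ^ M to at most 1 / D, as n² D ≤ 2 ^ (2 L) * 2 ^ (L +
      -- 2), and p does so for the digit error 2 / 2 ^ p. Merged weights are at most n² * 2 ^ R,
      -- hence below 2 ^ T.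
      M p T : ℕ
      M = 3 * L + 2
      p = L + 3
      T = suc (2 * L + R)

      open Build {n} D q q-sym M p T L public

      nn≤ : n * n ≤ 2 ^ (2 * L)
      nn≤ = ≤-trans (*-mono-≤ n≤ n≤) (≤-reflexive (trans (sym (^-distribˡ-+-* 2 L L)) (cong (2 ^_) (sym (double L)))))

      w< : ∀ i j → w i j < 2 ^ T
      w< i j = begin-strict
        w i j ≤⟨ ∑²-mono (λ u v → term (does (source q q-sym M u v Fin.≟ i)) (does (target q q-sym M u v Fin.≟ j)) (q< u v)) ⟩
        ∑² {n} (λ _ _ → 2 ^ R) ≡⟨ trans (∑-cong (allFin n) λ _ → ∑-allFin-const n (2 ^ R)) (∑-allFin-const n (n * 2 ^ R)) ⟩
        n * (n * 2 ^ R) ≡⟨ sym (*-assoc n n (2 ^ R)) ⟩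
        n * n * 2 ^ R ≤⟨ *-monoˡ-≤ (2 ^ R) nn≤ ⟩
        2 ^ (2 * L) * 2 ^ R ≡⟨ sym (^-distribˡ-+-* 2 (2 * L) R) ⟩
        2 ^ (2 * L + R) <⟨ 2^-suc-< (2 * L + R) ⟩
        2 ^ T ∎
        where
        open ≤-Reasoning
        term : ∀ a b {x y} → x ≤ y → ⟦ a ⟧ * (⟦ b ⟧ * x) ≤ y
        term true  true  {x} le = ≤-trans (≤-reflexive (trans (+-identityʳ _) (+-identityʳ x))) le
        term true  false le = z≤n
        term false b     le = z≤n

      accuracy : ∀ χ {τ} → τ ∈ outcomes → failed χ τ ≡ false → let Q = cut q χ (allFin n) ; z = estimateℕ D (sketchOf τ) χ in
        D * Q ≤ z + 11 * Q × z ≤ D * Q + 9 * Q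
      accuracy χ {τ} τ∈ ok = combine-errors D 1≤D
        (relative-error (2 ^ M) D (n * n) h Q Q (2^-pos M) nnD≤ (≤-trans (cut-contracted-≤ q q-sym M χ) (≤-reflexive (assoc Q))))
        (relative-error (2 ^ M) D (n * n) Q h Q (2^-pos M) nnD≤ (≤-trans (cut-contracted-≥ q q-sym M χ) (≤-reflexive (assoc h))))
        (planes-cut-≤ w p T w< χ)
        (relative-error (2 ^ p) D 2 h (total χ) h (2^-pos p) 2D≤ (planes-cut-≥ w p T w< χ))
        (proj₁ (succeeded χ τ∈ ok)) (proj₂ (succeeded χ τ∈ ok))
        where
        Q h : ℕ
        Q = cut q χ (allFin n)
        h = cut w χ (allFin n)
        assoc : ∀ b → 2 ^ M * b + n * (n * Q) ≡ 2 ^ M * b + n * n * Q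
        assoc b = cong (2 ^ M * b +_) (sym (*-assoc n n Q))
        nnD≤ : n * n * D ≤ 2 ^ M
        nnD≤ = ≤-trans (*-mono-≤ nn≤ D≤) (≤-reflexive (trans (sym (^-distribˡ-+-* 2 (2 * L) (L + 2))) (cong (2 ^_) (exponent L))))
          where
          exponent : ∀ l → 2 * l + (l + 2) ≡ 3 * l + 2
          exponent = solve-∀
        2D≤ : 2 * D ≤ 2 ^ p
        2D≤ = ≤-trans (*-monoʳ-≤ 2 D≤) (≤-reflexive (cong (2 ^_) (sym (+-suc L 2))))

      private
        nₜ : ℕ → ℕ
        nₜ t = length (support (H t))

        -- N counts the touched vertices over all planes; `total-support` bounds it by 2 (6 L + 5) n
        -- ≤ 22 L n. Removed edges cost a further factor D L, and so do D samples for every vertex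
        -- in each of L trials; X is the common unit.
        N X : ℕ
        N = ∑ (upTo T) nₜ
        X = D * L * L * n

        1≤n : 1 ≤ n
        1≤n = >-nonZero⁻¹ n

        N≤ : N ≤ 22 * (L * n)
        N≤ = begin
          N ≤⟨ total-support q q-sym M p (2 * L) T nn≤ ⟩
          2 * ((p + M + 2 * L) * n) ≡⟨ collect L n ⟩
          12 * (L * n) + 1 * (10 * n) ≤⟨ +-monoʳ-≤ (12 * (L * n)) (*-monoˡ-≤ (10 * n) 1≤L) ⟩
          12 * (L * n) + L * (10 * n) ≡⟨ collect′ L n ⟩
          22 * (L * n) ∎
          where
          open ≤-Reasoning
          collect : ∀ l n → 2 * ((l + 3 + (3 * l + 2) + 2 * l) * n) ≡ 12 * (l * n) + 1 * (10 * n)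
          collect = solve-∀
          collect′ : ∀ l n → 12 * (l * n) + l * (10 * n) ≡ 22 * (l * n)
          collect′ = solve-∀

        LDN≤ : L * (D * N) ≤ 22 * X
        LDN≤ = ≤-trans (*-monoʳ-≤ L (*-monoʳ-≤ D N≤)) (≤-reflexive (collect D L n))
          where
          collect : ∀ d l n → l * (d * (22 * (l * n))) ≡ 22 * (d * l * l * n)
          collect = solve-∀

        m≤L*m : ∀ m → m ≤ L * m
        m≤L*m m = ≤-trans (≤-reflexive (sym (*-identityˡ m))) (*-monoˡ-≤ m 1≤L)

        m≤D*m : ∀ m → m ≤ D * m
        m≤D*m m = ≤-trans (≤-reflexive (sym (*-identityˡ m))) (*-monoˡ-≤ m 1≤D)

        DN≤ : D * N ≤ 22 * X
        DN≤ = ≤-trans (m≤L*m (D * N)) LDN≤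

        N≤X : N ≤ 22 * X
        N≤X = ≤-trans (m≤D*m N) DN≤

        L≤X : L ≤ X
        L≤X = ≤-trans (m≤L*m L) (≤-trans (m≤D*m (L * L)) (≤-trans (≤-reflexive (sym (trans (*-identityʳ (D * L * L)) (*-assoc D L L))))
                (*-monoʳ-≤ (D * L * L) 1≤n)))

        n≤X : n ≤ X
        n≤X = ≤-trans (m≤L*m n) (≤-trans (m≤L*m (L * n)) (≤-trans (m≤D*m (L * (L * n))) (≤-reflexive (collect D L n))))
          where
          collect : ∀ d l n → d * (l * (l * n)) ≡ d * l * l * n
          collect = solve-∀

        1≤X : 1 ≤ X
        1≤X = ≤-trans 1≤n n≤X

        X≤22X : X ≤ 22 * X
        X≤22X = m≤m+n X (21 * X)

        storedEdges≤ : length storedEdges ≤ 22 * X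
        storedEdges≤ = begin
          length storedEdges ≡⟨ length-concatMap (λ t → map (t ,_) (Dec.edges t)) (upTo T) ⟩
          (∑[ t ∈ upTo T ] length (map (t ,_) (Dec.edges t))) ≤⟨ ∑-mono (upTo T) bound ⟩
          (∑[ t ∈ upTo T ] L * (D * nₜ t)) ≡⟨ trans (∑-*ˡ L (upTo T) _) (cong (L *_) (∑-*ˡ D (upTo T) nₜ)) ⟩
          L * (D * N) ≤⟨ LDN≤ ⟩
          22 * X ∎
          where
          open ≤-Reasoning
          bound : ∀ t → length (map (t ,_) (Dec.edges t)) ≤ L * (D * nₜ t)
          bound t = begin
            length (map (t ,_) (Dec.edges t)) ≡⟨ length-map (t ,_) (Dec.edges t) ⟩
            length (Dec.edges t) ≤⟨ Dec.edges-size t ⟩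
            D * (nₜ t * lg (nₜ t)) ≤⟨ *-monoʳ-≤ D (*-monoʳ-≤ (nₜ t) (lg-least (≤-trans (support-≤ (H t)) n≤))) ⟩
            D * (nₜ t * L) ≡⟨ trans (sym (*-assoc D (nₜ t) L)) (*-comm (D * nₜ t) L) ⟩
            L * (D * nₜ t) ∎

        pieces≤ : length allPieces ≤ N
        pieces≤ = ≤-trans (≤-reflexive (length-concatMap (λ t → map (t ,_) (Dec.pieces t)) (upTo T))) (∑-mono (upTo T) λ t →
          ≤-trans (≤-reflexive (length-map (t ,_) (Dec.pieces t))) (Dec.#pieces t))

        vertices≤ : (∑[ x ∈ allPieces ] length (proj₂ x)) ≤ N
        vertices≤ = ≤-trans (≤-reflexive (∑-concatMap (λ t → map (t ,_) (Dec.pieces t)) (upTo T) (length ∘ proj₂))) (∑-mono (upTo T) λ t →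
          ≤-trans (≤-reflexive (∑-map (t ,_) (Dec.pieces t) _)) (Dec.pieces-size t))

        draws≤ : length allDraws ≤ D * N
        draws≤ = begin
          length allDraws ≡⟨ length-concatMap draws allPieces ⟩
          (∑[ x ∈ allPieces ] length (draws x)) ≡⟨ ∑-cong allPieces (λ x → trans (length-concatMap (λ u → replicate D (neighbours (H (proj₁ x)) (proj₂ x) u)) (proj₂ x))
                                                                (trans (∑-cong (proj₂ x) λ u → length-replicate D) (trans (∑-const (proj₂ x) D) (*-comm _ D)))) ⟩
          (∑[ x ∈ allPieces ] D * length (proj₂ x)) ≡⟨ ∑-*ˡ D allPieces _ ⟩
          D * (∑[ x ∈ allPieces ] length (proj₂ x)) ≤⟨ *-monoʳ-≤ D vertices≤ ⟩
          D * N ∎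
          where open ≤-Reasoning

        trial-length : ∀ {τ ω} → τ ∈ outcomes → ω ∈ τ → length ω ≤ D * N
        trial-length τ∈ ω∈ = ≤-trans (≤-reflexive (length-∈-choices allDraws (∈-choices L τ∈ ω∈))) draws≤

        outcome-length : ∀ {τ} → τ ∈ outcomes → length τ ≡ L
        outcome-length τ∈ = trans (length-∈-choices (replicate L Ω) τ∈) (length-replicate L)

        piece-bounds : ∀ {x} → x ∈ allPieces → proj₁ x < T × length (proj₂ x) ≤ n
        piece-bounds x∈ with find (∈-concatMap⁻ (λ t → map (t ,_) (Dec.pieces t)) {xs = upTo T} x∈)
        ... | t , t∈ , x∈t with ∈-map⁻ (t ,_) x∈t
        ... | P , P∈ , refl = ∈-upTo⁻ t∈ , ≤-trans (∑-∈ length P∈) (≤-trans (Dec.pieces-size t) (support-≤ (H t)))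

        edge-bounds : ∀ {e} → e ∈ storedEdges → proj₁ e < T
        edge-bounds e∈ with find (∈-concatMap⁻ (λ t → map (t ,_) (Dec.edges t)) {xs = upTo T} e∈)
        ... | t , t∈ , e∈t with ∈-map⁻ (t ,_) e∈t
        ... | _ , _ , refl = ∈-upTo⁻ t∈

        degree≤ : ∀ t P u → u ∈ P → length (neighbours (H t) P u) ≤ length P
        degree≤ t P u u∈ = ≤-trans (≤-reflexive (sym (∑-1 (neighbours (H t) P u)))) (≤-trans
          (orSelf-∑-≤ (H t) (H≤1 t) (H-sym t) u (filterᵇ (positive ∘ H t u) P) P (λ _ → 1) u∈
            (≤-trans (≤-reflexive (∑-filterᵇ (positive ∘ H t u) P (λ _ → 1)))
              (∑-mono P λ v → ≤-trans (≤-reflexive (*-identityʳ _)) (⟦⟧≤1 (positive (H t u v))))))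
          (≤-reflexive (∑-1 P)))

      -- Three numbers for an edge, two for a piece, two for each of its vertices and one for a
      -- sample: 66 X + 88 X + 23 X, where the last term includes the lengths of the L trials. The
      -- lengths of the three outer lists are absorbed by 1 ≤ X.
      encoded-length : ∀ {τ} → τ ∈ outcomes → length (encode (stored-codec D) (sketchOf τ)) ≤ 180 * X
      encoded-length {τ} τ∈ = begin
        length (encode (stored-codec D) (sketchOf τ))
          ≡⟨ trans (length-++ (encode edge-codec storedEdges)) (cong (length (encode edge-codec storedEdges) +_) (length-++ (encode piece-codec storedPieces))) ⟩
        length (encode edge-codec storedEdges) + (length (encode piece-codec storedPieces) + length (encode choice-codec τ))
          ≤⟨ +-mono-≤ edges (+-mono-≤ pieces choice) ⟩
        suc (22 * X * 3) + (suc (22 * X * 4) + suc (X + 22 * X))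
          ≡⟨ collect X ⟩
        3 * 1 + 177 * X
          ≤⟨ +-monoˡ-≤ (177 * X) (*-monoʳ-≤ 3 1≤X) ⟩
        3 * X + 177 * X
          ≡⟨ sym (*-distribʳ-+ X 3 177) ⟩
        180 * X ∎
        where
        open ≤-Reasoning
        edge-codec = List-codec (ℕ-codec ×-codec Fin-codec n ×-codec Fin-codec n)
        piece-codec = List-codec (ℕ-codec ×-codec List-codec (Fin-codec n ×-codec ℕ-codec))
        choice-codec = List-codec (List-codec (Fin-codec n))
        collect : ∀ x → suc (22 * x * 3) + (suc (22 * x * 4) + suc (x + 22 * x)) ≡ 3 * 1 + 177 * x
        collect = solve-∀
        edges : length (encode edge-codec storedEdges) ≤ suc (22 * X * 3)
        edges = ≤-trans (≤-reflexive (trans (length-List-codec (ℕ-codec ×-codec Fin-codec n ×-codec Fin-codec n) storedEdges)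
            (cong suc (∑-const storedEdges 3))))
          (s≤s (*-monoˡ-≤ 3 storedEdges≤))
        pieces : length (encode piece-codec storedPieces) ≤ suc (22 * X * 4)
        pieces = ≤-trans (≤-reflexive (trans (length-List-codec (ℕ-codec ×-codec List-codec (Fin-codec n ×-codec ℕ-codec)) storedPieces)
            (cong suc (trans (∑-map stored allPieces _) (∑-cong allPieces λ x → cong suc (piece x))))))
          (s≤s (begin
            (∑[ x ∈ allPieces ] 2 + length (proj₂ x) * 2)
              ≡⟨ trans (∑-+ allPieces _ _) (cong₂ _+_ (∑-const allPieces 2) (∑-*ʳ 2 allPieces _)) ⟩
            length allPieces * 2 + (∑[ x ∈ allPieces ] length (proj₂ x)) * 2
              ≤⟨ +-mono-≤ (*-monoˡ-≤ 2 (≤-trans pieces≤ N≤X)) (*-monoˡ-≤ 2 (≤-trans vertices≤ N≤X)) ⟩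
            22 * X * 2 + 22 * X * 2
              ≡⟨ sym (*-distribˡ-+ (22 * X) 2 2) ⟩
            22 * X * 4 ∎))
          where
          piece : ∀ x → length (encode (List-codec (Fin-codec n ×-codec ℕ-codec)) (proj₂ (stored x))) ≡ suc (length (proj₂ x) * 2)
          piece x = trans (length-List-codec (Fin-codec n ×-codec ℕ-codec) (proj₂ (stored x)))
            (cong suc (trans (∑-const (proj₂ (stored x)) 2) (cong (_* 2) (length-map _ (proj₂ x)))))
        choice : length (encode choice-codec τ) ≤ suc (X + 22 * X)
        choice = ≤-trans (≤-reflexive (length-List-codec (List-codec (Fin-codec n)) τ)) (s≤s (begin
          (∑[ ω ∈ τ ] length (encode (List-codec (Fin-codec n)) ω))
            ≤⟨ ∑-mono-∈ τ (λ ω ω∈ → ≤-trans (≤-reflexive (trans (length-List-codec (Fin-codec n) ω)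
                 (cong suc (∑-1 ω)))) (s≤s (trial-length τ∈ ω∈))) ⟩
          (∑[ ω ∈ τ ] suc (D * N))
            ≡⟨ trans (∑-const τ _) (cong (_* suc (D * N)) (outcome-length τ∈)) ⟩
          L * suc (D * N)
            ≡⟨ *-suc L (D * N) ⟩
          L + L * (D * N)
            ≤⟨ +-mono-≤ L≤X LDN≤ ⟩
          X + 22 * X ∎))

      -- Counts, vertices and degrees are at most 22 X, whatever the weights. Only the scales depend
      -- on the weights, through T, which is of the order of log W; so W contributes log log W bits
      -- to a number.
      encoded-entries : ∀ b {τ} → T ≤ 2 ^ b → 22 * X < 2 ^ b → τ ∈ outcomes →
        All (_< 2 ^ b) (encode (stored-codec D) (sketchOf τ))
      encoded-entries b {τ} T≤ X< τ∈ = All.++⁺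
        (All-List-codec (_< 2 ^ b) (ℕ-codec ×-codec Fin-codec n ×-codec Fin-codec n) (fits storedEdges≤)
          (All.tabulate λ e∈ → <-≤-trans (edge-bounds e∈) T≤ ∷ vertex _ ∷ vertex _ ∷ []))
        (All.++⁺
          (All-List-codec (_< 2 ^ b) (ℕ-codec ×-codec List-codec (Fin-codec n ×-codec ℕ-codec))
            (fits (≤-trans (≤-reflexive (length-map stored allPieces)) (≤-trans pieces≤ N≤X)))
            (All.map⁺ (All.tabulate λ {x} x∈ → <-≤-trans (proj₁ (piece-bounds x∈)) T≤ ∷
              All-List-codec (_< 2 ^ b) (Fin-codec n ×-codec ℕ-codec)
                (fits (≤-trans (≤-reflexive (length-map _ (proj₂ x))) (≤-trans (proj₂ (piece-bounds x∈)) n≤22X)))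
                (All.map⁺ (All.tabulate λ {u} u∈ → vertex u ∷
                  fits (≤-trans (degree≤ (proj₁ x) (proj₂ x) u u∈) (≤-trans (proj₂ (piece-bounds x∈)) n≤22X)) ∷ [])))))
          (All-List-codec (_< 2 ^ b) (List-codec (Fin-codec n)) (fits (≤-trans (≤-reflexive (outcome-length τ∈)) (≤-trans L≤X X≤22X)))
            (All.tabulate λ {ω} ω∈ → All-List-codec (_< 2 ^ b) (Fin-codec n) {ω} (fits (≤-trans (trial-length τ∈ ω∈) DN≤))
              (All.tabulate λ {u} _ → vertex u ∷ []))))
        where
        fits : ∀ {x} → x ≤ 22 * X → x < 2 ^ b
        fits x≤ = ≤-<-trans x≤ X<
        n≤22X : n ≤ 22 * X
        n≤22X = ≤-trans n≤X X≤22X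
        vertex : ∀ (u : Fin n) → toℕ u < 2 ^ b
        vertex u = fits (≤-trans (<⇒≤ (Fin.toℕ<n u)) n≤22X)

      22X< : 22 * X < 2 ^ (4 * L + 7)
      22X< = begin-strict
        22 * X <⟨ *-monoˡ-< X {{>-nonZero 1≤X}} {22} {32} (m≤m+n 23 9) ⟩
        32 * X ≤⟨ *-monoʳ-≤ 32 (*-mono-≤ (*-mono-≤ (*-mono-≤ D≤ L≤2^L) L≤2^L) n≤) ⟩
        32 * (2 ^ (L + 2) * 2 ^ L * 2 ^ L * 2 ^ L) ≡⟨ cong (λ x → 32 * (x * 2 ^ L * 2 ^ L * 2 ^ L)) (^-distribˡ-+-* 2 L 2) ⟩
        32 * (2 ^ L * 4 * 2 ^ L * 2 ^ L * 2 ^ L) ≡⟨ collect (2 ^ L) ⟩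
        (2 ^ L * 2 ^ L) * (2 ^ L * 2 ^ L) * 128 ≡⟨ cong (_* 128) (trans (cong₂ _*_ (sym (^-distribˡ-+-* 2 L L)) (sym (^-distribˡ-+-* 2 L L))) (sym (^-distribˡ-+-* 2 (L + L) (L + L)))) ⟩
        2 ^ (L + L + (L + L)) * 2 ^ 7 ≡⟨ sym (^-distribˡ-+-* 2 (L + L + (L + L)) 7) ⟩
        2 ^ (L + L + (L + L) + 7) ≡⟨ cong (λ k → 2 ^ (k + 7)) (four L) ⟩
        2 ^ (4 * L + 7) ∎
        where
        open ≤-Reasoning
        L≤2^L : L ≤ 2 ^ L
        L≤2^L = <⇒≤ (n<2^n L)
        collect : ∀ x → 32 * (x * 4 * x * x * x) ≡ (x * x) * (x * x) * 128
        collect = solve-∀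
        four : ∀ l → l + l + (l + l) ≡ 4 * l
        four = solve-∀

-- Rational arithmetic: rounding and propagation of errors.

module Rationals where
  open import Data.Fin.Base using (Fin; zero; suc)
  open import Data.Integer.Base as ℤ using (+_; -[1+_])
  import Data.Integer.Properties as ℤ
  open import Data.Nat.Base as ℕ using (ℕ; zero; suc)
  import Data.Nat.DivMod as ℕ
  import Data.Nat.Properties as ℕ
  open import Data.Product.Base using (_×_; _,_)
  open import Data.Rational.Base
  open import Data.Rational.Properties
  open import Data.Rational.Solver using (module +-*-Solver)
  import Data.Rational.Unnormalised.Base as ℚᵘ
  import Data.Rational.Unnormalised.Properties as ℚᵘ
  open import Data.Sum.Base using (inj₁; inj₂)
  open import Relation.Binary.PropositionalEquality
  open +-*-Solver

  ι : ℕ → ℚ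
  ι k = + k / 1

  private
    ιᵘ : ℕ → ℚᵘ.ℚᵘ
    ιᵘ k = ℚᵘ.mkℚᵘ (+ k) 0

    toℚᵘ-ι : ∀ k → toℚᵘ (ι k) ℚᵘ.≃ ιᵘ k
    toℚᵘ-ι k = toℚᵘ-fromℚᵘ (ιᵘ k)

  ι-+ : ∀ a b → ι (a ℕ.+ b) ≡ ι a + ι b
  ι-+ a b = toℚᵘ-injective (ℚᵘ.≃-trans (toℚᵘ-ι (a ℕ.+ b)) (ℚᵘ.≃-trans
    (ℚᵘ.*≡* (cong (ℤ._* + 1) (cong₂ ℤ._+_ (sym (ℤ.*-identityʳ (+ a))) (sym (ℤ.*-identityʳ (+ b))))))
    (ℚᵘ.≃-sym (ℚᵘ.≃-trans (toℚᵘ-homo-+ (ι a) (ι b)) (ℚᵘ.+-cong (toℚᵘ-ι a) (toℚᵘ-ι b))))))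

  ι-* : ∀ a b → ι (a ℕ.* b) ≡ ι a * ι b
  ι-* a b = toℚᵘ-injective (ℚᵘ.≃-trans (toℚᵘ-ι (a ℕ.* b)) (ℚᵘ.≃-trans
    (ℚᵘ.*≡* (cong (ℤ._* + 1) (ℤ.pos-* a b)))
    (ℚᵘ.≃-sym (ℚᵘ.≃-trans (toℚᵘ-homo-* (ι a) (ι b)) (ℚᵘ.*-cong (toℚᵘ-ι a) (toℚᵘ-ι b))))))

  ι-mono : ∀ {a b} → a ℕ.≤ b → ι a ≤ ι b
  ι-mono {a} {b} a≤b = toℚᵘ-cancel-≤ (ℚᵘ.≤-respˡ-≃ (ℚᵘ.≃-sym (toℚᵘ-ι a)) (ℚᵘ.≤-respʳ-≃ (ℚᵘ.≃-sym (toℚᵘ-ι b))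
    (ℚᵘ.*≤* (ℤ.*-monoʳ-≤-nonNeg (+ 1) (ℤ.+≤+ a≤b)))))

  ι-cancel : ∀ {a b} → ι a ≤ ι b → a ℕ.≤ b
  ι-cancel {a} {b} le with ℚᵘ.≤-respˡ-≃ (toℚᵘ-ι a) (ℚᵘ.≤-respʳ-≃ (toℚᵘ-ι b) (toℚᵘ-mono-≤ le))
  ... | ℚᵘ.*≤* h = ℤ.drop‿+≤+ (subst₂ ℤ._≤_ (ℤ.*-identityʳ (+ a)) (ℤ.*-identityʳ (+ b)) h)

  0≤ι : ∀ k → 0ℚ ≤ ι k
  0≤ι k = ι-mono {0} {k} ℕ.z≤n

  n*1/n : ∀ n .{{_ : ℕ.NonZero n}} → ι n * (+ 1 / n) ≡ 1ℚ
  n*1/n (suc n) = toℚᵘ-injective (ℚᵘ.≃-trans (toℚᵘ-homo-* (ι (suc n)) (+ 1 / suc n))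
    (ℚᵘ.≃-trans (ℚᵘ.*-cong (toℚᵘ-ι (suc n)) (toℚᵘ-fromℚᵘ (ℚᵘ.mkℚᵘ (+ 1) n)))
      (ℚᵘ.*≡* (cong +_ (trans (ℕ.*-identityʳ _) (trans (ℕ.*-identityʳ _) (sym (trans (ℕ.*-identityˡ _) (ℕ.*-identityˡ _)))))))))

  floorℕ : ℚ → ℕ
  floorℕ (mkℚ (+ m)    d _) = m ℕ./ suc d
  floorℕ (mkℚ -[1+ _ ] d _) = 0

  floorℕ-≤ : ∀ r → 0ℚ ≤ r → ι (floorℕ r) ≤ r
  floorℕ-≤ r@(mkℚ (+ m) d _) _ = toℚᵘ-cancel-≤ (ℚᵘ.≤-respˡ-≃ (ℚᵘ.≃-sym (toℚᵘ-ι (m ℕ./ suc d)))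
    (ℚᵘ.*≤* (subst₂ ℤ._≤_ (ℤ.pos-* (m ℕ./ suc d) (suc d)) (sym (ℤ.*-identityʳ (+ m))) (ℤ.+≤+ (ℕ.m/n*n≤m m (suc d))))))
  floorℕ-≤ (mkℚ -[1+ _ ] d _) (*≤* ())

  <floorℕ+1 : ∀ r → 0ℚ ≤ r → r ≤ ι (suc (floorℕ r))
  <floorℕ+1 r@(mkℚ (+ m) d _) _ = toℚᵘ-cancel-≤ (ℚᵘ.≤-respʳ-≃ (ℚᵘ.≃-sym (toℚᵘ-ι (suc (m ℕ./ suc d))))
    (ℚᵘ.*≤* (subst₂ ℤ._≤_ (sym (ℤ.*-identityʳ (+ m))) (ℤ.pos-* (suc (m ℕ./ suc d)) (suc d)) (ℤ.+≤+
      (ℕ.≤-trans (ℕ.≤-reflexive (ℕ.m≡m%n+[m/n]*n m (suc d))) (ℕ.+-monoˡ-≤ (m ℕ./ suc d ℕ.* suc d) (ℕ.<⇒≤ (ℕ.m%n<n m (suc d)))))))))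
  <floorℕ+1 (mkℚ -[1+ _ ] d _) (*≤* ())

  -- Linear arithmetic in one move: the hypotheses are added up to a ≤ b, and what remains is a ring
  -- identity.
  shift : ∀ {a b c d} → a ≤ b → c + b ≡ d + a → c ≤ d
  shift {a} {b} {c} {d} a≤b eq = ≤-trans
    (≤-reflexive (trans (sym (cancel c b)) (trans (cong (_- b) eq) (cancel′ d a b))))
    (≤-trans (+-monoʳ-≤ d (≤-trans (+-monoˡ-≤ (- b) a≤b) (≤-reflexive (+-inverseʳ b)))) (≤-reflexive (+-identityʳ d)))
    where
    cancel : ∀ c b → c + b - b ≡ c
    cancel = solve 2 (λ c b → c :+ b :- b := c) refl
    cancel′ : ∀ d a b → d + a - b ≡ d + (a - b)
    cancel′ = solve 3 (λ d a b → d :+ a :- b := d :+ (a :- b)) refl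

  *-monoˡ : ∀ {a x y} → 0ℚ ≤ a → x ≤ y → a * x ≤ a * y
  *-monoˡ {a} 0≤a x≤y = *-monoˡ-≤-nonNeg a {{nonNegative 0≤a}} x≤y

  *-monoʳ : ∀ {a x y} → 0ℚ ≤ a → x ≤ y → x * a ≤ y * a
  *-monoʳ {a} 0≤a x≤y = *-monoʳ-≤-nonNeg a {{nonNegative 0≤a}} x≤y

  *-nonneg : ∀ {a b} → 0ℚ ≤ a → 0ℚ ≤ b → 0ℚ ≤ a * b
  *-nonneg {a} 0≤a 0≤b = ≤-trans (≤-reflexive (sym (*-zeroʳ a))) (*-monoˡ 0≤a 0≤b)

  inverse-nonneg : ∀ {a c} → 0ℚ ≤ a → a * c ≡ 1ℚ → 0ℚ ≤ c
  inverse-nonneg {a} {c} 0≤a ac≡1 with ≤-total 0ℚ c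
  ... | inj₁ 0≤c = 0≤c
  ... | inj₂ c≤0 with ≤-trans (≤-reflexive (sym ac≡1)) (≤-trans (*-monoˡ 0≤a c≤0) (≤-reflexive (*-zeroʳ a)))
  ... | *≤* (ℤ.+≤+ ())

  ∑ℚ : ∀ {n} → (Fin n → ℚ) → ℚ
  ∑ℚ {zero}  f = 0ℚ
  ∑ℚ {suc n} f = f zero + ∑ℚ (λ i → f (suc i))

  ∑ℚ-mono : ∀ {n} {f g : Fin n → ℚ} → (∀ i → f i ≤ g i) → ∑ℚ f ≤ ∑ℚ g
  ∑ℚ-mono {zero}  h = ≤-refl
  ∑ℚ-mono {suc n} h = +-mono-≤ (h zero) (∑ℚ-mono λ i → h (suc i))

  ∑ℚ-cong : ∀ {n} {f g : Fin n → ℚ} → (∀ i → f i ≡ g i) → ∑ℚ f ≡ ∑ℚ g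
  ∑ℚ-cong {zero}  h = refl
  ∑ℚ-cong {suc n} h = cong₂ _+_ (h zero) (∑ℚ-cong λ i → h (suc i))

  ∑ℚ-*ˡ : ∀ {n} c (f : Fin n → ℚ) → ∑ℚ (λ i → c * f i) ≡ c * ∑ℚ f
  ∑ℚ-*ˡ {zero}  c f = sym (*-zeroʳ c)
  ∑ℚ-*ˡ {suc n} c f = trans (cong (λ t → c * f zero + t) (∑ℚ-*ˡ c λ i → f (suc i))) (sym (*-distribˡ-+ c (f zero) _))

  ∑ℚ-const : ∀ n c → ∑ℚ {n} (λ _ → c) ≡ ι n * c
  ∑ℚ-const zero    c = sym (*-zeroˡ c)
  ∑ℚ-const (suc n) c = trans (cong (λ t → c + t) (∑ℚ-const n c)) (trans
    (solve 2 (λ c x → c :+ x :* c := (con 1ℚ :+ x) :* c) refl c (ι n)) (cong (_* c) (sym (ι-+ 1 n))))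

  module _ {P c : ℚ} (0≤P : 0ℚ ≤ P) (Pc≡1 : P * c ≡ 1ℚ) where

    scale : ∀ {a x} → a ≤ x + c → P * a ≤ P * x + 1ℚ
    scale {a} {x} h = ≤-trans (*-monoˡ 0≤P h) (≤-reflexive (trans (*-distribˡ-+ P x c) (cong (λ t → P * x + t) Pc≡1)))

    -- a, b are late approximations to the weight of an edge in either direction, x, y are the
    -- ones that were rounded to u / P, v / P.
    edge-error : ∀ {a b x y u v D} → a ≤ x + c → x ≤ a + c → b ≤ y + c → y ≤ b + c → a ≤ b + c → b ≤ a + c →
      u ≤ P * x → P * x ≤ u + 1ℚ → v ≤ P * y → P * y ≤ v + 1ℚ → 0ℚ ≤ D → ι 8 * D ≤ P → 1ℚ ≤ ι 2 * a →
      D * (u + v) ≤ (D + 1ℚ) * (ι 2 * P * a) × (D - 1ℚ) * (ι 2 * P * a) ≤ D * (u + v)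
    edge-error {a} {b} {x} {y} {u} {v} {D} ax xa by yb ab ba ux xu vy yv 0≤D 8D≤P 1≤2a =
      shift (+-mono-≤ (*-monoˡ 0≤D upper) 5D≤)
        (solve 5 (λ D u v P a →
           D :* (u :+ v) :+ (D :* (con (ι 2) :* P :* a :+ con (ι 5)) :+ con (ι 2) :* P :* a)
           := (D :+ con 1ℚ) :* (con (ι 2) :* P :* a) :+ (D :* (u :+ v) :+ con (ι 5) :* D)) refl D u v P a) ,
      shift (+-mono-≤ (*-monoˡ 0≤D lower) 5D≤)
        (solve 5 (λ D u v P a →
           (D :- con 1ℚ) :* (con (ι 2) :* P :* a) :+ (D :* (u :+ v :+ con (ι 5)) :+ con (ι 2) :* P :* a)
           := D :* (u :+ v) :+ (D :* (con (ι 2) :* P :* a) :+ con (ι 5) :* D)) refl D u v P a)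
      where
      -- Five units are needed for `lower`: one each for passing from a to x, from a to b and from b
      -- to y, and one each for rounding P x and P y. Here three suffice, and two are added to have
      -- a common constant.
      upper : u + v ≤ ι 2 * P * a + ι 5
      upper = shift (+-mono-≤ (+-mono-≤ (+-mono-≤ ux (scale xa)) (+-mono-≤ vy (scale yb)))
                              (+-mono-≤ (scale ba) (0≤ι 2)))
        (solve 7 (λ u v P a b x y →
          u :+ v :+ (P :* x :+ (P :* a :+ con 1ℚ) :+ (P :* y :+ (P :* b :+ con 1ℚ)) :+ (P :* a :+ con 1ℚ :+ con (ι 2)))
          := con (ι 2) :* P :* a :+ con (ι 5) :+ (u :+ P :* x :+ (v :+ P :* y) :+ (P :* b :+ con 0ℚ))) refl u v P a b x y)
      lower : ι 2 * P * a ≤ u + v + ι 5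
      lower = shift (+-mono-≤ (+-mono-≤ (+-mono-≤ (scale ax) xu) (+-mono-≤ (scale by) yv)) (scale ab))
        (solve 7 (λ u v P a b x y →
          con (ι 2) :* P :* a :+ (P :* x :+ con 1ℚ :+ (u :+ con 1ℚ) :+ (P :* y :+ con 1ℚ :+ (v :+ con 1ℚ)) :+ (P :* b :+ con 1ℚ))
          := u :+ v :+ con (ι 5) :+ (P :* a :+ P :* x :+ (P :* b :+ P :* y) :+ P :* a)) refl u v P a b x y)
      -- Since 2 a ≥ 1, the choice P ≥ 8 D makes the absolute error 5 at most the D-th part of 2 P
      -- a.
      5D≤ : ι 5 * D ≤ ι 2 * P * a
      5D≤ = ≤-trans (*-monoʳ 0≤D (ι-mono {5} {8} (ℕ.m≤m+n 5 3))) (≤-trans 8D≤P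
        (≤-trans (≤-reflexive (sym (*-identityʳ P))) (≤-trans (*-monoˡ 0≤P 1≤2a)
          (≤-reflexive (solve 2 (λ P a → P :* (con (ι 2) :* a) := con (ι 2) :* P :* a) refl P a)))))

  -- As Q ≤ 2 Y, the errors 11 Q and 9 Q are at most 22 Y and 18 Y, and rounding adds Y. This gives
  -- 23 below and 19 above, the latter raised to 23 as well.
  estimate-error : ∀ {D Q z Y} → 1ℚ ≤ D → 0ℚ ≤ Y → D * Q ≤ (D + 1ℚ) * Y → (D - 1ℚ) * Y ≤ D * Q →
    D * Q ≤ z + ι 11 * Q → z ≤ D * Q + ι 9 * Q → z ≤ (D + ι 23) * Y × (D - ι 23) * Y ≤ z
  estimate-error {D} {Q} {z} {Y} 1≤D 0≤Y QY YQ Qz zQ =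
    shift (+-mono-≤ (+-mono-≤ zQ QY) (+-mono-≤ (*-monoˡ (0≤ι 9) Q≤2Y) (*-monoˡ (0≤ι 4) 0≤Y)))
      (solve 4 (λ D Q z Y → z :+ (D :* Q :+ con (ι 9) :* Q :+ (D :+ con 1ℚ) :* Y :+ (con (ι 9) :* (con (ι 2) :* Y) :+ con (ι 4) :* Y))
        := (D :+ con (ι 23)) :* Y :+ (z :+ D :* Q :+ (con (ι 9) :* Q :+ con (ι 4) :* con 0ℚ))) refl D Q z Y) ,
    shift (+-mono-≤ (+-mono-≤ Qz YQ) (*-monoˡ (0≤ι 11) Q≤2Y))
      (solve 4 (λ D Q z Y → (D :- con (ι 23)) :* Y :+ (z :+ con (ι 11) :* Q :+ D :* Q :+ con (ι 11) :* (con (ι 2) :* Y))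
        := z :+ (D :* Q :+ (D :- con 1ℚ) :* Y :+ con (ι 11) :* Q)) refl D Q z Y)
    where
    D-pos : Positive D
    D-pos = positive (<-≤-trans (positive⁻¹ 1ℚ) 1≤D)
    Q≤2Y : Q ≤ ι 2 * Y
    Q≤2Y = *-cancelˡ-≤-pos D {{D-pos}} (shift (+-mono-≤ QY (*-monoʳ 0≤Y 1≤D))
      (solve 3 (λ D Q Y → D :* Q :+ ((D :+ con 1ℚ) :* Y :+ D :* Y) := D :* (con (ι 2) :* Y) :+ (D :* Q :+ con 1ℚ :* Y)) refl D Q Y))

  -- By 1 ≤ D ε the error 23 is at most 23 D ε; multiplication by c then removes the total scale D *
  -- 2 P.
  rescale-error : ∀ {D ε P c w z} → 0ℚ ≤ c → D * (ι 2 * P) * c ≡ 1ℚ → 0ℚ ≤ ι 2 * P * w → 1ℚ ≤ D * ε →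
    z ≤ (D + ι 23) * (ι 2 * P * w) × (D - ι 23) * (ι 2 * P * w) ≤ z →
    (1ℚ - ι 23 * ε) * w ≤ z * c × z * c ≤ (1ℚ + ι 23 * ε) * w
  rescale-error {D} {ε} {P} {c} {w} {z} 0≤c unit 0≤Y 1≤Dε (z≤ , ≤z) =
    ≤-trans (≤-reflexive (unscale (1ℚ - ι 23 * ε) lower-eq)) (*-monoʳ 0≤c lower) ,
    ≤-trans (*-monoʳ 0≤c upper) (≤-reflexive (sym (unscale (1ℚ + ι 23 * ε) upper-eq)))
    where
    lower : (D - ι 23 * (D * ε)) * (ι 2 * P * w) ≤ z
    lower = shift (+-mono-≤ ≤z (*-monoˡ (0≤ι 23) (*-monoʳ 0≤Y 1≤Dε)))
      (solve 4 (λ D ε Y z → (D :- con (ι 23) :* (D :* ε)) :* Y :+ (z :+ con (ι 23) :* (D :* ε :* Y))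
        := z :+ ((D :- con (ι 23)) :* Y :+ con (ι 23) :* (con 1ℚ :* Y))) refl D ε (ι 2 * P * w) z)
    upper : z ≤ (D + ι 23 * (D * ε)) * (ι 2 * P * w)
    upper = shift (+-mono-≤ z≤ (*-monoˡ (0≤ι 23) (*-monoʳ 0≤Y 1≤Dε)))
      (solve 4 (λ D ε Y z → z :+ ((D :+ con (ι 23)) :* Y :+ con (ι 23) :* (D :* ε :* Y))
        := (D :+ con (ι 23) :* (D :* ε)) :* Y :+ (z :+ con (ι 23) :* (con 1ℚ :* Y))) refl D ε (ι 2 * P * w) z)
    lower-eq : D * (ι 2 * P) * c * ((1ℚ - ι 23 * ε) * w) ≡ (D - ι 23 * (D * ε)) * (ι 2 * P * w) * c
    lower-eq = solve 5 (λ D ε P c w → D :* (con (ι 2) :* P) :* c :* ((con 1ℚ :- con (ι 23) :* ε) :* w)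
      := (D :- con (ι 23) :* (D :* ε)) :* (con (ι 2) :* P :* w) :* c) refl D ε P c w
    upper-eq : D * (ι 2 * P) * c * ((1ℚ + ι 23 * ε) * w) ≡ (D + ι 23 * (D * ε)) * (ι 2 * P * w) * c
    upper-eq = solve 5 (λ D ε P c w → D :* (con (ι 2) :* P) :* c :* ((con 1ℚ :+ con (ι 23) :* ε) :* w)
      := (D :+ con (ι 23) :* (D :* ε)) :* (con (ι 2) :* P :* w) :* c) refl D ε P c w
    unscale : ∀ f {r} → D * (ι 2 * P) * c * (f * w) ≡ r → f * w ≡ r
    unscale f eq = trans (sym (*-identityˡ (f * w))) (trans (cong (_* (f * w)) (sym unit)) eq)

-- Eventual properties and approximation of Cauchy sequences.

module Sequences where
  open import Data.Fin.Base using (Fin; zero; suc)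
  open import Data.Integer.Base using (+_)
  open import Data.Nat.Base as ℕ using (ℕ; zero; suc)
  import Data.Nat.Properties as ℕ
  open import Data.Product.Base using (∃-syntax; _×_; _,_; proj₁; proj₂)
  open import Data.Rational.Base
  open import Data.Rational.Properties
  open import Data.Rational.Solver using (module +-*-Solver)
  open import Data.Sum.Base using (inj₁; inj₂)
  open import Relation.Binary.PropositionalEquality
  open +-*-Solver
  open Rationals

  Eventually : (ℕ → Set) → Set
  Eventually P = ∃[ N ] (∀ k → N ℕ.≤ k → P k)

  map-ev : ∀ {P Q : ℕ → Set} → (∀ k → P k → Q k) → Eventually P → Eventually Q
  map-ev f (N , p) = N , λ k N≤k → f k (p k N≤k)

  zip-ev : ∀ {P Q R : ℕ → Set} → (∀ k → P k → Q k → R k) → Eventually P → Eventually Q → Eventually R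
  zip-ev f (M , p) (N , q) = M ℕ.⊔ N , λ k M⊔N≤k →
    f k (p k (ℕ.m⊔n≤o⇒m≤o M N M⊔N≤k)) (q k (ℕ.m⊔n≤o⇒n≤o M N M⊔N≤k))

  all-ev : ∀ {n} {P : Fin n → ℕ → Set} → (∀ i → Eventually (P i)) → Eventually (λ k → ∀ i → P i k)
  all-ev {zero}  p = 0 , λ _ _ ()
  all-ev {suc n} p = zip-ev (λ k p₀ ps → λ { zero → p₀ ; (suc i) → ps i }) (p zero) (all-ev λ i → p (suc i))

  always : ∀ {P : Set} → Eventually (λ _ → P) → P
  always (N , p) = p N ℕ.≤-refl

  Close : ℚ → ℚ → ℚ → Set
  Close δ x y = x ≤ y + δ × y ≤ x + δ

  Cauchy : (ℕ → ℚ) → Set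
  Cauchy x = ∀ δ → 0ℚ < δ → ∃[ N ] (∀ m n → N ℕ.≤ m → N ℕ.≤ n → ∣ x m - x n ∣ ≤ δ)

  ∣-∣≤⇒≤ : ∀ {x y δ} → ∣ x - y ∣ ≤ δ → x ≤ y + δ
  ∣-∣≤⇒≤ {x} {y} {δ} h = shift (≤-trans (p≤∣p∣ (x - y)) h)
    (solve 3 (λ x y δ → x :+ δ := y :+ δ :+ (x :- y)) refl x y δ)
    where
    p≤∣p∣ : ∀ p → p ≤ ∣ p ∣
    p≤∣p∣ p with ≤-total 0ℚ p
    ... | inj₁ 0≤p = ≤-reflexive (sym (0≤p⇒∣p∣≡p 0≤p))
    ... | inj₂ p≤0 = ≤-trans p≤0 (0≤∣p∣ p)

  close-to : ∀ {x} (cx : Cauchy x) δ (0<δ : 0ℚ < δ) → let N = proj₁ (cx δ 0<δ) in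
    ∀ m k → N ℕ.≤ m → N ℕ.≤ k → Close δ (x k) (x m)
  close-to cx δ 0<δ m k N≤m N≤k =
    ∣-∣≤⇒≤ (proj₂ (cx δ 0<δ) k m N≤k N≤m) , ∣-∣≤⇒≤ (proj₂ (cx δ 0<δ) m k N≤m N≤k)

  -- A late entry inherits an eventual property and stays within δ of all later entries. Integers
  -- are computed from such entries, since the reals themselves cannot be compared effectively.
  representative : ∀ {x} {P : ℕ → Set} → Cauchy x → Eventually P → ∀ δ → 0ℚ < δ →
    ∃[ m ] (P m × Eventually (λ k → Close δ (x k) (x m)))
  representative cx (M , p) δ 0<δ = let N = proj₁ (cx δ 0<δ) in
    M ℕ.⊔ N , p _ (ℕ.m≤m⊔n M N) , N , λ k N≤k → close-to cx δ 0<δ _ k (ℕ.m≤n⊔m M N) N≤k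

  -- As δ ≤ e / 4, x lies between 3 e / 4 and 5 e / 4, and therefore D x between 3 / 2 and 15 / 4.
  scaled-bounds : ∀ {D x e c δ} → 0ℚ ≤ D → ι 4 * δ ≡ c → c ≤ e → ι 2 ≤ D * e → D * e ≤ ι 3 → Close δ x e →
    1ℚ ≤ D * x × D * x ≤ ι 4
  scaled-bounds {D} {x} {e} {c} {δ} 0≤D refl c≤e 2≤De De≤3 (≤e , e≤) =
    *-cancelˡ-≤-pos (ι 4) (shift (+-mono-≤ (+-mono-≤ (*-monoˡ 0≤4D e≤) (*-monoˡ 0≤D c≤e)) (+-mono-≤ (+-mono-≤ 2≤De 2≤De) 0≤De))
      (solve 4 (λ D x e δ → con (ι 4) :* con 1ℚ :+ (con (ι 4) :* D :* (x :+ δ) :+ D :* e :+ (D :* e :+ D :* e :+ D :* e))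
        := con (ι 4) :* (D :* x) :+ (con (ι 4) :* D :* e :+ D :* (con (ι 4) :* δ) :+ (con (ι 2) :+ con (ι 2) :+ con 0ℚ))) refl D x e δ)) ,
    *-cancelˡ-≤-pos (ι 4) (shift (+-mono-≤ (+-mono-≤ (*-monoˡ 0≤4D ≤e) (*-monoˡ 0≤D c≤e)) (+-mono-≤ (*-monoˡ (0≤ι 5) De≤3) (0≤ι 1)))
      (solve 4 (λ D x e δ → con (ι 4) :* (D :* x) :+ (con (ι 4) :* D :* (e :+ δ) :+ D :* e :+ (con (ι 5) :* con (ι 3) :+ con 1ℚ))
        := con (ι 4) :* con (ι 4) :+ (con (ι 4) :* D :* x :+ D :* (con (ι 4) :* δ) :+ (con (ι 5) :* (D :* e) :+ con 0ℚ))) refl D x e δ))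
    where
    0≤4D : 0ℚ ≤ ι 4 * D
    0≤4D = *-nonneg (0≤ι 4) 0≤D
    0≤De : 0ℚ ≤ D * e
    0≤De = ≤-trans (0≤ι 2) 2≤De

  -- D is about 2 / x.
  inverse-scale : ∀ n .{{_ : ℕ.NonZero n}} {x} → Cauchy x →
    Eventually (λ k → + 1 / n ≤ x k × x k ≤ 1ℚ) →
    ∃[ D ] (1 ℕ.≤ D × D ℕ.≤ 3 ℕ.* n × Eventually (λ k → 1ℚ ≤ ι D * x k × ι D * x k ≤ ι 4))
  inverse-scale n {x} cx bounds = D , ℕ.s≤s ℕ.z≤n , ι-cancel D≤ ,
    map-ev (λ k → scaled-bounds 0≤D 4δ≡c c≤e 2≤De De≤3) near
    where
    c : ℚ
    c = + 1 / n
    nc≡1 : ι n * c ≡ 1ℚ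
    nc≡1 = n*1/n n
    0≤c : 0ℚ ≤ c
    0≤c = inverse-nonneg (0≤ι n) nc≡1
    0<c : 0ℚ < c
    0<c = positive⁻¹ c {{normalize-pos 1 n}}
    δ : ℚ
    δ = + 1 / 4 * c
    0<δ : 0ℚ < δ
    0<δ = subst (_< δ) (*-zeroʳ (+ 1 / 4)) (*-monoʳ-<-pos (+ 1 / 4) 0<c)
    4δ≡c : ι 4 * δ ≡ c
    4δ≡c = trans (sym (*-assoc (ι 4) (+ 1 / 4) c)) (*-identityˡ c)
    rep = representative {x} cx bounds δ 0<δ
    e : ℚ
    e = x (proj₁ rep)
    c≤e : c ≤ e
    c≤e = proj₁ (proj₁ (proj₂ rep))
    e≤1 : e ≤ 1ℚ
    e≤1 = proj₂ (proj₁ (proj₂ rep))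
    near : Eventually (λ k → Close δ (x k) e)
    near = proj₂ (proj₂ rep)
    0<e : 0ℚ < e
    0<e = <-≤-trans 0<c c≤e
    0≤e : 0ℚ ≤ e
    0≤e = <⇒≤ 0<e
    instance
      e-nonZero : NonZero e
      e-nonZero = pos⇒nonZero e {{positive 0<e}}
    i : ℚ
    i = 1/ e
    ei≡1 : e * i ≡ 1ℚ
    ei≡1 = *-inverseʳ e
    0≤2i : 0ℚ ≤ ι 2 * i
    0≤2i = *-nonneg (0≤ι 2) (inverse-nonneg 0≤e ei≡1)
    D : ℕ
    -- Rounding 2 / e up adds at most 1 to it; as e ≤ 1, the product with e stays between 2 and 3.
    D = suc (floorℕ (ι 2 * i))
    2≤De : ι 2 ≤ ι D * e
    2≤De = ≤-trans (≤-reflexive (trans (trans (sym (*-identityʳ (ι 2))) (cong (ι 2 *_) (sym ei≡1)))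
        (solve 2 (λ e i → con (ι 2) :* (e :* i) := con (ι 2) :* i :* e) refl e i)))
      (*-monoʳ 0≤e (<floorℕ+1 (ι 2 * i) 0≤2i))
    De≤3 : ι D * e ≤ ι 3
    De≤3 = ≤-trans (*-monoʳ 0≤e (≤-trans (≤-reflexive (ι-+ 1 (floorℕ (ι 2 * i)))) (+-monoʳ-≤ 1ℚ (floorℕ-≤ (ι 2 * i) 0≤2i))))
      (≤-trans (≤-reflexive (trans (solve 2 (λ e i → (con 1ℚ :+ con (ι 2) :* i) :* e := e :+ con (ι 2) :* (e :* i)) refl e i)
          (cong (λ t → e + ι 2 * t) ei≡1)))
        (+-monoˡ-≤ (ι 2 * 1ℚ) e≤1))
    0≤D : 0ℚ ≤ ι D
    0≤D = 0≤ι D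
    D≤ : ι D ≤ ι (3 ℕ.* n)
    D≤ = begin
      ι D ≡⟨ trans (sym (*-identityʳ (ι D))) (cong (ι D *_) (sym nc≡1)) ⟩
      ι D * (ι n * c) ≡⟨ solve 3 (λ d n c → d :* (n :* c) := n :* (d :* c)) refl (ι D) (ι n) c ⟩
      ι n * (ι D * c) ≤⟨ *-monoˡ (0≤ι n) (≤-trans (*-monoˡ 0≤D c≤e) De≤3) ⟩
      ι n * ι 3 ≡⟨ trans (*-comm (ι n) (ι 3)) (sym (ι-* 3 n)) ⟩
      ι (3 ℕ.* n) ∎
      where open ≤-Reasoning
  shift-up : ∀ {x r f} → x ≤ r + ½ → r ≤ ι 1 + f → x + ι 2 ≤ f + ι 4
  shift-up {x} {r} {f} x≤ r≤ = shift (+-mono-≤ x≤ (+-mono-≤ r≤ (<⇒≤ (positive⁻¹ ½))))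
    (solve 3 (λ x r f → x :+ con (ι 2) :+ (r :+ con ½ :+ (con (ι 1) :+ f :+ con ½)) := f :+ con (ι 4) :+ (x :+ (r :+ con 0ℚ))) refl x r f)

  shift-down : ∀ {x r f} → r ≤ x + ½ → f ≤ r → f + ι 4 ≤ x + ι 5
  shift-down {x} {r} {f} r≤ f≤ = shift (+-mono-≤ r≤ (+-mono-≤ f≤ (<⇒≤ (positive⁻¹ ½))))
    (solve 3 (λ x r f → f :+ con (ι 4) :+ (x :+ con ½ :+ (r :+ con ½)) := x :+ con (ι 5) :+ (r :+ (f :+ con 0ℚ))) refl x r f)

  round-up : ∀ {x r} f → ι f ≤ r → r ≤ ι (suc f) → Close ½ x r → x + ι 2 ≤ ι (f ℕ.+ 4) × ι (f ℕ.+ 4) ≤ x + ι 5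
  round-up {x} {r} f f≤ ≤f+1 (≤r , r≤) =
    subst (x + ι 2 ≤_) (sym (ι-+ f 4)) (shift-up {x} {r} {ι f} ≤r (subst (r ≤_) (ι-+ 1 f) ≤f+1)) ,
    subst (_≤ x + ι 5) (sym (ι-+ f 4)) (shift-down {x} {r} {ι f} r≤ f≤)

  -- The floor of a late entry, raised by 4. The margin 2 above the sequence absorbs the
  -- approximation errors in `rounded-bound`; the limit 5 keeps the bound for W close enough to W
  -- for the size estimate.
  upper-integer : ∀ {x} → Cauchy x → Eventually (λ k → ½ ≤ x k) →
    ∃[ w ] Eventually (λ k → x k + ι 2 ≤ ι w × ι w ≤ x k + ι 5)
  upper-integer {x} cx ½≤ = f ℕ.+ 4 , map-ev (λ k → round-up f (floorℕ-≤ r 0≤r) (<floorℕ+1 r 0≤r)) (proj₂ (proj₂ rep))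
    where
    rep = representative {x} cx ½≤ ½ (positive⁻¹ ½)
    r : ℚ
    r = x (proj₁ rep)
    0≤r : 0ℚ ≤ r
    0≤r = ≤-trans (<⇒≤ (positive⁻¹ ½)) (proj₁ (proj₂ rep))
    f : ℕ
    f = floorℕ r

-- The integer sketch as bit strings, and its size in terms of the parameters.

module IntegerTheorem where
  open Prelude
  open Sums
  open Log
  open ContractedGraph using (cut)
  open Encoding using (toBits; fromBits; fromBits-toBits; length-encodeBits; encode)
  open IntegerSketch using (estimateℕ)
  open SketchBounds

  -- A Boolean test on integers, so that failing outcomes can be counted.
  accurate : ℕ → ℕ → ℕ → Bool
  accurate D Q z = (D * Q ≤ᵇ z + 11 * Q) ∧ (z ≤ᵇ D * Q + 9 * Q)

  accurate-sound : ∀ D Q z → accurate D Q z ≡ true → D * Q ≤ z + 11 * Q × z ≤ D * Q + 9 * Q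
  accurate-sound D Q z eq with D * Q ≤ᵇ z + 11 * Q | ≤ᵇ⇒≤ (D * Q) (z + 11 * Q)
  ... | true | lower with z ≤ᵇ D * Q + 9 * Q | ≤ᵇ⇒≤ z (D * Q + 9 * Q)
  ... | true | upper = lower _ , upper _

  accurate-complete : ∀ D Q z → D * Q ≤ z + 11 * Q → z ≤ D * Q + 9 * Q → accurate D Q z ≡ true
  accurate-complete D Q z lower upper with D * Q ≤ᵇ z + 11 * Q | ≤⇒≤ᵇ lower
  ... | true | _ with z ≤ᵇ D * Q + 9 * Q | ≤⇒≤ᵇ upper
  ... | true | _ = refl

  -- At most 180 X numbers below 2 ^ (ℓ + 4 L + 9), with two bits for a digit and two for the end of
  -- a number.
  sketchSize : ℕ → ℕ → ℕ → ℕ → ℕ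
  sketchSize n D L ℓ = 180 * (D * L * L * n) * (2 * (ℓ + 4 * L + 9) + 2)

  record RandomSketch {n : ℕ} (estimate : List Bool → (Fin n → Bool) → ℕ) (D L ℓ : ℕ) (q : Fin n → Fin n → ℕ) : Set where
    field
      outcomes : List (List Bool)
      nonempty : 1 ≤ length outcomes
      short    : ∀ {o} → o ∈ outcomes → length o ≤ sketchSize n D L ℓ
      reliable : ∀ χ → (∑[ o ∈ outcomes ] ⟦ not (accurate D (cut q χ (allFin n)) (estimate o χ)) ⟧) * n ≤ length outcomes

  module _ {n : ℕ} .{{_ : NonZero n}} where

    abstract

      estimateBits : ℕ → List Bool → (Fin n → Bool) → ℕ
      estimateBits D bs = estimateℕ D (fromBits (stored-codec D) bs)

      randomSketch : ∀ D L ℓ → 1 ≤ D → D ≤ 2 ^ (L + 2) → 1 ≤ L → n ≤ 2 ^ L →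
        ∀ q → (∀ u v → q u v ≡ q v u) → (∀ u v → q u v ≤ 2 ^ (2 ^ ℓ + L + 6)) → RandomSketch (estimateBits D) D L ℓ q
      randomSketch D L ℓ 1≤D D≤ 1≤L n≤ q q-sym q≤ = record
        { outcomes = map bits S.outcomes
        ; nonempty = subst (1 ≤_) (sym (length-map bits S.outcomes)) S.outcomes-nonempty
        ; short    = short
        ; reliable = reliable }
        where
        module S = Bounds {n} D L (2 ^ ℓ + L + 6) 1≤D D≤ 1≤L n≤ q q-sym q≤
        bits : List (List (Fin n)) → List Bool
        bits τ = toBits (stored-codec D) (S.sketchOf τ)
        b : ℕ
        -- Large enough for T = 2 ^ ℓ + 3 L + 7 and for the bound 2 ^ (4 L + 7) on 22 X.
        b = ℓ + 4 * L + 9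
        T≤ : S.T ≤ 2 ^ b
        T≤ = begin
          suc (2 * L + (2 ^ ℓ + L + 6)) ≡⟨ regroup L (2 ^ ℓ) ⟩
          2 ^ ℓ + 1 * (3 * L + 7) ≤⟨ +-monoʳ-≤ (2 ^ ℓ) (*-monoˡ-≤ (3 * L + 7) (2^-pos ℓ)) ⟩
          2 ^ ℓ + 2 ^ ℓ * (3 * L + 7) ≡⟨ sym (*-suc (2 ^ ℓ) (3 * L + 7)) ⟩
          2 ^ ℓ * suc (3 * L + 7) ≤⟨ *-monoʳ-≤ (2 ^ ℓ) (≤-trans (s≤s (+-mono-≤ (*-monoˡ-≤ L (n≤1+n 3)) (m≤m+n 7 2))) (n<2^n (4 * L + 9))) ⟩
          2 ^ ℓ * 2 ^ (4 * L + 9) ≡⟨ sym (^-distribˡ-+-* 2 ℓ (4 * L + 9)) ⟩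
          2 ^ (ℓ + (4 * L + 9)) ≡⟨ cong (2 ^_) (sym (+-assoc ℓ (4 * L) 9)) ⟩
          2 ^ b ∎
          where
          open ≤-Reasoning
          regroup : ∀ l e → suc (2 * l + (e + l + 6)) ≡ e + 1 * (3 * l + 7)
          regroup = solve-∀
        X< : 22 * (D * L * L * n) < 2 ^ b
        X< = <-≤-trans S.22X< (2^-mono (≤-trans (+-monoʳ-≤ (4 * L) (m≤m+n 7 2))
          (≤-trans (m≤n+m _ ℓ) (≤-reflexive (sym (+-assoc ℓ (4 * L) 9))))))
        short : ∀ {o} → o ∈ map bits S.outcomes → length o ≤ sketchSize n D L ℓ
        short o∈ = let τ , τ∈ , eq = ∈-map⁻ bits o∈ in subst (λ o → length o ≤ sketchSize n D L ℓ) (sym eq)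
          (≤-trans (length-encodeBits b (encode (stored-codec D) (S.sketchOf τ)) (S.encoded-entries b T≤ X< τ∈))
                   (*-monoˡ-≤ (2 * b + 2) (S.encoded-length τ∈)))
        reliable : ∀ χ → (∑[ o ∈ map bits S.outcomes ] ⟦ not (accurate D (cut q χ (allFin n)) (estimateBits D o χ)) ⟧) * n
                         ≤ length (map bits S.outcomes)
        reliable χ = begin
          (∑[ o ∈ map bits S.outcomes ] wrong o) * n ≡⟨ cong (_* n) (∑-map bits S.outcomes wrong) ⟩
          (∑[ τ ∈ S.outcomes ] wrong (bits τ)) * n ≤⟨ *-mono-≤ (∑-mono-∈ S.outcomes pointwise) n≤ ⟩
          (∑[ τ ∈ S.outcomes ] ⟦ S.failed χ τ ⟧) * 2 ^ L ≤⟨ S.failed-rare χ ⟩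
          length S.outcomes ≡⟨ sym (length-map bits S.outcomes) ⟩
          length (map bits S.outcomes) ∎
          where
          open ≤-Reasoning
          Q : ℕ
          Q = cut q χ (allFin n)
          wrong : List Bool → ℕ
          wrong o = ⟦ not (accurate D Q (estimateBits D o χ)) ⟧
          right : ∀ τ → τ ∈ S.outcomes → S.failed χ τ ≡ false → accurate D Q (estimateBits D (bits τ) χ) ≡ true
          right τ τ∈ ok = trans (cong (λ s → accurate D Q (estimateℕ D s χ)) (fromBits-toBits (stored-codec D) (S.sketchOf τ)))
            (accurate-complete D Q _ (proj₁ (S.accuracy χ τ∈ ok)) (proj₂ (S.accuracy χ τ∈ ok)))
          pointwise : ∀ τ → τ ∈ S.outcomes → wrong (bits τ) ≤ ⟦ S.failed χ τ ⟧
          pointwise τ τ∈ = case (S.failed χ τ) refl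
            where
            case : ∀ f → S.failed χ τ ≡ f → wrong (bits τ) ≤ ⟦ f ⟧
            case true  _  = ⟦⟧≤1 (not (accurate D Q (estimateBits D (bits τ) χ)))
            case false ok = ≤-reflexive (cong (λ a → ⟦ not a ⟧) (right τ τ∈ ok))

  -- As ℓ and L are positive, 2 ℓ + 8 L + 22 is at most 32 ℓ L, and L ≤ 2 m turns the cube of L into
  -- 8 m³; 180 * 32 * 8 = 46080.
  sketchSize-≤ : ∀ n D L ℓ₀ ℓ m → 1 ≤ ℓ → ℓ₀ ≤ suc ℓ → 1 ≤ L → L ≤ 2 * m →
    sketchSize n D L ℓ₀ ≤ 46080 * (n * ℓ) * m ^ 3 * D
  sketchSize-≤ n D L ℓ₀ ℓ m 1≤ℓ ℓ₀≤ 1≤L L≤ = begin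
    180 * (D * L * L * n) * (2 * (ℓ₀ + 4 * L + 9) + 2)
      ≤⟨ *-monoʳ-≤ (180 * (D * L * L * n)) (+-monoˡ-≤ 2 (*-monoʳ-≤ 2 (+-monoˡ-≤ 9 (+-monoˡ-≤ (4 * L) ℓ₀≤)))) ⟩
    180 * (D * L * L * n) * (2 * (suc ℓ + 4 * L + 9) + 2)
      ≡⟨ cong (180 * (D * L * L * n) *_) (expand ℓ L) ⟩
    180 * (D * L * L * n) * (2 * (ℓ * 1) + 8 * (1 * L) + 22 * (1 * 1))
      ≤⟨ *-monoʳ-≤ (180 * (D * L * L * n)) (+-mono-≤ (+-mono-≤ (*-monoʳ-≤ 2 (*-monoʳ-≤ ℓ 1≤L)) (*-monoʳ-≤ 8 (*-monoˡ-≤ L 1≤ℓ)))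
                                              (*-monoʳ-≤ 22 (*-mono-≤ 1≤ℓ 1≤L))) ⟩
    180 * (D * L * L * n) * (2 * (ℓ * L) + 8 * (ℓ * L) + 22 * (ℓ * L))
      ≡⟨ collect n D L ℓ ⟩
    5760 * (n * ℓ) * (L * L * L) * D
      ≤⟨ *-monoˡ-≤ D (*-monoʳ-≤ (5760 * (n * ℓ)) (*-mono-≤ (*-mono-≤ L≤ L≤) L≤)) ⟩
    5760 * (n * ℓ) * (2 * m * (2 * m) * (2 * m)) * D
      ≡⟨ cube (n * ℓ) m D ⟩
    46080 * (n * ℓ) * m ^ 3 * D ∎
    where
    open ≤-Reasoning
    expand : ∀ l k → 2 * (suc l + 4 * k + 9) + 2 ≡ 2 * (l * 1) + 8 * (1 * k) + 22 * (1 * 1)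
    expand = solve-∀
    collect : ∀ n d l k → 180 * (d * l * l * n) * (2 * (k * l) + 8 * (k * l) + 22 * (k * l)) ≡ 5760 * (n * k) * (l * l * l) * d
    collect = solve-∀
    cube : ∀ x m d → 5760 * x * (2 * m * (2 * m) * (2 * m)) * d ≡ 46080 * x * (m * (m * (m * 1))) * d
    cube = solve-∀

  scale-≤ : ∀ {n D} L → n ≤ 2 ^ L → D ≤ 3 * n → D ≤ 2 ^ (L + 2)
  scale-≤ L n≤ D≤ = ≤-trans D≤ (≤-trans (*-mono-≤ (n≤1+n 3) n≤)
    (≤-reflexive (trans (*-comm 4 (2 ^ L)) (sym (^-distribˡ-+-* 2 L 2)))))

  precision-≥ : ∀ {D} L → D ≤ 2 ^ (L + 2) → 8 * D ≤ 2 ^ (L + 5)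
  precision-≥ L D≤ = ≤-trans (*-monoʳ-≤ 8 D≤)
    (≤-reflexive (trans (sym (^-distribˡ-+-* 2 3 (L + 2))) (cong (2 ^_) (exponent L))))
    where
    exponent : ∀ l → 3 + (l + 2) ≡ l + 5
    exponent = solve-∀

  symmetrised-≤ : ∀ {r r′ w} L e → r ≤ 2 ^ (L + 5) * w → r′ ≤ 2 ^ (L + 5) * w → w ≤ 2 ^ e → r + r′ ≤ 2 ^ (e + L + 6)
  symmetrised-≤ {r} {r′} {w} L e r≤ r′≤ w≤ = begin
    r + r′ ≤⟨ +-mono-≤ (≤-trans r≤ Pw≤) (≤-trans r′≤ Pw≤) ⟩
    2 ^ (L + 5 + e) + 2 ^ (L + 5 + e) ≡⟨ sym (double (2 ^ (L + 5 + e))) ⟩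
    2 ^ suc (L + 5 + e) ≡⟨ cong (2 ^_) (exponent L e) ⟩
    2 ^ (e + L + 6) ∎
    where
    open ≤-Reasoning
    Pw≤ : 2 ^ (L + 5) * w ≤ 2 ^ (L + 5 + e)
    Pw≤ = ≤-trans (*-monoʳ-≤ (2 ^ (L + 5)) w≤) (≤-reflexive (sym (^-distribˡ-+-* 2 (L + 5) e)))
    exponent : ∀ l e → suc (l + 5 + e) ≡ e + l + 6
    exponent = solve-∀

  -- For x ≥ 4, x + 6 ≤ 4 x ≤ x²: the additive slack in the integer bound for W raises the double
  -- logarithm by at most one.
  tower-slack : ∀ {ℓ} → 1 ≤ ℓ → 2 ^ (2 ^ ℓ) + 6 ≤ 2 ^ (2 ^ suc ℓ)
  tower-slack {ℓ} 1≤ℓ = begin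
    x + 6 ≤⟨ +-monoʳ-≤ x (≤-trans (m≤m+n 6 6) (*-monoʳ-≤ 3 4≤x)) ⟩
    4 * x ≤⟨ *-monoˡ-≤ x 4≤x ⟩
    x * x ≡⟨ sym (^-distribˡ-+-* 2 (2 ^ ℓ) (2 ^ ℓ)) ⟩
    2 ^ (2 ^ ℓ + 2 ^ ℓ) ≡⟨ cong (2 ^_) (sym (double (2 ^ ℓ))) ⟩
    2 ^ (2 ^ suc ℓ) ∎
    where
    open ≤-Reasoning
    x : ℕ
    x = 2 ^ (2 ^ ℓ)
    4≤x : 4 ≤ x
    4≤x = 2^-mono {2} (2^-mono {1} 1≤ℓ)

  -- Because of ε < 1 / 30, the logarithm m of n ℓ / ε is positive and at least that of n, so it
  -- pays for L. The summand 15 is 30 times the tolerance 1 / 2 of the comparison of reals.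
  suc-lg-≤ : ∀ {n ℓ} m → 1 ≤ n → 1 ≤ ℓ → 30 * (n * ℓ) ≤ 2 ^ m + 15 → suc (lg n) ≤ 2 * m
  suc-lg-≤ {n} {ℓ} m 1≤n 1≤ℓ 30nℓ≤ = ≤-trans (s≤s (lg-least n≤2^m))
    (≤-trans (+-monoˡ-≤ m (1≤m m 30n≤)) (≤-reflexive (sym (double m))))
    where
    open ≤-Reasoning
    30n≤ : 30 * n ≤ 16 * 2 ^ m
    30n≤ = begin
      30 * n ≤⟨ *-monoʳ-≤ 30 (≤-trans (≤-reflexive (sym (*-identityʳ n))) (*-monoʳ-≤ n 1≤ℓ)) ⟩
      30 * (n * ℓ) ≤⟨ 30nℓ≤ ⟩
      2 ^ m + 15 * 1 ≤⟨ +-monoʳ-≤ (2 ^ m) (*-monoʳ-≤ 15 (2^-pos m)) ⟩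
      16 * 2 ^ m ∎
    n≤2^m : n ≤ 2 ^ m
    n≤2^m = *-cancelˡ-≤ 16 (≤-trans (*-monoˡ-≤ n (m≤m+n 16 14)) 30n≤)
    1≤m : ∀ m → 30 * n ≤ 16 * 2 ^ m → 1 ≤ m
    1≤m zero    le = contradiction (≤-trans (*-monoʳ-≤ 30 1≤n) le) (<⇒≱ (m≤m+n 17 13))
    1≤m (suc m) le = s≤s z≤n

open import Defs
open import Data.Nat.Base as ℕ using (ℕ)
open import Data.Integer.Base using (+_)
open import Data.Product.Base using (Σ-syntax; _×_)
open import Data.Rational.Base as ℚ using (ℚ)

-- From integer to real weights, and from counts to probabilities.

module RealSketch where
  open import Data.Bool.Base using (Bool; true; false; not; _∧_; if_then_else_)
  open import Data.Fin.Base using (Fin; zero; suc)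
  open import Data.Fin.Subset using (Subset)
  open import Data.List.Base as List using (List; []; _∷_; length; allFin)
  open import Data.List.Membership.Propositional using (_∈_)
  open import Data.Nat.Base using (zero; suc)
  import Data.Nat.Properties as ℕ
  open import Data.Product.Base using (_,_; proj₁; proj₂)
  open import Data.Rational.Base using (0ℚ; 1ℚ; ½)
  import Data.Rational.Properties as ℚ
  open import Data.Rational.Solver using (module +-*-Solver)
  open import Data.Vec.Base using (lookup; tabulate)
  open import Data.Vec.Properties using (lookup∘tabulate; []=⇒lookup)
  open import Relation.Binary.PropositionalEquality
  open +-*-Solver using (solve; _:+_; _:*_; _:-_; _:=_; con)
  open Sums using (⟦_⟧)
  open ContractedGraph using (cut; crosses)
  open Rationals
  open Sequences

  eventually-≤ : ∀ {x y} → Eventually (λ k → seq x k ℚ.≤ seq y k) → x ≤ y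
  eventually-≤ {x} {y} (N , h) δ 0<δ = N , λ k N≤k → ℚ.≤-trans (h k N≤k)
    (ℚ.≤-trans (ℚ.≤-reflexive (sym (ℚ.+-identityʳ (seq y k)))) (ℚ.+-monoʳ-≤ (seq y k) (ℚ.<⇒≤ 0<δ)))

  <⇒eventually-≤ : ∀ {x y} → x < y → Eventually (λ k → seq x k ℚ.≤ seq y k)
  <⇒eventually-≤ {x} (δ , 0<δ , ev) = map-ev (λ k → ℚ.≤-trans
    (ℚ.≤-trans (ℚ.≤-reflexive (sym (ℚ.+-identityʳ (seq x k)))) (ℚ.+-monoʳ-≤ (seq x k) (ℚ.<⇒≤ 0<δ)))) ev

  1≤⇒eventually-½≤ : ∀ {x} → 1ℝ ≤ x → Eventually (λ k → ½ ℚ.≤ seq x k)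
  1≤⇒eventually-½≤ {x} 1≤x = map-ev (λ k 1≤ → shift 1≤ (half (seq x k))) (1≤x ½ (ℚ.positive⁻¹ ½))
    where
    half : ∀ x → ½ ℚ.+ (x ℚ.+ ½) ≡ x ℚ.+ 1ℚ
    half = solve 1 (λ x → con ½ :+ (x :+ con ½) := x :+ con 1ℚ) refl

  seq-∑ : ∀ {n} (f : Fin n → ℝ) k → seq (∑ f) k ≡ ∑ℚ (λ i → seq (f i) k)
  seq-∑ {zero}  f k = refl
  seq-∑ {suc n} f k = cong (λ t → seq (f zero) k ℚ.+ t) (seq-∑ (λ i → f (suc i)) k)

  ι-∑-allFin : ∀ {n} (f : Fin n → ℕ) → ι (Sums.∑ (allFin n) f) ≡ ∑ℚ (λ i → ι (f i))
  ι-∑-allFin {zero}  f = refl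
  ι-∑-allFin {suc n} f = trans (cong ι (Sums.∑-allFin-suc n f)) (trans (ι-+ (f zero) _)
    (cong (λ t → ι (f zero) ℚ.+ t) (ι-∑-allFin λ i → f (suc i))))

  ι-∑-lookup : ∀ {A : Set} (xs : List A) (f : A → ℕ) → ι (Sums.∑ xs f) ≡ ∑ℚ (λ i → ι (f (List.lookup xs i)))
  ι-∑-lookup []       f = refl
  ι-∑-lookup (x ∷ xs) f = trans (ι-+ (f x) _) (cong (λ t → ι (f x) ℚ.+ t) (ι-∑-lookup xs f))

  module _ (xs : List (List Bool)) .{{_ : ℕ.NonZero (length xs)}} where

    private
      N : ℕ
      N = length xs
      c : ℚ
      c = + 1 ℚ./ N
      Nc≡1 : ι N ℚ.* c ≡ 1ℚ
      Nc≡1 = n*1/n N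
      0≤c : 0ℚ ℚ.≤ c
      0≤c = inverse-nonneg (0≤ι N) Nc≡1

    uniform : Distribution (List Bool)
    uniform = record
      { #outcomes = N
      ; outcome = List.lookup xs
      ; probability = λ _ → fromℚ c
      ; probability-nonNegative = λ _ → eventually-≤ {0ℝ} {fromℚ c} (0 , λ _ _ → 0≤c)
      ; probability-total = eventually-≤ {∑ {N} (λ _ → fromℚ c)} {1ℝ} (0 , λ k _ → ℚ.≤-reflexive (total k)) ,
                            eventually-≤ {1ℝ} {∑ {N} (λ _ → fromℚ c)} (0 , λ k _ → ℚ.≤-reflexive (sym (total k))) }
      where
      total : ∀ k → seq (∑ {N} (λ _ → fromℚ c)) k ≡ 1ℚ
      total k = trans (seq-∑ {N} (λ _ → fromℚ c) k) (trans (∑ℚ-const N c) Nc≡1)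

    -- The event need not be decidable; the outcomes that pass a sound Boolean test form the set to
    -- be exhibited.
    uniform-Pr : ∀ m .{{_ : ℕ.NonZero m}} (good : List Bool → Bool) (P : List Bool → Set) → (∀ o → good o ≡ true → P o) →
      Sums.∑ xs (λ o → ⟦ not (good o) ⟧) ℕ.* m ℕ.≤ N → Pr[ uniform ∶ P ]≥ (1ℝ - fromℚ (+ 1 ℚ./ m))
    uniform-Pr m good P sound few = T ,
      (λ i i∈ → sound _ (trans (sym (lookup∘tabulate (λ i → good (List.lookup xs i)) i)) ([]=⇒lookup i∈))) ,
      eventually-≤ {1ℝ - fromℚ r} {∑ masses} (0 , λ k _ → ℚ.≤-trans bound (ℚ.≤-reflexive (sym (mass k))))
      where
      T : Subset N
      T = tabulate (λ i → good (List.lookup xs i))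
      r : ℚ
      r = + 1 ℚ./ m
      mr≡1 : ι m ℚ.* r ≡ 1ℚ
      mr≡1 = n*1/n m
      #good #bad : ℕ
      #good = Sums.∑ xs (λ o → ⟦ good o ⟧)
      #bad  = Sums.∑ xs (λ o → ⟦ not (good o) ⟧)
      masses : Fin N → ℝ
      masses i = if lookup T i then fromℚ c else 0ℝ
      one : ∀ b k → seq (if b then fromℚ c else 0ℝ) k ≡ c ℚ.* ι ⟦ b ⟧
      one true  k = sym (ℚ.*-identityʳ c)
      one false k = sym (ℚ.*-zeroʳ c)
      mass : ∀ k → seq (∑ masses) k ≡ c ℚ.* ι #good
      mass k = trans (seq-∑ masses k) (trans (∑ℚ-cong λ i → trans (one (lookup T i) k)
          (cong (λ b → c ℚ.* ι ⟦ b ⟧) (lookup∘tabulate (λ i → good (List.lookup xs i)) i)))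
        (trans (∑ℚ-*ˡ c (λ i → ι ⟦ good (List.lookup xs i) ⟧)) (cong (c ℚ.*_) (sym (ι-∑-lookup xs (λ o → ⟦ good o ⟧))))))
      total : #good ℕ.+ #bad ≡ N
      total = trans (sym (Sums.∑-+ xs _ _)) (trans (Sums.∑-cong xs λ o → split (good o)) (Sums.∑-1 xs))
        where
        split : ∀ b → ⟦ b ⟧ ℕ.+ ⟦ not b ⟧ ≡ 1
        split true  = refl
        split false = refl
      bad≤ : ι #bad ℚ.* c ℚ.≤ r
      bad≤ = begin
        ι #bad ℚ.* c ≡⟨ trans (sym (ℚ.*-identityʳ (ι #bad ℚ.* c))) (cong (ι #bad ℚ.* c ℚ.*_) (sym mr≡1)) ⟩
        ι #bad ℚ.* c ℚ.* (ι m ℚ.* r) ≡⟨ solve 4 (λ b c m r → b :* c :* (m :* r) := b :* m :* (c :* r)) refl (ι #bad) c (ι m) r ⟩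
        ι #bad ℚ.* ι m ℚ.* (c ℚ.* r) ≤⟨ *-monoʳ (*-nonneg 0≤c (inverse-nonneg (0≤ι m) mr≡1))
                                                  (ℚ.≤-trans (ℚ.≤-reflexive (sym (ι-* #bad m))) (ι-mono few)) ⟩
        ι N ℚ.* (c ℚ.* r) ≡⟨ trans (sym (ℚ.*-assoc (ι N) c r)) (trans (cong (ℚ._* r) Nc≡1) (ℚ.*-identityˡ r)) ⟩
        r ∎
        where open ℚ.≤-Reasoning
      bound : 1ℚ ℚ.- r ℚ.≤ c ℚ.* ι #good
      bound = shift bad≤ (trans (cancel r) (trans (trans (sym Nc≡1) (cong (λ s → ι s ℚ.* c) (sym total)))
        (trans (cong (ℚ._* c) (ι-+ #good #bad)) (solve 3 (λ g b c → (g :+ b) :* c := c :* g :+ b :* c) refl (ι #good) (ι #bad) c))))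
        where
        cancel : ∀ r → 1ℚ ℚ.- r ℚ.+ r ≡ 1ℚ
        cancel = solve 1 (λ r → con 1ℚ :- r :+ r := con 1ℚ) refl

  module Rounding {n : ℕ} {W : ℝ} (P : ℕ) .{{_ : ℕ.NonZero P}} (G : Graph n W) where

    c : ℚ
    c = + 1 ℚ./ P

    Pc≡1 : ι P ℚ.* c ≡ 1ℚ
    Pc≡1 = n*1/n P

    0<c : 0ℚ ℚ.< c
    0<c = ℚ.positive⁻¹ c {{ℚ.normalize-pos 1 P}}

    -- Its entry in the sequence from which on the weight varies by at most 1 / P.
    approx : Fin n → Fin n → ℚ
    approx i j = seq (weight G i j) (proj₁ (cauchy (weight G i j) c 0<c))

    rounded : Fin n → Fin n → ℕ
    rounded i j = if adjacent G i j then floorℕ (ι P ℚ.* approx i j) else 0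

    -- Both directions, each of which has its own approximating sequence.
    q : Fin n → Fin n → ℕ
    q i j = rounded i j ℕ.+ rounded j i

    q-sym : ∀ i j → q i j ≡ q j i
    q-sym i j = ℕ.+-comm (rounded i j) (rounded j i)

    rounded-off : ∀ {i j} → adjacent G i j ≡ false → rounded i j ≡ 0
    rounded-off e rewrite e = refl

    rounded-on : ∀ {i j} → adjacent G i j ≡ true → rounded i j ≡ floorℕ (ι P ℚ.* approx i j)
    rounded-on e rewrite e = refl

    module _ (2≤P : 2 ℕ.≤ P) where

      c≤½ : c ℚ.≤ ½
      c≤½ = shift {ι 2 ℚ.* (½ ℚ.* c)} {ι P ℚ.* (½ ℚ.* c)}
        (*-monoʳ (*-nonneg (ℚ.<⇒≤ (ℚ.positive⁻¹ ½)) (ℚ.<⇒≤ 0<c)) (ι-mono 2≤P))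
        (trans (cong (c ℚ.+_) (trans (solve 3 (λ P h c → P :* (h :* c) := h :* (P :* c)) refl (ι P) ½ c) (cong (½ ℚ.*_) Pc≡1)))
          (solve 1 (λ c → c :+ con ½ :* con 1ℚ := con ½ :+ con (ι 2) :* (con ½ :* c)) refl c))

      module _ {i j} (e : adjacent G i j ≡ true) where

        weight-late : Eventually (λ k → Close c (seq (weight G i j) k) (approx i j))
        weight-late = proj₁ (cauchy (weight G i j) c 0<c) , λ k N≤k →
          close-to {seq (weight G i j)} (cauchy (weight G i j)) c 0<c _ k ℕ.≤-refl N≤k

        weight-≥½ : Eventually (λ k → ½ ℚ.≤ seq (weight G i j) k)
        weight-≥½ = 1≤⇒eventually-½≤ {weight G i j} (proj₁ (weight-range G i j e))

        approx-nonneg : 0ℚ ℚ.≤ approx i j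
        approx-nonneg = always (zip-ev (λ k close ½≤ → shift (ℚ.+-mono-≤ (proj₁ close) (ℚ.+-mono-≤ ½≤ c≤½))
            (solve 3 (λ a w c → con 0ℚ :+ (a :+ c :+ (w :+ con ½)) := a :+ (w :+ (con ½ :+ c))) refl (approx i j) (seq (weight G i j) k) c))
          weight-late weight-≥½)

        rounded-≤ : ι (rounded i j) ℚ.≤ ι P ℚ.* approx i j
        rounded-≤ = subst (λ r → ι r ℚ.≤ ι P ℚ.* approx i j) (sym (rounded-on e))
          (floorℕ-≤ (ι P ℚ.* approx i j) (*-nonneg (0≤ι P) approx-nonneg))

        rounded-≥ : ι P ℚ.* approx i j ℚ.≤ ι (rounded i j) ℚ.+ 1ℚ
        rounded-≥ = subst (λ r → ι P ℚ.* approx i j ℚ.≤ ι r ℚ.+ 1ℚ) (sym (rounded-on e))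
          (subst (ι P ℚ.* approx i j ℚ.≤_) (suc-right (floorℕ (ι P ℚ.* approx i j)))
            (<floorℕ+1 (ι P ℚ.* approx i j) (*-nonneg (0≤ι P) approx-nonneg)))
          where
          suc-right : ∀ f → ι (suc f) ≡ ι f ℚ.+ 1ℚ
          suc-right f = trans (ι-+ 1 f) (ℚ.+-comm 1ℚ (ι f))

        rounded-bound : ∀ {w} → Eventually (λ k → seq W k ℚ.+ ι 2 ℚ.≤ ι w) → rounded i j ℕ.≤ P ℕ.* w
        rounded-bound {w} W≤ = ι-cancel (ℚ.≤-trans rounded-≤ (ℚ.≤-trans (*-monoˡ (0≤ι P) approx≤) (ℚ.≤-reflexive (sym (ι-* P w)))))
          where
          approx≤ : approx i j ℚ.≤ ι w
          approx≤ = always (zip-ev (λ k close rest → shift (ℚ.+-mono-≤ (proj₂ close) rest)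
              (solve 4 (λ a x c w → a :+ (x :+ c :+ w) := w :+ (a :+ (x :+ c))) refl (approx i j) (seq (weight G i j) k) c (ι w)))
            weight-late (zip-ev (λ k ≤W W≤w → shift (ℚ.+-mono-≤ (ℚ.+-mono-≤ ≤W W≤w) (ℚ.+-mono-≤ c≤½ (0≤ι 1)))
                (solve 4 (λ x W c w → x :+ c :+ (W :+ con ½ :+ w :+ (con ½ :+ con 1ℚ)) := w :+ (x :+ (W :+ con (ι 2)) :+ (c :+ con 0ℚ))) refl
                   (seq (weight G i j) k) (seq W k) c (ι w)))
              (proj₂ (weight-range G i j e) ½ (ℚ.positive⁻¹ ½)) W≤))

      module _ (D : ℕ) (8D≤P : 8 ℕ.* D ℕ.≤ P) where

        -- A relative error 1 / D, multiplied out so as to be linear in Q and a and to pass to sums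
        -- over edges. The scale is 2 P because `q` adds both directions.
        EdgeClose : ℕ → ℚ → Set
        EdgeClose Q a = 0ℚ ℚ.≤ ι 2 ℚ.* ι P ℚ.* a ×
          ι D ℚ.* ι Q ℚ.≤ (ι D ℚ.+ 1ℚ) ℚ.* (ι 2 ℚ.* ι P ℚ.* a) ×
          (ι D ℚ.- 1ℚ) ℚ.* (ι 2 ℚ.* ι P ℚ.* a) ℚ.≤ ι D ℚ.* ι Q

        edge-close : ∀ {i j} → adjacent G i j ≡ true → Eventually (λ k → EdgeClose (q i j) (seq (weight G i j) k))
        edge-close {i} {j} e = zip-ev (λ k (closeᵢ , closeⱼ) (½≤ , ij≤ji , ji≤ij) →
            *-nonneg (*-nonneg (0≤ι 2) (0≤ι P)) (ℚ.≤-trans (ℚ.<⇒≤ (ℚ.positive⁻¹ ½)) ½≤) ,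
            subst (λ Q → ι D ℚ.* Q ℚ.≤ (ι D ℚ.+ 1ℚ) ℚ.* (ι 2 ℚ.* ι P ℚ.* seq (weight G i j) k) ×
                         (ι D ℚ.- 1ℚ) ℚ.* (ι 2 ℚ.* ι P ℚ.* seq (weight G i j) k) ℚ.≤ ι D ℚ.* Q)
              (sym (ι-+ (rounded i j) (rounded j i)))
              (edge-error {ι P} {c} (0≤ι P) Pc≡1 (proj₁ closeᵢ) (proj₂ closeᵢ) (proj₁ closeⱼ) (proj₂ closeⱼ) ij≤ji ji≤ij
                (rounded-≤ e) (rounded-≥ e) (rounded-≤ e′) (rounded-≥ e′) (0≤ι D)
                (ℚ.≤-trans (ℚ.≤-reflexive (sym (ι-* 8 D))) (ι-mono 8D≤P))
                (*-monoˡ (0≤ι 2) ½≤)))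
          (zip-ev (λ k a b → a , b) (weight-late e) (weight-late e′))
          (zip-ev (λ k a b → a , b) (weight-≥½ e) (zip-ev (λ k a b → a , b)
            (proj₁ (weight-symmetric G i j e) c 0<c) (proj₂ (weight-symmetric G i j e) c 0<c)))
          where
          e′ : adjacent G j i ≡ true
          e′ = trans (sym (symmetric G i j)) e

        term : Subset n → Fin n → Fin n → ℝ
        term S i j = if lookup S i ∧ not (lookup S j) ∧ adjacent G i j then weight G i j else 0ℝ

        entry-close : ∀ S i j → Eventually (λ k → EdgeClose (crosses (lookup S) i j ℕ.* q i j) (seq (term S i j) k))
        entry-close S i j = go (lookup S i) (lookup S j) (adjacent G i j) refl
          where
          none : EdgeClose 0 0ℚ
          none = ℚ.≤-reflexive (sym zero-Y) ,
            ℚ.≤-reflexive (trans (ℚ.*-zeroʳ (ι D)) (sym (trans (cong ((ι D ℚ.+ 1ℚ) ℚ.*_) zero-Y) (ℚ.*-zeroʳ (ι D ℚ.+ 1ℚ))))) ,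
            ℚ.≤-reflexive (trans (trans (cong ((ι D ℚ.- 1ℚ) ℚ.*_) zero-Y) (ℚ.*-zeroʳ (ι D ℚ.- 1ℚ))) (sym (ℚ.*-zeroʳ (ι D))))
            where
            zero-Y : ι 2 ℚ.* ι P ℚ.* 0ℚ ≡ 0ℚ
            zero-Y = ℚ.*-zeroʳ (ι 2 ℚ.* ι P)
          go : ∀ s t e → adjacent G i j ≡ e →
            Eventually (λ k → EdgeClose (⟦ s ∧ not t ⟧ ℕ.* q i j) (seq (if s ∧ not t ∧ e then weight G i j else 0ℝ) k))
          go false t     e     eq = 0 , λ _ _ → none
          go true  true  e     eq = 0 , λ _ _ → none
          go true  false false eq = 0 , λ _ _ → subst (λ Q → EdgeClose Q 0ℚ)
            (sym (trans (ℕ.+-identityʳ _) (cong₂ ℕ._+_ (rounded-off eq) (rounded-off (trans (sym (symmetric G i j)) eq))))) none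
          go true  false true  eq = map-ev (λ k → subst (λ Q → EdgeClose Q (seq (weight G i j) k)) (sym (ℕ.+-identityʳ (q i j)))) (edge-close eq)

        -- The index from which an entry is close depends on the pair. There are finitely many
        -- pairs, so from some index on the inequalities hold together and can be added.
        cut-close : ∀ S → Eventually (λ k → EdgeClose (cut q (lookup S) (allFin n)) (seq (cutWeight G S) k))
        cut-close S = map-ev close (all-ev λ i → all-ev λ j → entry-close S i j)
          where
          Q : ℕ
          Q = cut q (lookup S) (allFin n)
          f : Fin n → Fin n → ℚ
          f i j = ι (crosses (lookup S) i j ℕ.* q i j)
          g : ℕ → Fin n → Fin n → ℚ
          g k i j = ι 2 ℚ.* ι P ℚ.* seq (term S i j) k
          ∑ℚ²-*ˡ : ∀ a (h : Fin n → Fin n → ℚ) → ∑ℚ (λ i → ∑ℚ λ j → a ℚ.* h i j) ≡ a ℚ.* ∑ℚ (λ i → ∑ℚ (h i))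
          ∑ℚ²-*ˡ a h = trans (∑ℚ-cong λ i → ∑ℚ-*ˡ a (h i)) (∑ℚ-*ˡ a λ i → ∑ℚ (h i))
          Q-sum : ι Q ≡ ∑ℚ (λ i → ∑ℚ (f i))
          Q-sum = trans (ι-∑-allFin (λ i → Sums.∑ (allFin n) (λ j → crosses (lookup S) i j ℕ.* q i j)))
            (∑ℚ-cong {n} λ i → ι-∑-allFin (λ j → crosses (lookup S) i j ℕ.* q i j))
          ∑ℚ-zero : ∑ℚ {n} (λ _ → 0ℚ) ≡ 0ℚ
          ∑ℚ-zero = trans (∑ℚ-const n 0ℚ) (ℚ.*-zeroʳ (ι n))
          w-sum : ∀ k → ι 2 ℚ.* ι P ℚ.* seq (cutWeight G S) k ≡ ∑ℚ (λ i → ∑ℚ (g k i))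
          w-sum k = sym (trans (∑ℚ²-*ˡ (ι 2 ℚ.* ι P) λ i j → seq (term S i j) k) (cong (ι 2 ℚ.* ι P ℚ.*_)
            (sym (trans (seq-∑ (λ i → ∑ (term S i)) k) (∑ℚ-cong λ i → seq-∑ (term S i) k)))))
          linear : ∀ a b (h h′ : Fin n → Fin n → ℚ) → (∀ i j → a ℚ.* h i j ℚ.≤ b ℚ.* h′ i j) →
            a ℚ.* ∑ℚ (λ i → ∑ℚ (h i)) ℚ.≤ b ℚ.* ∑ℚ (λ i → ∑ℚ (h′ i))
          linear a b h h′ le = subst₂ ℚ._≤_ (∑ℚ²-*ˡ a h) (∑ℚ²-*ˡ b h′) (∑ℚ-mono λ i → ∑ℚ-mono (le i))
          close : ∀ k → (∀ i j → EdgeClose (crosses (lookup S) i j ℕ.* q i j) (seq (term S i j) k)) → EdgeClose Q (seq (cutWeight G S) k)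
          close k entries =
            ℚ.≤-trans (ℚ.≤-reflexive (sym (trans (∑ℚ-cong {n} {λ _ → ∑ℚ {n} (λ _ → 0ℚ)} {λ _ → 0ℚ} λ _ → ∑ℚ-zero) ∑ℚ-zero)))
              (ℚ.≤-trans (∑ℚ-mono λ i → ∑ℚ-mono λ j → proj₁ (entries i j)) (ℚ.≤-reflexive (sym (w-sum k)))) ,
            subst₂ (λ Q Y → ι D ℚ.* Q ℚ.≤ (ι D ℚ.+ 1ℚ) ℚ.* Y) (sym Q-sum) (sym (w-sum k)) (linear (ι D) (ι D ℚ.+ 1ℚ) f (g k) λ i j → proj₁ (proj₂ (entries i j))) ,
            subst₂ (λ Q Y → (ι D ℚ.- 1ℚ) ℚ.* Y ℚ.≤ ι D ℚ.* Q) (sym Q-sum) (sym (w-sum k)) (linear (ι D ℚ.- 1ℚ) (ι D) (g k) f λ i j → proj₂ (proj₂ (entries i j)))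

-- Choice of the parameters and assembly of the sketch.

module Parameters (n : ℕ) .{{_ : ℕ.NonZero n}} (ε W : ℝ)
                  (1/n<ε : fromℚ (+ 1 ℚ./ n) < ε) (ε<1/30 : ε < fromℚ (+ 1 ℚ./ 30)) (1≤W : 1ℝ ≤ W) where
  open import Data.Bool.Base using (Bool; true; false; not)
  open import Data.List.Base using (List; length; allFin)
  open import Data.List.Membership.Propositional.Properties using (∈-lookup)
  open import Data.Nat.Base using (suc)
  import Data.Nat.Properties as ℕ
  open import Data.Nat.Tactic.RingSolver using (solve-∀)
  open import Data.Product.Base using (∃-syntax; _,_; proj₁; proj₂)
  open import Data.Rational.Base using (0ℚ; 1ℚ; ½)
  import Data.Rational.Properties as ℚ
  open import Data.Rational.Solver using (module +-*-Solver)
  open import Data.Vec.Base using (lookup)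
  open import Relation.Binary.PropositionalEquality
  open +-*-Solver using (solve; _:+_; _:*_; _:=_; con)
  open Log
  open ContractedGraph using (cut)
  open Rationals
  open Sequences
  open IntegerTheorem
  open RealSketch

  1/n≤ε : Eventually (λ k → + 1 ℚ./ n ℚ.≤ seq ε k)
  1/n≤ε = <⇒eventually-≤ {fromℚ (+ 1 ℚ./ n)} {ε} 1/n<ε

  ε≤1/30 : Eventually (λ k → seq ε k ℚ.≤ + 1 ℚ./ 30)
  ε≤1/30 = <⇒eventually-≤ {ε} {fromℚ (+ 1 ℚ./ 30)} ε<1/30

  abstract

    scale-exists : ∃[ D ] (1 ℕ.≤ D × D ℕ.≤ 3 ℕ.* n × Eventually (λ k → 1ℚ ℚ.≤ ι D ℚ.* seq ε k × ι D ℚ.* seq ε k ℚ.≤ ι 4))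
    scale-exists = inverse-scale n {seq ε} (cauchy ε)
      (zip-ev (λ k lo hi → lo , ℚ.≤-trans hi 1/30≤1) 1/n≤ε ε≤1/30)
      where
      1/30≤1 : + 1 ℚ./ 30 ℚ.≤ 1ℚ
      1/30≤1 = ℚ.≤-trans (ℚ.≤-reflexive (sym (ℚ.*-identityˡ (+ 1 ℚ./ 30))))
        (*-monoʳ (ℚ.<⇒≤ (ℚ.positive⁻¹ (+ 1 ℚ./ 30))) (ι-mono {1} {30} (ℕ.m≤m+n 1 29)))

    weight-bound : ∃[ w ] Eventually (λ k → seq W k ℚ.+ ι 2 ℚ.≤ ι w × ι w ℚ.≤ seq W k ℚ.+ ι 5)
    weight-bound = upper-integer {seq W} (cauchy W)
      (1≤⇒eventually-½≤ {W} 1≤W)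

  D maxWeight L ℓ₀ P : ℕ
  D = proj₁ scale-exists
  maxWeight = proj₁ weight-bound
  -- The successor guarantees a trial, and 2 ^ L ≥ n brings the failure probability of the median of
  -- L trials down to 1 / n.
  L = suc (lg n)
  ℓ₀ = lg (lg maxWeight)
  P = 2 ℕ.^ (L ℕ.+ 5)

  1≤D : 1 ℕ.≤ D
  1≤D = proj₁ (proj₂ scale-exists)

  Dε : Eventually (λ k → 1ℚ ℚ.≤ ι D ℚ.* seq ε k × ι D ℚ.* seq ε k ℚ.≤ ι 4)
  Dε = proj₂ (proj₂ (proj₂ scale-exists))

  n≤ : n ℕ.≤ 2 ℕ.^ L
  n≤ = ℕ.≤-trans (≤2^lg n) (2^-mono (ℕ.n≤1+n (lg n)))

  D≤ : D ℕ.≤ 2 ℕ.^ (L ℕ.+ 2)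
  D≤ = scale-≤ L n≤ (proj₁ (proj₂ (proj₂ scale-exists)))

  8D≤P : 8 ℕ.* D ℕ.≤ P
  8D≤P = precision-≥ L D≤

  2≤P : 2 ℕ.≤ P
  2≤P = 2^-mono {1} {L ℕ.+ 5} (ℕ.s≤s ℕ.z≤n)

  instance
    P≢0 : ℕ.NonZero P
    P≢0 = ℕ.m^n≢0 2 (L ℕ.+ 5)

    2PD≢0 : ℕ.NonZero (D ℕ.* (2 ℕ.* P))
    2PD≢0 = ℕ.m*n≢0 D (2 ℕ.* P) {{ℕ.>-nonZero 1≤D}} {{ℕ.m*n≢0 2 P}}

  maxWeight≤ : maxWeight ℕ.≤ 2 ℕ.^ (2 ℕ.^ ℓ₀)
  maxWeight≤ = ℕ.≤-trans (≤2^lg maxWeight) (2^-mono (≤2^lg (lg maxWeight)))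

  module _ (G : Graph n W) where
    open Rounding P G

    rounded≤ : ∀ i j → rounded i j ℕ.≤ P ℕ.* maxWeight
    rounded≤ i j = case (adjacent G i j) refl
      where
      case : ∀ e → adjacent G i j ≡ e → rounded i j ℕ.≤ P ℕ.* maxWeight
      case true  eq = rounded-bound 2≤P eq (map-ev (λ k → proj₁) (proj₂ weight-bound))
      case false eq = subst (ℕ._≤ P ℕ.* maxWeight) (sym (rounded-off eq)) ℕ.z≤n

    q≤ : ∀ i j → q i j ℕ.≤ 2 ℕ.^ (2 ℕ.^ ℓ₀ ℕ.+ L ℕ.+ 6)
    q≤ i j = symmetrised-≤ L (2 ℕ.^ ℓ₀) (rounded≤ i j) (rounded≤ j i) maxWeight≤

    integerSketch : RandomSketch (estimateBits D) D L ℓ₀ q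
    integerSketch = randomSketch D L ℓ₀ 1≤D D≤ (ℕ.s≤s ℕ.z≤n) n≤ q q-sym q≤

    module I = RandomSketch integerSketch

    randomBits : Distribution (List Bool)
    randomBits = uniform I.outcomes {{ℕ.>-nonZero I.nonempty}}

  -- The integer estimate is D times a cut whose weights have been scaled by 2 P.
  c : ℚ
  c = + 1 ℚ./ (D ℕ.* (2 ℕ.* P))

  unit : ι D ℚ.* (ι 2 ℚ.* ι P) ℚ.* c ≡ 1ℚ
  unit = trans (cong (ℚ._* c) (sym (trans (ι-* D (2 ℕ.* P)) (cong (ι D ℚ.*_) (ι-* 2 P))))) (n*1/n (D ℕ.* (2 ℕ.* P)))

  0≤c : 0ℚ ℚ.≤ c
  0≤c = inverse-nonneg (0≤ι (D ℕ.* (2 ℕ.* P))) (n*1/n (D ℕ.* (2 ℕ.* P)))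

  cutSketch : CutSketch n W
  cutSketch = record
    { sketch   = randomBits
    ; estimate = λ o S → fromℚ (ι (estimateBits D o (lookup S)) ℚ.* c) }

  approximates : ∀ (G : Graph n W) S z → let Q = cut (Rounding.q P G) (lookup S) (allFin n) in
    D ℕ.* Q ℕ.≤ z ℕ.+ 11 ℕ.* Q → z ℕ.≤ D ℕ.* Q ℕ.+ 9 ℕ.* Q → Approximates 23 ε (cutWeight G S) (fromℚ (ι z ℚ.* c))
  approximates G S z lower upper =
    eventually-≤ {(1ℝ - fromℕ 23 * ε) * cutWeight G S} {fromℚ (ι z ℚ.* c)} (map-ev (λ k → proj₁) both) ,
    eventually-≤ {fromℚ (ι z ℚ.* c)} {(1ℝ + fromℕ 23 * ε) * cutWeight G S} (map-ev (λ k → proj₂) both)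
    where
    Q : ℕ
    Q = cut (Rounding.q P G) (lookup S) (allFin n)
    lowerℚ : ι D ℚ.* ι Q ℚ.≤ ι z ℚ.+ ι 11 ℚ.* ι Q
    lowerℚ = subst₂ ℚ._≤_ (ι-* D Q) (trans (ι-+ z (11 ℕ.* Q)) (cong (λ t → ι z ℚ.+ t) (ι-* 11 Q))) (ι-mono lower)
    upperℚ : ι z ℚ.≤ ι D ℚ.* ι Q ℚ.+ ι 9 ℚ.* ι Q
    upperℚ = subst (ι z ℚ.≤_) (trans (ι-+ (D ℕ.* Q) (9 ℕ.* Q)) (cong₂ ℚ._+_ (ι-* D Q) (ι-* 9 Q))) (ι-mono upper)
    both : Eventually (λ k → (1ℚ ℚ.- ι 23 ℚ.* seq ε k) ℚ.* seq (cutWeight G S) k ℚ.≤ ι z ℚ.* c ×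
                             ι z ℚ.* c ℚ.≤ (1ℚ ℚ.+ ι 23 ℚ.* seq ε k) ℚ.* seq (cutWeight G S) k)
    both = zip-ev (λ k (0≤Y , Q≤ , ≤Q) (1≤Dε , _) →
        rescale-error {ι D} {seq ε k} {ι P} {c} {seq (cutWeight G S) k} {ι z} 0≤c unit 0≤Y 1≤Dε
          (estimate-error {ι D} {ι Q} {ι z} (ι-mono 1≤D) 0≤Y Q≤ ≤Q lowerℚ upperℚ))
      (Rounding.cut-close P G 2≤P D 8D≤P S) Dε

  forEach : ForEach 23 1 ε cutSketch
  forEach G S = uniform-Pr (I.outcomes G) {{ℕ.>-nonZero (I.nonempty G)}} (n ℕ.^ 1) {{ℕ.m^n≢0 n 1}}
    (λ o → accurate D Q (estimateBits D o (lookup S)))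
    (λ o → Approximates 23 ε (cutWeight G S) (fromℚ (ι (estimateBits D o (lookup S)) ℚ.* c)))
    (λ o good → let lower , upper = accurate-sound D Q (estimateBits D o (lookup S)) good in
       approximates G S (estimateBits D o (lookup S)) lower upper)
    (subst (λ m → Sums.∑ (I.outcomes G) (λ o → Sums.⟦ not (accurate D Q (estimateBits D o (lookup S))) ⟧) ℕ.* m ℕ.≤ length (I.outcomes G)) (sym (ℕ.*-identityʳ n)) (I.reliable G (lookup S)))
    where
    Q : ℕ
    Q = cut (Rounding.q P G) (lookup S) (allFin n)

  hasSize : HasSize cutSketch (sketchSize n D L ℓ₀)
  hasSize G i = I.short G (∈-lookup i)

  -- The size is at most F D with F free of ε, and D ε ≤ 4 gives 184320 = 4 * 46080. The given ℓ and
  -- m are arbitrary upper bounds, so ℓ₀ and L, which were computed from approximations, have to be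
  -- compared with them.
  sizeÕ : SizeÕ 184320 3 n ε W (sketchSize n D L ℓ₀)
  sizeÕ ℓ m 1≤ℓ W≤ nℓ≤ = eventually-≤ {fromℕ s * ε} {fromℕ (184320 ℕ.* (n ℕ.* ℓ) ℕ.* m ℕ.^ 3)} (zip-ev bound 1/n≤ε Dε)
    where
    s F x : ℕ
    s = sketchSize n D L ℓ₀
    F = 46080 ℕ.* (n ℕ.* ℓ) ℕ.* m ℕ.^ 3
    x = 2 ℕ.^ (2 ℕ.^ ℓ)
    maxWeight≤x+6 : maxWeight ℕ.≤ x ℕ.+ 6
    maxWeight≤x+6 = ι-cancel (ℚ.≤-trans (always (zip-ev (λ k (_ , w≤) W≤x → shift (ℚ.+-mono-≤ w≤ W≤x) (regroup (ι maxWeight) (seq W k) (ι x)))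
        (proj₂ weight-bound) (W≤ 1ℚ (ℚ.positive⁻¹ 1ℚ)))) (ℚ.≤-reflexive (sym (ι-+ x 6))))
      where
      regroup : ∀ w v x → w ℚ.+ (v ℚ.+ ι 5 ℚ.+ (x ℚ.+ 1ℚ)) ≡ x ℚ.+ ι 6 ℚ.+ (w ℚ.+ v)
      regroup = solve 3 (λ w v x → w :+ (v :+ con (ι 5) :+ (x :+ con 1ℚ)) := x :+ con (ι 6) :+ (w :+ v)) refl
    ℓ₀≤ : ℓ₀ ℕ.≤ suc ℓ
    ℓ₀≤ = lg-least (lg-least (ℕ.≤-trans maxWeight≤x+6 (tower-slack 1≤ℓ)))
    30nℓ≤ : 30 ℕ.* (n ℕ.* ℓ) ℕ.≤ 2 ℕ.^ m ℕ.+ 15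
    30nℓ≤ = ι-cancel (ℚ.≤-trans (ℚ.≤-reflexive (ι-* 30 (n ℕ.* ℓ))) (ℚ.≤-trans
        (always (zip-ev (λ k → step (ι (n ℕ.* ℓ)) (ι (2 ℕ.^ m)) (seq ε k) (0≤ι (2 ℕ.^ m))) ε≤1/30 (nℓ≤ ½ (ℚ.positive⁻¹ ½))))
        (ℚ.≤-reflexive (sym (ι-+ (2 ℕ.^ m) 15)))))
      where
      step : ∀ N M e → 0ℚ ℚ.≤ M → e ℚ.≤ + 1 ℚ./ 30 → N ℚ.≤ M ℚ.* e ℚ.+ ½ → ι 30 ℚ.* N ℚ.≤ M ℚ.+ ι 15
      step N M e 0≤M e≤ N≤ = shift (ℚ.+-mono-≤ (*-monoˡ (0≤ι 30) N≤) (*-monoˡ (0≤ι 30) (*-monoˡ 0≤M e≤)))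
        (solve 3 (λ N M e → con (ι 30) :* N :+ (con (ι 30) :* (M :* e :+ con ½) :+ con (ι 30) :* (M :* con (+ 1 ℚ./ 30)))
          := M :+ con (ι 15) :+ (con (ι 30) :* N :+ con (ι 30) :* (M :* e))) refl N M e)
    L≤ : L ℕ.≤ 2 ℕ.* m
    L≤ = suc-lg-≤ m (ℕ.>-nonZero⁻¹ n) 1≤ℓ 30nℓ≤
    s≤ : s ℕ.≤ F ℕ.* D
    s≤ = sketchSize-≤ n D L ℓ₀ ℓ m 1≤ℓ ℓ₀≤ (ℕ.s≤s ℕ.z≤n) L≤
    4F≡ : F ℕ.* 4 ≡ 184320 ℕ.* (n ℕ.* ℓ) ℕ.* m ℕ.^ 3
    4F≡ = quadruple (n ℕ.* ℓ) (m ℕ.^ 3)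
      where
      quadruple : ∀ a b → 46080 ℕ.* a ℕ.* b ℕ.* 4 ≡ 184320 ℕ.* a ℕ.* b
      quadruple = solve-∀
    bound : ∀ k → + 1 ℚ./ n ℚ.≤ seq ε k → 1ℚ ℚ.≤ ι D ℚ.* seq ε k × ι D ℚ.* seq ε k ℚ.≤ ι 4 →
      ι s ℚ.* seq ε k ℚ.≤ ι (184320 ℕ.* (n ℕ.* ℓ) ℕ.* m ℕ.^ 3)
    bound k 1/n≤ (_ , Dε≤4) = begin
      ι s ℚ.* seq ε k ≤⟨ *-monoʳ (ℚ.≤-trans (inverse-nonneg (0≤ι n) (n*1/n n)) 1/n≤) (ι-mono s≤) ⟩
      ι (F ℕ.* D) ℚ.* seq ε k ≡⟨ trans (cong (ℚ._* seq ε k) (ι-* F D)) (ℚ.*-assoc (ι F) (ι D) (seq ε k)) ⟩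
      ι F ℚ.* (ι D ℚ.* seq ε k) ≤⟨ *-monoˡ (0≤ι F) Dε≤4 ⟩
      ι F ℚ.* ι 4 ≡⟨ trans (sym (ι-* F 4)) (cong ι 4F≡) ⟩
      ι (184320 ℕ.* (n ℕ.* ℓ) ℕ.* m ℕ.^ 3) ∎
      where open ℚ.≤-Reasoning

theorem4p12 : Σ[ K ∈ ℕ ] Σ[ a ∈ ℕ ] Σ[ C ∈ ℕ ] Σ[ c ∈ ℕ ] (1 ℕ.≤ a ×
    (∀ (n : ℕ) .{{_ : ℕ.NonZero n}} (ε W : ℝ) →
    fromℚ (+ 1 ℚ./ n) < ε → ε < fromℚ (+ 1 ℚ./ 30) → 1ℝ ≤ W →
    Σ[ s ∈ ℕ ] Σ[ sk ∈ CutSketch n W ]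
    (SizeÕ C c n ε W s × HasSize sk s × ForEach K a ε sk)))
theorem4p12 = 23 , 1 , 184320 , 3 , ℕ.s≤s ℕ.z≤n , λ n ε W 1/n<ε ε<1/30 1≤W →
  let open Parameters n ε W 1/n<ε ε<1/30 1≤W in
  sketchSize n D L ℓ₀ , cutSketch , sizeÕ , hasSize , forEach
  where
  open import Data.Product.Base using (_,_)
  open IntegerTheorem using (sketchSize)
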